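{- For all $n \geq 0$, $$p_{\xi}(16n+14) \equiv 0 \pmod{8},\qquad p_{\xi}(24n+13) \equiv 0 \pmod{8},\qquad p_{\xi}(24n+22) \equiv 0 \pmod{8}.$$
   Context: $(a;q)_n=(1-a)(1-aq)\cdots(1-aq^{n-1})$, $(a;q)_0=1$. The coefficients $p_\xi(n)$ are defined by $\sum_{n\ge0}p_\xi(n)q^n=\xi(q)=1+2\sum_{n\ge1}\frac{q^{6n^2-6n+1}}{(q;q^6)_n(q^5;q^6)_n}$. -}

module Defs where

open import Data.Nat using (ℕ; zero; suc; _+_; _*_; _∸_; _≤ᵇ_)
open import Data.Bool using (if_then_else_)

Series : Set
Series = ℕ → ℕ

sumTo : ℕ → (ℕ → ℕ) → ℕ
sumTo zero    f = f zero
sumTo (suc m) f = sumTo m f + f (suc m)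

-- Multiplication of a series f by 1/(1 - q^k):  coefficient of q^m is
-- Σ_{i ≥ 0, i*k ≤ m} f(m - i*k).  (For k ≥ 1 the terms with i ≤ m suffice.)
divGeom : ℕ → Series → Series
divGeom k f m = sumTo m (λ i → if i * k ≤ᵇ m then f (m ∸ i * k) else 0)

-- 1 / ((q;q^6)_n (q^5;q^6)_n) = Π_{j<n} 1/((1 - q^{6j+1})(1 - q^{6j+5}))
invProd : ℕ → Series
invProd zero    m = if m ≤ᵇ 0 then 1 else 0
invProd (suc n) = divGeom (6 * n + 1) (divGeom (6 * n + 5) (invProd n))

shift : ℕ → Series → Series
shift e f m = if e ≤ᵇ m then f (m ∸ e) else 0

term : ℕ → Series
term n = shift (6 * n * n ∸ 6 * n + 1) (invProd n)

-- p_ξ(N): coefficient of q^N in ξ(q) = 1 + 2 Σ_{n≥1} term n.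
-- Summand n has lowest exponent 6n²-6n+1 ≥ n, so only n ≤ N contribute to q^N.
pξ : ℕ → ℕ
pξ N = (if N ≤ᵇ 0 then 1 else 0) + 2 * sumTo N (λ n → if 1 ≤ᵇ n then term n N else 0)

{-# OPTIONS --safe #-}

-- Write ξ = 1 + 2A, u = q, v = q⁵, Q = uv and f_k = Π (1 - q^{kn}), and let φ(-q) = Σ (-1)^n q^{n²}.
-- Expanding the products in A into partial fractions and summing over n with the
-- q-Vandermonde identity gives
--   f_6 A = q Σ_{r ∈ ℤ} (-1)^r Q^{3r(r+1)/2} / (1 - u Q^r).
-- Multiplication by ψ(q⁶) = f_12² / f_6 makes the left side a power series in q¹² times A,
-- and completing the square in the resulting lattice sum shows that its part with
-- exponents ≡ 1 or 2 (mod 4) is a theta series in q⁴ times the reciprocal theta function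
-- Σ_{r ∈ ℤ} (-1)^r Q^{r(r+1)/2} / (1 - u Q^r) at q⁴: the two lattice sums differ only in
-- which half line r runs over, and Σ_{r ∈ ℤ} vanishes by r ↦ -1 - 2m - r. With the triple
-- product, X = Σ a(4n+2) qⁿ and Z = Σ a(4n+1) qⁿ satisfy
--   X φ(-q) = φ(-q²) f_12   and   Z φ(-q) = ψ(-q) Π (1 - (-q³)ⁿ).
-- As φ² ≡ 1 (mod 4), X ≡ φ(-q) φ(-q²) f_12, whose coefficients at 4n + 3 and 6n + 5
-- vanish modulo 4, and Σ a(12n+1) qⁿ ≡ φ(-q³) φ(q³) f_2 ≡ f_2, which is even.

module Submission where

open import Defs
open import Data.Nat using (ℕ; _+_; _*_)
open import Data.Nat.Divisibility using (_∣_)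
open import Data.Product using (_×_)
open import Data.Product using (_,_; Σ; proj₁; proj₂)
open import Data.Sum using (_⊎_; inj₁; inj₂)
open import Data.Bool using (if_then_else_)
open import Data.Maybe using (just; nothing)
open import Data.Nat using (zero; suc; NonZero; z≤n; s≤s; _∸_; _%_; _≤_; _<_; _≤ᵇ_)
import Data.Nat as ℕ
import Data.Nat.Divisibility as Div
import Data.Nat.DivMod as DivMod
import Data.Nat.Properties as ℕₚ
import Data.Nat.Tactic.RingSolver as ℕ-Solver
open import Data.Integer using (ℤ)
import Data.Integer as ℤ
import Data.Integer.Properties as ℤₚ
open import Data.Integer.Tactic.RingSolver using (solve-∀)
open import Relation.Nullary using (yes; no; contradiction)
open import Relation.Nullary.Decidable using (from-yes; ¬?)
open import Relation.Binary.Definitions using (WeaklyDecidable)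
open import Relation.Binary.PropositionalEquality as ≡ using (_≡_; _≢_; cong; cong₂)
import Relation.Binary.Reasoning.Setoid
open import Algebra.Bundles using (CommutativeRing)
open import Algebra.Structures using (IsCommutativeRing)
open import Algebra.Properties.AbelianGroup ℤₚ.+-0-abelianGroup using () renaming (∙-cancelʳ to ℤ-+-cancelʳ)
open import Algebra.Solver.Ring.AlmostCommutativeRing
  using (fromCommutativeRing; _-Raw-AlmostCommutative⟶_; Induced-equivalence)
import Algebra.Solver.Ring
open import Level using (0ℓ)

-- Formal power series over ℤ

-- The factor ψ(q⁶) is dictated by a quadratic form. The exponents of f_6 A / q are 9(r² + r) + 6rM
-- + M, and ψ(q⁶) adds 12x² - 6x = 3((4x - 1)² - 1)/4. Replacing 4x - 1 by 4k - 2r - 1, up to sign,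
-- contributes 3(r² + r) and a mixed term -12rk, so 9 becomes 12. In the class 0 modulo 4 the
-- exponent then forces M = 2k + 4m, which removes the mixed term and leaves four times the sum of a
-- form in k and a form in (m, r). The class 1 works with 4k + 2r - 1 and M = 1 - 2k + 4m. In the
-- expansion r and M lie on the same side of zero, and the substitution does not keep that property;
-- hence the need to change the half line. The reflection of r mixes both half lines and is no
-- formal rearrangement of the series, so coefficients are compared over finite boxes. For fixed m
-- only finitely many r give a prescribed exponent, but their range grows with m, which is why r
-- gets a larger box. The congruence for a(12n + 1) closes with φ(-q³) φ(q³) = φ(-q⁶)².

S : Set
S = ℕ → ℤ

tail : S → S
tail f n = f (suc n)

infix 4 _≋_
_≋_ : S → S → Set
f ≋ g = ∀ n → f n ≡ g n

const : ℤ → S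
const c zero    = c
const c (suc _) = ℤ.0ℤ

-- The Cauchy product by recursion on the degree: fg = f(0) g + q (tail f) g. The ring laws then
-- follow by induction, without manipulating index sums.
conv : S → S → S
conv f g zero    = f 0 ℤ.* g 0
conv f g (suc n) = f 0 ℤ.* g (suc n) ℤ.+ conv (tail f) g n

conv-cong : ∀ {f f′ g g′} → f ≋ f′ → g ≋ g′ → conv f g ≋ conv f′ g′
conv-cong p r zero    = cong₂ ℤ._*_ (p 0) (r 0)
conv-cong p r (suc n) =
  cong₂ ℤ._+_ (cong₂ ℤ._*_ (p 0) (r (suc n))) (conv-cong (λ k → p (suc k)) r n)

conv-distribʳ : ∀ h f g → conv (λ n → f n ℤ.+ g n) h ≋ (λ n → conv f h n ℤ.+ conv g h n)
conv-distribʳ h f g zero    = ℤₚ.*-distribʳ-+ (h 0) (f 0) (g 0)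
conv-distribʳ h f g (suc n) =
  ≡.trans (cong (λ z → (f 0 ℤ.+ g 0) ℤ.* h (suc n) ℤ.+ z) (conv-distribʳ h (tail f) (tail g) n))
          (lemma (f 0) (g 0) (h (suc n)) (conv (tail f) h n) (conv (tail g) h n))
  where
  lemma : ∀ a b c x y → (a ℤ.+ b) ℤ.* c ℤ.+ (x ℤ.+ y) ≡ (a ℤ.* c ℤ.+ x) ℤ.+ (b ℤ.* c ℤ.+ y)
  lemma = solve-∀

conv-scale : ∀ c f g → conv (λ n → c ℤ.* f n) g ≋ (λ n → c ℤ.* conv f g n)
conv-scale c f g zero    = ℤₚ.*-assoc c (f 0) (g 0)
conv-scale c f g (suc n) =
  ≡.trans (cong (λ z → c ℤ.* f 0 ℤ.* g (suc n) ℤ.+ z) (conv-scale c (tail f) g n))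
          (lemma c (f 0) (g (suc n)) (conv (tail f) g n))
  where
  lemma : ∀ c a b x → c ℤ.* a ℤ.* b ℤ.+ c ℤ.* x ≡ c ℤ.* (a ℤ.* b ℤ.+ x)
  lemma = solve-∀

conv-sucʳ : ∀ f g n → conv f g (suc n) ≡ f (suc n) ℤ.* g 0 ℤ.+ conv f (tail g) n
conv-sucʳ f g zero    = ℤₚ.+-comm (f 0 ℤ.* g 1) (f 1 ℤ.* g 0)
conv-sucʳ f g (suc n) =
  ≡.trans (cong (λ z → f 0 ℤ.* g (suc (suc n)) ℤ.+ z) (conv-sucʳ (tail f) g n))
          (lemma (f 0 ℤ.* g (suc (suc n))) (f (suc (suc n)) ℤ.* g 0) (conv (tail f) (tail g) n))
  where
  lemma : ∀ a b c → a ℤ.+ (b ℤ.+ c) ≡ b ℤ.+ (a ℤ.+ c)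
  lemma = solve-∀

conv-comm : ∀ f g → conv f g ≋ conv g f
conv-comm f g zero    = ℤₚ.*-comm (f 0) (g 0)
conv-comm f g (suc n) =
  ≡.trans (cong₂ ℤ._+_ (ℤₚ.*-comm (f 0) (g (suc n))) (conv-comm (tail f) g n))
          (≡.sym (conv-sucʳ g f n))

conv-assoc : ∀ f g h → conv (conv f g) h ≋ conv f (conv g h)
conv-assoc f g h zero    = ℤₚ.*-assoc (f 0) (g 0) (h 0)
conv-assoc f g h (suc n) = begin
    f 0 ℤ.* g 0 ℤ.* h (suc n) ℤ.+ conv (tail (conv f g)) h n
      ≡⟨ cong (λ z → f 0 ℤ.* g 0 ℤ.* h (suc n) ℤ.+ z) (conv-distribʳ h (λ k → f 0 ℤ.* tail g k) (conv (tail f) g) n) ⟩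
    f 0 ℤ.* g 0 ℤ.* h (suc n) ℤ.+ (conv (λ k → f 0 ℤ.* tail g k) h n ℤ.+ conv (conv (tail f) g) h n)
      ≡⟨ cong (λ z → f 0 ℤ.* g 0 ℤ.* h (suc n) ℤ.+ z) (cong₂ ℤ._+_ (conv-scale (f 0) (tail g) h n) (conv-assoc (tail f) g h n)) ⟩
    f 0 ℤ.* g 0 ℤ.* h (suc n) ℤ.+ (f 0 ℤ.* conv (tail g) h n ℤ.+ conv (tail f) (conv g h) n)
      ≡⟨ lemma (f 0) (g 0) (h (suc n)) (conv (tail g) h n) (conv (tail f) (conv g h) n) ⟩
    f 0 ℤ.* (g 0 ℤ.* h (suc n) ℤ.+ conv (tail g) h n) ℤ.+ conv (tail f) (conv g h) n ∎
  where
  open ≡.≡-Reasoning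
  lemma : ∀ a b c x y → a ℤ.* b ℤ.* c ℤ.+ (a ℤ.* x ℤ.+ y) ≡ a ℤ.* (b ℤ.* c ℤ.+ x) ℤ.+ y
  lemma = solve-∀

conv-zeroˡ : ∀ {f} g → (∀ n → f n ≡ ℤ.0ℤ) → ∀ n → conv f g n ≡ ℤ.0ℤ
conv-zeroˡ g p zero    rewrite p 0 = ℤₚ.*-zeroˡ (g 0)
conv-zeroˡ g p (suc n) rewrite p 0 | ℤₚ.*-zeroˡ (g (suc n)) =
  ≡.trans (ℤₚ.+-identityˡ _) (conv-zeroˡ g (λ k → p (suc k)) n)

conv-const : ∀ c g n → conv (const c) g n ≡ c ℤ.* g n
conv-const c g zero    = ≡.refl
conv-const c g (suc n) =
  ≡.trans (cong (λ z → c ℤ.* g (suc n) ℤ.+ z) (conv-zeroˡ g (λ _ → ≡.refl) n)) (ℤₚ.+-identityʳ _)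

const-* : ∀ a b → const (a ℤ.* b) ≋ conv (const a) (const b)
const-* a b zero    = ≡.refl
const-* a b (suc n) = ≡.sym (≡.trans (conv-const a (const b) (suc n)) (ℤₚ.*-zeroʳ a))

opaque
  infixl 6 _⊕_
  infixl 7 _⊛_
  infix  8 ⊖_

  _⊕_ : S → S → S
  (f ⊕ g) n = f n ℤ.+ g n

  _⊛_ : S → S → S
  _⊛_ = conv

  ⊖_ : S → S
  (⊖ f) n = ℤ.- f n

  𝟎 : S
  𝟎 _ = ℤ.0ℤ

  con : ℤ → S
  con = const

𝟏 : S
𝟏 = con ℤ.1ℤ

opaque
  unfolding _⊕_

  isCommutativeRing : IsCommutativeRing _≋_ _⊕_ _⊛_ ⊖_ 𝟎 𝟏
  isCommutativeRing = record
      { isRing = record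
        { +-isAbelianGroup = record
          { isGroup = record
            { isMonoid = record
              { isSemigroup = record
                { isMagma = record
                  { isEquivalence = record
                    { refl  = λ _ → ≡.refl
                    ; sym   = λ p n → ≡.sym (p n)
                    ; trans = λ p r n → ≡.trans (p n) (r n)
                    }
                  ; ∙-cong = λ p r n → cong₂ ℤ._+_ (p n) (r n)
                  }
                ; assoc = λ f g h n → ℤₚ.+-assoc (f n) (g n) (h n)
                }
              ; identity = (λ f n → ℤₚ.+-identityˡ (f n)) , (λ f n → ℤₚ.+-identityʳ (f n))
              }
            ; inverse = (λ f n → ℤₚ.+-inverseˡ (f n)) , (λ f n → ℤₚ.+-inverseʳ (f n))
            ; ⁻¹-cong = λ p n → cong ℤ.-_ (p n)
            }
          ; comm = λ f g n → ℤₚ.+-comm (f n) (g n)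
          }
        ; *-cong = conv-cong
        ; *-assoc = conv-assoc
        ; *-identity =
              (λ f n → ≡.trans (conv-const ℤ.1ℤ f n) (ℤₚ.*-identityˡ (f n)))
            , (λ f n → ≡.trans (conv-comm f (const ℤ.1ℤ) n)
                               (≡.trans (conv-const ℤ.1ℤ f n) (ℤₚ.*-identityˡ (f n))))
        ; distrib =
              (λ f g h n → ≡.trans (conv-comm f (λ k → g k ℤ.+ h k) n)
                  (≡.trans (conv-distribʳ f g h n) (cong₂ ℤ._+_ (conv-comm g f n) (conv-comm h f n))))
            , conv-distribʳ
        }
      ; *-comm = conv-comm
      }

𝕊 : CommutativeRing 0ℓ 0ℓ
𝕊 = record { isCommutativeRing = isCommutativeRing }

open CommutativeRing 𝕊 public using ()
  renaming ( refl to ≋-refl; sym to ≋-sym; trans to ≋-trans; setoid to ≋-setoid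
           ; +-cong to ⊕-cong; *-cong to ⊛-cong; -‿cong to ⊖-cong
           ; +-identityˡ to ⊕-identityˡ; +-identityʳ to ⊕-identityʳ; +-comm to ⊕-comm
           ; +-assoc to ⊕-assoc; -‿inverseʳ to ⊖-inverseʳ
           ; *-identityˡ to ⊛-identityˡ; *-identityʳ to ⊛-identityʳ; *-comm to ⊛-comm
           ; *-assoc to ⊛-assoc; zeroˡ to ⊛-zeroˡ; zeroʳ to ⊛-zeroʳ
           ; distribˡ to ⊛-distribˡ; distribʳ to ⊛-distribʳ )

opaque
  unfolding _⊕_

  con-+ : ∀ a b → con (a ℤ.+ b) ≋ con a ⊕ con b
  con-+ a b zero    = ≡.refl
  con-+ a b (suc n) = ≡.refl

  con-* : ∀ a b → con (a ℤ.* b) ≋ con a ⊛ con b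
  con-* = const-*

  con-neg : ∀ a → con (ℤ.- a) ≋ ⊖ con a
  con-neg a zero    = ≡.refl
  con-neg a (suc n) = ≡.refl

  con-0 : con ℤ.0ℤ ≋ 𝟎
  con-0 zero    = ≡.refl
  con-0 (suc n) = ≡.refl

con-homomorphism : CommutativeRing.rawRing ℤₚ.+-*-commutativeRing
                   -Raw-AlmostCommutative⟶ fromCommutativeRing 𝕊
con-homomorphism = record
  { ⟦_⟧    = con
  ; +-homo = con-+
  ; *-homo = con-*
  ; -‿homo = con-neg
  ; 0-homo = con-0
  ; 1-homo = ≋-refl
  }

con-≟ : WeaklyDecidable (Induced-equivalence con-homomorphism)
con-≟ a b with a ℤ.≟ b
... | yes ≡.refl = just ≋-refl
... | no  _      = nothing

module ⊛-Solver = Algebra.Solver.Ring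
  (CommutativeRing.rawRing ℤₚ.+-*-commutativeRing) (fromCommutativeRing 𝕊) con-homomorphism con-≟
open ⊛-Solver using (solve; _:=_; _:+_; _:*_; _:-_; :-_)

infixl 6 _⊝_
_⊝_ : S → S → S
f ⊝ g = f ⊕ ⊖ g

infixr 8 _↑_
_↑_ : S → ℕ → S
y ↑ zero  = 𝟏
y ↑ suc n = y ⊛ y ↑ n

module ≋-Reasoning = Relation.Binary.Reasoning.Setoid ≋-setoid

-- Truncation modulo q^N and order of vanishing

infix 4 _≈[_]_
_≈[_]_ : S → ℕ → S → Set
f ≈[ N ] g = ∀ n → n < N → f n ≡ g n

Ord : ℕ → S → Set
Ord N f = f ≈[ N ] 𝟎

≋⇒≈ : ∀ {N f g} → f ≋ g → f ≈[ N ] g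
≋⇒≈ p n _ = p n

≈⇒≋ : ∀ {f g} → (∀ N → f ≈[ N ] g) → f ≋ g
≈⇒≋ p n = p (suc n) n ℕₚ.≤-refl

≈-sym : ∀ {N f g} → f ≈[ N ] g → g ≈[ N ] f
≈-sym p n l = ≡.sym (p n l)

≈-trans : ∀ {N f g h} → f ≈[ N ] g → g ≈[ N ] h → f ≈[ N ] h
≈-trans p r n l = ≡.trans (p n l) (r n l)

≈-weaken : ∀ {M N f g} → M ≤ N → f ≈[ N ] g → f ≈[ M ] g
≈-weaken M≤N p n l = p n (ℕₚ.≤-trans l M≤N)

opaque
  unfolding _⊕_

  coeff-⊕ : ∀ f g n → (f ⊕ g) n ≡ f n ℤ.+ g n
  coeff-⊕ f g n = ≡.refl

  coeff-⊖ : ∀ f n → (⊖ f) n ≡ ℤ.- f n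
  coeff-⊖ f n = ≡.refl

  coeff-𝟎 : ∀ n → 𝟎 n ≡ ℤ.0ℤ
  coeff-𝟎 n = ≡.refl

  coeff-con-⊛ : ∀ c f n → (con c ⊛ f) n ≡ c ℤ.* f n
  coeff-con-⊛ = conv-const

  ⊕-≈ : ∀ {N f f′ g g′} → f ≈[ N ] f′ → g ≈[ N ] g′ → f ⊕ g ≈[ N ] f′ ⊕ g′
  ⊕-≈ p r n l = cong₂ ℤ._+_ (p n l) (r n l)

  ⊖-≈ : ∀ {N f f′} → f ≈[ N ] f′ → ⊖ f ≈[ N ] ⊖ f′
  ⊖-≈ p n l = cong ℤ.-_ (p n l)

  ⊛-≈ : ∀ {N f f′ g g′} → f ≈[ N ] f′ → g ≈[ N ] g′ → f ⊛ g ≈[ N ] f′ ⊛ g′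
  ⊛-≈ p r zero    l = cong₂ ℤ._*_ (p 0 l) (r 0 l)
  ⊛-≈ {suc N} p r (suc n) l =
    cong₂ ℤ._+_ (cong₂ ℤ._*_ (p 0 (s≤s z≤n)) (r (suc n) l))
                (⊛-≈ (λ k l → p (suc k) (s≤s l)) (λ k l → r k (ℕₚ.m≤n⇒m≤1+n l)) n (ℕₚ.≤-pred l))

  Ord-⊛ : ∀ {a b f g} → Ord a f → Ord b g → Ord (a + b) (f ⊛ g)
  Ord-⊛ {zero}  {b} {f} {g} p r zero l rewrite r 0 l = ℤₚ.*-zeroʳ (f 0)
  Ord-⊛ {suc a} {b} {f} {g} p r zero l rewrite p 0 (s≤s z≤n) = ℤₚ.*-zeroˡ (g 0)
  Ord-⊛ {zero}  {b} {f} {g} p r (suc n) l rewrite r (suc n) l | ℤₚ.*-zeroʳ (f 0) =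
    ≡.trans (ℤₚ.+-identityˡ _) (Ord-⊛ {zero} {b} {tail f} {g} (λ _ ()) r n (ℕₚ.<-trans (ℕₚ.n<1+n n) l))
  Ord-⊛ {suc a} {b} {f} {g} p r (suc n) l rewrite p 0 (s≤s z≤n) | ℤₚ.*-zeroˡ (g (suc n)) =
    ≡.trans (ℤₚ.+-identityˡ _)
            (Ord-⊛ {a} {b} {tail f} {g} (λ k l → p (suc k) (s≤s l)) r n (ℕₚ.≤-pred l))

Ord-0 : ∀ {f} → Ord 0 f
Ord-0 _ ()

⊝-≈ : ∀ {N f f′ g g′} → f ≈[ N ] f′ → g ≈[ N ] g′ → f ⊝ g ≈[ N ] f′ ⊝ g′
⊝-≈ p r = ⊕-≈ p (⊖-≈ r)

≈⇒Ord : ∀ {N f g} → f ≈[ N ] g → Ord N (f ⊝ g)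
≈⇒Ord {g = g} p = ≈-trans (⊝-≈ p (λ _ _ → ≡.refl)) (≋⇒≈ (⊖-inverseʳ g))

Ord⇒≈ : ∀ {N f g} → Ord N (f ⊝ g) → f ≈[ N ] g
Ord⇒≈ {f = f} {g} p =
  ≈-trans (≋⇒≈ (solve 2 (λ f g → f := f :- g :+ g) ≋-refl f g))
          (≈-trans (⊕-≈ p (λ _ _ → ≡.refl)) (≋⇒≈ (⊕-identityˡ g)))

Ord-cong : ∀ {N f g} → f ≋ g → Ord N f → Ord N g
Ord-cong p o = ≈-trans (≋⇒≈ (≋-sym p)) o

⊖-𝟎 : ⊖ 𝟎 ≋ 𝟎
⊖-𝟎 = ≋-trans (≋-sym (⊕-identityˡ _)) (⊖-inverseʳ 𝟎)

Ord-⊖ : ∀ {N f} → Ord N f → Ord N (⊖ f)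
Ord-⊖ o = ≈-trans (⊖-≈ o) (≋⇒≈ ⊖-𝟎)

-- Multiplication by a series of order a gains a coefficients of precision.
⊛-gain : ∀ {a b h f g} → Ord a h → f ≈[ b ] g → h ⊛ f ≈[ a + b ] h ⊛ g
⊛-gain {h = h} {f} {g} o p =
  Ord⇒≈ (Ord-cong (solve 3 (λ h f g → h :* (f :- g) := h :* f :- h :* g) ≋-refl h f g)
                  (Ord-⊛ o (≈⇒Ord p)))

↑-+ : ∀ y m n → y ↑ (m + n) ≋ y ↑ m ⊛ y ↑ n
↑-+ y zero    n = ≋-sym (⊛-identityˡ _)
↑-+ y (suc m) n = ≋-trans (⊛-cong ≋-refl (↑-+ y m n)) (≋-sym (⊛-assoc y (y ↑ m) (y ↑ n)))

↑-cong : ∀ {x y} n → x ≋ y → x ↑ n ≋ y ↑ n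
↑-cong zero    p = ≋-refl
↑-cong (suc n) p = ⊛-cong p (↑-cong n p)

↑-⊛ : ∀ x y n → (x ⊛ y) ↑ n ≋ x ↑ n ⊛ y ↑ n
↑-⊛ x y zero    = ≋-sym (⊛-identityˡ 𝟏)
↑-⊛ x y (suc n) = ≋-trans (⊛-cong ≋-refl (↑-⊛ x y n))
  (solve 4 (λ x y a b → x :* y :* (a :* b) := x :* a :* (y :* b)) ≋-refl x y (x ↑ n) (y ↑ n))

↑-≡ : ∀ y {m n} → m ≡ n → y ↑ m ≋ y ↑ n
↑-≡ y ≡.refl = ≋-refl

↑-* : ∀ y m n → y ↑ (m * n) ≋ (y ↑ n) ↑ m
↑-* y zero    n = ≋-refl
↑-* y (suc m) n = ≋-trans (↑-+ y n (m * n)) (⊛-cong ≋-refl (↑-* y m n))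

Ord-↑ : ∀ {y} a → Ord a y → ∀ n → Ord (n * a) (y ↑ n)
Ord-↑ a o zero    = Ord-0
Ord-↑ a o (suc n) = Ord-⊛ o (Ord-↑ a o n)

Ord₁-↑ : ∀ {y} → Ord 1 y → ∀ n → Ord n (y ↑ n)
Ord₁-↑ o n = ≈-weaken (ℕₚ.≤-reflexive (≡.sym (ℕₚ.*-identityʳ n))) (Ord-↑ 1 o n)

-- Limits of sequences whose coefficient of q^m is constant from stage m + 1 on

lim : (ℕ → S) → S
lim G n = G (suc n) n

Stable : (ℕ → S) → Set
Stable G = ∀ n → G (suc n) ≈[ n ] G n

Stable-≤ : ∀ {G} → Stable G → ∀ {N M} → N ≤ M → G M ≈[ N ] G N
Stable-≤ {G} st {N} {M} N≤M =
  ≡.subst (λ k → G k ≈[ N ] G N) (ℕₚ.m∸n+n≡m N≤M) (go (M ∸ N))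
  where
  go : ∀ k → G (k + N) ≈[ N ] G N
  go zero    _ _ = ≡.refl
  go (suc k) = ≈-trans (≈-weaken (ℕₚ.m≤n+m N k) (st (k + N))) (go k)

lim-≈ : ∀ {G} → Stable G → ∀ {N M} → N ≤ M → lim G ≈[ N ] G M
lim-≈ st N≤M n l =
  ≡.trans (≡.sym (Stable-≤ st l n ℕₚ.≤-refl)) (≡.sym (Stable-≤ st N≤M n l))

∑ : ℕ → (ℕ → S) → S
∑ zero    F = 𝟎
∑ (suc N) F = ∑ N F ⊕ F N

∏ : ℕ → (ℕ → S) → S
∏ zero    F = 𝟏
∏ (suc N) F = ∏ N F ⊛ F N

∑-cong : ∀ N {F G} → (∀ n → n < N → F n ≋ G n) → ∑ N F ≋ ∑ N G
∑-cong zero    p = ≋-refl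
∑-cong (suc N) p = ⊕-cong (∑-cong N (λ n l → p n (ℕₚ.m≤n⇒m≤1+n l))) (p N ℕₚ.≤-refl)

∑-≈ : ∀ N {k F G} → (∀ n → n < N → F n ≈[ k ] G n) → ∑ N F ≈[ k ] ∑ N G
∑-≈ zero    p _ _ = ≡.refl
∑-≈ (suc N) p = ⊕-≈ (∑-≈ N (λ n l → p n (ℕₚ.m≤n⇒m≤1+n l))) (p N ℕₚ.≤-refl)

∏-cong : ∀ N {F G} → (∀ n → F n ≋ G n) → ∏ N F ≋ ∏ N G
∏-cong zero    p = ≋-refl
∏-cong (suc N) p = ⊛-cong (∏-cong N p) (p N)

∏-⊛ : ∀ N F G → ∏ N (λ n → F n ⊛ G n) ≋ ∏ N F ⊛ ∏ N G
∏-⊛ zero    F G = ≋-sym (⊛-identityˡ 𝟏)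
∏-⊛ (suc N) F G = ≋-trans (⊛-cong (∏-⊛ N F G) ≋-refl)
  (solve 4 (λ a b c d → a :* b :* (c :* d) := a :* c :* (b :* d)) ≋-refl (∏ N F) (∏ N G) (F N) (G N))

∏-𝟏 : ∀ N {F} → (∀ n → F n ≋ 𝟏) → ∏ N F ≋ 𝟏
∏-𝟏 zero    p = ≋-refl
∏-𝟏 (suc N) p = ≋-trans (⊛-cong (∏-𝟏 N p) (p N)) (⊛-identityˡ 𝟏)

∏-sucˡ : ∀ N F → ∏ (suc N) F ≋ F 0 ⊛ ∏ N (λ n → F (suc n))
∏-sucˡ zero    F = ⊛-comm 𝟏 (F 0)
∏-sucˡ (suc N) F = ≋-trans (⊛-cong (∏-sucˡ N F) ≋-refl) (⊛-assoc _ _ _)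

∑-sucˡ : ∀ N F → ∑ (suc N) F ≋ F 0 ⊕ ∑ N (λ n → F (suc n))
∑-sucˡ zero    F = ⊕-comm 𝟎 (F 0)
∑-sucˡ (suc N) F = ≋-trans (⊕-cong (∑-sucˡ N F) ≋-refl) (⊕-assoc _ _ _)

∑-⊕ : ∀ N F G → ∑ N (λ n → F n ⊕ G n) ≋ ∑ N F ⊕ ∑ N G
∑-⊕ zero    F G = ≋-sym (⊕-identityˡ 𝟎)
∑-⊕ (suc N) F G = ≋-trans (⊕-cong (∑-⊕ N F G) ≋-refl)
  (solve 4 (λ a b c d → a :+ b :+ (c :+ d) := a :+ c :+ (b :+ d)) ≋-refl (∑ N F) (∑ N G) (F N) (G N))

∑-⊛ˡ : ∀ N c F → ∑ N (λ n → c ⊛ F n) ≋ c ⊛ ∑ N F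
∑-⊛ˡ zero    c F = ≋-sym (⊛-zeroʳ c)
∑-⊛ˡ (suc N) c F = ≋-trans (⊕-cong (∑-⊛ˡ N c F) ≋-refl) (≋-sym (⊛-distribˡ c _ _))

∑-stable : ∀ {F} → (∀ n → Ord n (F n)) → Stable (λ N → ∑ N F)
∑-stable {F} o n = ≈-trans (⊕-≈ (λ _ _ → ≡.refl) (o n)) (≋⇒≈ (⊕-identityʳ (∑ n F)))

∏-stable : ∀ {F} → (∀ n → F n ≈[ n ] 𝟏) → Stable (λ N → ∏ N F)
∏-stable {F} o n = ≈-trans (⊛-≈ (λ _ _ → ≡.refl) (o n)) (≋⇒≈ (⊛-identityʳ (∏ n F)))

geometric : S → ℕ → S
geometric y N = ∑ N (y ↑_)

-- 1 / (1 - y); meaningful only for y without constant term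
geo : S → S
geo y = lim (geometric y)

geo-stable : ∀ {y} → Ord 1 y → Stable (geometric y)
geo-stable o = ∑-stable (Ord₁-↑ o)

geometric-sum : ∀ y N → (𝟏 ⊝ y) ⊛ geometric y N ≋ 𝟏 ⊝ y ↑ N
geometric-sum y zero    = ≋-trans (⊛-zeroʳ _) (≋-sym (⊖-inverseʳ 𝟏))
geometric-sum y (suc N) = ≋-trans (⊛-distribˡ _ _ _)
  (≋-trans (⊕-cong (geometric-sum y N) ≋-refl)
    (solve 2 (λ y p → (⊛-Solver.con ℤ.1ℤ :- p) :+ (⊛-Solver.con ℤ.1ℤ :- y) :* p
                        := ⊛-Solver.con ℤ.1ℤ :- y :* p) ≋-refl y (y ↑ N)))

𝟏⊝-≈ : ∀ {N y} → Ord N y → 𝟏 ⊝ y ≈[ N ] 𝟏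
𝟏⊝-≈ o = ≈-trans (⊝-≈ (λ _ _ → ≡.refl) o)
  (≋⇒≈ (≋-trans (⊕-cong ≋-refl ⊖-𝟎) (⊕-identityʳ 𝟏)))

geo-inverse : ∀ {y} → Ord 1 y → (𝟏 ⊝ y) ⊛ geo y ≋ 𝟏
geo-inverse {y} o = ≈⇒≋ λ N →
  ≈-trans (⊛-≈ (λ _ _ → ≡.refl) (lim-≈ (geo-stable o) (ℕₚ.≤-refl {N})))
    (≈-trans (≋⇒≈ (geometric-sum y N)) (𝟏⊝-≈ (Ord₁-↑ o N)))

Unit : S → Set
Unit x = Σ S λ x⁻¹ → x ⊛ x⁻¹ ≋ 𝟏

⊛-cancel : ∀ {x f g} → Unit x → x ⊛ f ≋ x ⊛ g → f ≋ g
⊛-cancel {x} {f} {g} (x⁻¹ , inv) p = begin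
  f               ≈⟨ expand f ⟩
  x⁻¹ ⊛ (x ⊛ f)   ≈⟨ ⊛-cong ≋-refl p ⟩
  x⁻¹ ⊛ (x ⊛ g)   ≈⟨ ≋-sym (expand g) ⟩
  g               ∎
  where
  open ≋-Reasoning
  expand : ∀ h → h ≋ x⁻¹ ⊛ (x ⊛ h)
  expand h = ≋-sym (≋-trans (solve 3 (λ x y h → y :* (x :* h) := (x :* y) :* h) ≋-refl x x⁻¹ h)
                            (≋-trans (⊛-cong inv ≋-refl) (⊛-identityˡ h)))

c1 : ∀ {n} → ⊛-Solver.Polynomial n
c1 = ⊛-Solver.con ℤ.1ℤ

-- Sums over the antidiagonal i + j = L

csum : (ℕ → ℕ → S) → ℕ → S
csum g zero    = g 0 0
csum g (suc L) = g 0 (suc L) ⊕ csum (λ i j → g (suc i) j) L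

csum-cong : ∀ L {g h} → (∀ i j → i + j ≡ L → g i j ≋ h i j) → csum g L ≋ csum h L
csum-cong zero    p = p 0 0 ≡.refl
csum-cong (suc L) p = ⊕-cong (p 0 (suc L) ≡.refl) (csum-cong L (λ i j e → p (suc i) j (cong suc e)))

csum-≈ : ∀ L {k g h} → (∀ i j → i + j ≡ L → g i j ≈[ k ] h i j) → csum g L ≈[ k ] csum h L
csum-≈ zero    p = p 0 0 ≡.refl
csum-≈ (suc L) p = ⊕-≈ (p 0 (suc L) ≡.refl) (csum-≈ L (λ i j e → p (suc i) j (cong suc e)))

csum-sucʳ : ∀ g L → csum g (suc L) ≋ csum (λ i j → g i (suc j)) L ⊕ g (suc L) 0
csum-sucʳ g zero    = ≋-refl
csum-sucʳ g (suc L) =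
  ≋-trans (⊕-cong ≋-refl (csum-sucʳ (λ i j → g (suc i) j) L)) (≋-sym (⊕-assoc _ _ _))

csum-⊕ : ∀ g h L → csum (λ i j → g i j ⊕ h i j) L ≋ csum g L ⊕ csum h L
csum-⊕ g h zero    = ≋-refl
csum-⊕ g h (suc L) = ≋-trans (⊕-cong ≋-refl (csum-⊕ (λ i j → g (suc i) j) (λ i j → h (suc i) j) L))
  (solve 4 (λ a b c d → a :+ b :+ (c :+ d) := a :+ c :+ (b :+ d)) ≋-refl
    (g 0 (suc L)) (h 0 (suc L)) (csum (λ i j → g (suc i) j) L) (csum (λ i j → h (suc i) j) L))

csum-⊛ˡ : ∀ c g L → csum (λ i j → c ⊛ g i j) L ≋ c ⊛ csum g L
csum-⊛ˡ c g zero    = ≋-refl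
csum-⊛ˡ c g (suc L) =
  ≋-trans (⊕-cong ≋-refl (csum-⊛ˡ c (λ i j → g (suc i) j) L)) (≋-sym (⊛-distribˡ c _ _))

-- Both sides run over the triples (i, j, t) with i + j + t = N.
csum-assoc : ∀ (g : ℕ → ℕ → ℕ → S) N →
  csum (λ n t → csum (λ i j → g i j t) n) N ≋ csum (λ i m → csum (λ j t → g i j t) m) N
csum-assoc g zero    = ≋-refl
csum-assoc g (suc N) = begin
  g 0 0 (suc N) ⊕ csum (λ n t → g 0 (suc n) t ⊕ csum (λ i j → g (suc i) j t) n) N
    ≈⟨ ⊕-cong ≋-refl (csum-⊕ (λ n t → g 0 (suc n) t) (λ n t → csum (λ i j → g (suc i) j t) n) N) ⟩
  g 0 0 (suc N) ⊕ (csum (λ n t → g 0 (suc n) t) N ⊕ csum (λ n t → csum (λ i j → g (suc i) j t) n) N)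
    ≈⟨ ⊕-cong ≋-refl (⊕-cong ≋-refl (csum-assoc (λ i → g (suc i)) N)) ⟩
  g 0 0 (suc N) ⊕ (csum (λ n t → g 0 (suc n) t) N ⊕ csum (λ i m → csum (λ j t → g (suc i) j t) m) N)
    ≈⟨ ≋-sym (⊕-assoc _ _ _) ⟩
  csum (g 0) (suc N) ⊕ csum (λ i m → csum (λ j t → g (suc i) j t) m) N ∎
  where open ≋-Reasoning

csum-∑ : ∀ F L → csum (λ i _ → F i) L ≋ ∑ (suc L) F
csum-∑ F zero    = ≋-sym (⊕-identityˡ (F 0))
csum-∑ F (suc L) = ≋-trans (⊕-cong ≋-refl (csum-∑ (λ i → F (suc i)) L)) (≋-sym (∑-sucˡ (suc L) F))

↑-split : ∀ y {m} a b → m ≡ a + b → y ↑ m ≋ y ↑ a ⊛ y ↑ b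
↑-split y a b ≡.refl = ↑-+ y a b

≡⇒≋ : ∀ (F : ℕ → S) {m n} → m ≡ n → F m ≋ F n
≡⇒≋ F ≡.refl = ≋-refl

-- The q-Pochhammer symbols (Q;Q)_n and their inverses

module Pochhammer (Q : S) (oQ : Ord 1 Q) where

  qq : ℕ → S
  qq n = ∏ n (λ j → 𝟏 ⊝ Q ↑ suc j)

  ip : ℕ → S
  ip n = ∏ n (λ j → geo (Q ↑ suc j))

  -- ip (n - 1), with 1 / (Q;Q)_{-1} = 0
  ip⁻ : ℕ → S
  ip⁻ zero    = 𝟎
  ip⁻ (suc n) = ip n

  Ord-Q↑suc : ∀ n → Ord 1 (Q ↑ suc n)
  Ord-Q↑suc n = ≈-weaken (s≤s z≤n) (Ord₁-↑ oQ (suc n))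

  geo-Q : ∀ n → (𝟏 ⊝ Q ↑ suc n) ⊛ geo (Q ↑ suc n) ≋ 𝟏
  geo-Q n = geo-inverse (Ord-Q↑suc n)

  1-Q-Unit : ∀ n → Unit (𝟏 ⊝ Q ↑ suc n)
  1-Q-Unit n = geo (Q ↑ suc n) , geo-Q n

  ip-suc : ∀ n → ip n ≋ (𝟏 ⊝ Q ↑ suc n) ⊛ ip (suc n)
  ip-suc n = ≋-sym (≋-trans
    (solve 3 (λ a i g → a :* (i :* g) := a :* g :* i) ≋-refl (𝟏 ⊝ Q ↑ suc n) (ip n) (geo (Q ↑ suc n)))
    (≋-trans (⊛-cong (geo-Q n) ≋-refl) (⊛-identityˡ (ip n))))

  ip⁻-≋ : ∀ n → ip⁻ n ≋ (𝟏 ⊝ Q ↑ n) ⊛ ip n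
  ip⁻-≋ zero    = ≋-sym (≋-trans (⊛-cong (⊖-inverseʳ 𝟏) ≋-refl) (⊛-zeroˡ 𝟏))
  ip⁻-≋ (suc n) = ip-suc n

  qq-ip : ∀ n → qq n ⊛ ip n ≋ 𝟏
  qq-ip n = ≋-trans (≋-sym (∏-⊛ n (λ j → 𝟏 ⊝ Q ↑ suc j) (λ j → geo (Q ↑ suc j)))) (∏-𝟏 n geo-Q)

  vterm : ℕ → ℕ → ℕ → S
  vterm d s t = Q ↑ (s * (s + d)) ⊛ ip s ⊛ ip (s + d) ⊛ ip t

  -- The limit of the q-Vandermonde sum in which one upper index tends to infinity. Induction on L
  -- for all d at once: after multiplication by 1 - Q^{L+1} one part lowers t and keeps d, the other
  -- lowers s and thereby turns d into d + 1.
  q-Vandermonde : ∀ L d → csum (vterm d) L ≋ ip L ⊛ ip (L + d)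
  q-Vandermonde zero    d = solve 1 (λ x → c1 :* c1 :* x :* c1 := c1 :* x) ≋-refl (ip d)
  q-Vandermonde (suc L) d = ⊛-cancel (1-Q-Unit L) (begin
    (𝟏 ⊝ Q ↑ suc L) ⊛ csum (vterm d) (suc L)
      ≈⟨ ≋-sym (csum-⊛ˡ _ (vterm d) (suc L)) ⟩
    csum (λ s t → (𝟏 ⊝ Q ↑ suc L) ⊛ vterm d s t) (suc L)
      ≈⟨ csum-cong (suc L) split ⟩
    csum (λ s t → g₁ s t ⊕ g₂ s t) (suc L)
      ≈⟨ csum-⊕ g₁ g₂ (suc L) ⟩
    csum g₁ (suc L) ⊕ csum g₂ (suc L)
      ≈⟨ ⊕-cong (csum-sucʳ g₁ L) ≋-refl ⟩
    (csum (vterm d) L ⊕ g₁ (suc L) 0) ⊕ (g₂ 0 (suc L) ⊕ csum (λ s t → g₂ (suc s) t) L)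
      ≈⟨ ⊕-cong (⊕-cong (q-Vandermonde L d) (⊛-zeroʳ _)) (⊕-cong g₂-zero (csum-cong L g₂-suc)) ⟩
    (ip L ⊛ ip (L + d) ⊕ 𝟎) ⊕ (𝟎 ⊕ csum (λ s t → Q ↑ (suc L + d) ⊛ vterm (suc d) s t) L)
      ≈⟨ ⊕-cong (⊕-identityʳ _) (≋-trans (⊕-identityˡ _)
           (≋-trans (csum-⊛ˡ _ (vterm (suc d)) L) (⊛-cong ≋-refl (q-Vandermonde L (suc d))))) ⟩
    ip L ⊛ ip (L + d) ⊕ Q ↑ (suc L + d) ⊛ (ip L ⊛ ip (L + suc d))
      ≈⟨ ⊕-cong (⊛-cong ≋-refl (ip-suc (L + d)))
                (⊛-cong ≋-refl (⊛-cong ≋-refl (≡⇒≋ ip (ℕₚ.+-suc L d)))) ⟩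
    ip L ⊛ ((𝟏 ⊝ Q ↑ (suc L + d)) ⊛ ip (suc L + d)) ⊕ Q ↑ (suc L + d) ⊛ (ip L ⊛ ip (suc L + d))
      ≈⟨ solve 3 (λ a q b → a :* ((c1 :- q) :* b) :+ q :* (a :* b) := a :* b) ≋-refl
           (ip L) (Q ↑ (suc L + d)) (ip (suc L + d)) ⟩
    ip L ⊛ ip (suc L + d)
      ≈⟨ ⊛-cong (ip-suc L) ≋-refl ⟩
    (𝟏 ⊝ Q ↑ suc L) ⊛ ip (suc L) ⊛ ip (suc L + d)
      ≈⟨ ⊛-assoc _ _ _ ⟩
    (𝟏 ⊝ Q ↑ suc L) ⊛ (ip (suc L) ⊛ ip (suc L + d)) ∎)
    where
    open ≋-Reasoning
    g₁ g₂ : ℕ → ℕ → S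
    g₁ s t = Q ↑ (s * (s + d)) ⊛ ip s ⊛ ip (s + d) ⊛ ip⁻ t
    g₂ s t = Q ↑ (s * (s + d)) ⊛ Q ↑ t ⊛ ip⁻ s ⊛ ip (s + d) ⊛ ip t
    -- 1 - Q^{s+t} = (1 - Q^t) + Q^t (1 - Q^s)
    split : ∀ s t → s + t ≡ suc L → (𝟏 ⊝ Q ↑ suc L) ⊛ vterm d s t ≋ g₁ s t ⊕ g₂ s t
    split s t e = ≋-trans
      (⊛-cong (⊕-cong ≋-refl (⊖-cong (↑-split Q s t (≡.sym e)))) ≋-refl)
      (≋-trans
        (solve 6 (λ S T E a b c → (c1 :- S :* T) :* (E :* a :* b :* c)
                   := E :* a :* b :* ((c1 :- T) :* c) :+ E :* T :* ((c1 :- S) :* a) :* b :* c) ≋-refl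
          (Q ↑ s) (Q ↑ t) (Q ↑ (s * (s + d))) (ip s) (ip (s + d)) (ip t))
        (⊕-cong (⊛-cong ≋-refl (≋-sym (ip⁻-≋ t)))
                (⊛-cong (⊛-cong (⊛-cong ≋-refl (≋-sym (ip⁻-≋ s))) ≋-refl) ≋-refl)))
    g₂-zero : g₂ 0 (suc L) ≋ 𝟎
    g₂-zero = ≋-trans (⊛-cong (⊛-cong (⊛-zeroʳ _) ≋-refl) ≋-refl)
                      (≋-trans (⊛-cong (⊛-zeroˡ _) ≋-refl) (⊛-zeroˡ _))
    g₂-suc : ∀ s t → s + t ≡ L → g₂ (suc s) t ≋ Q ↑ (suc L + d) ⊛ vterm (suc d) s t
    g₂-suc s t ≡.refl = ≋-trans
      (⊛-cong (⊛-cong (⊛-cong (≋-trans (≋-sym (↑-+ Q (suc s * (suc s + d)) t))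
          (↑-split Q (suc (s + t) + d) (s * (s + suc d)) (exponent s t d))) ≋-refl)
          (≡⇒≋ ip (≡.sym (ℕₚ.+-suc s d)))) ≋-refl)
      (solve 5 (λ q e a b c → q :* e :* a :* b :* c := q :* (e :* a :* b :* c)) ≋-refl
        (Q ↑ (suc (s + t) + d)) (Q ↑ (s * (s + suc d))) (ip s) (ip (s + suc d)) (ip t))
      where
      exponent : ∀ s t d → suc s * (suc s + d) + t ≡ suc (s + t) + d + s * (s + suc d)
      exponent = ℕ-Solver.solve-∀

⊛-zero₃ : ∀ {a} b c → a ≋ 𝟎 → a ⊛ b ⊛ c ≋ 𝟎
⊛-zero₃ b c p = ≋-trans (⊛-cong (≋-trans (⊛-cong p ≋-refl) (⊛-zeroˡ b)) ≋-refl) (⊛-zeroˡ c)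

-- A formal Tannery theorem: F i has order i and w i j is 1 modulo q^j, so replacing the weight by 1
-- changes the summand only from degree i + j = N on.
csum-limit : ∀ {F : ℕ → S} {w : ℕ → ℕ → S} → (∀ i → Ord i (F i)) → (∀ i j → w i j ≈[ j ] 𝟏) →
             ∀ N → csum (λ i j → F i ⊛ w i j) N ≈[ N ] ∑ (suc N) F
csum-limit {F} {w} oF ow N = ≈-trans
  (csum-≈ N (λ { i j ≡.refl → ≈-trans (⊛-gain (oF i) (ow i j)) (≋⇒≈ (⊛-identityʳ (F i))) }))
  (≋⇒≈ (csum-∑ F N))

T : ℕ → ℕ
T zero    = 0
T (suc n) = T n + suc n

n≤Tn : ∀ n → n ≤ T n
n≤Tn zero    = z≤n
n≤Tn (suc n) = ℕₚ.m≤n+m (suc n) (T n)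

sg : ℕ → S
sg i = (⊖ 𝟏) ↑ i

-- Partial fractions, a Bailey-type summation and the reciprocal theta function

module Lambert (u v : S) (ou : Ord 1 u) (ov : Ord 1 v) where

  Q : S
  Q = u ⊛ v

  oQ : Ord 1 Q
  oQ = ≈-weaken (s≤s z≤n) (Ord-⊛ ou ov)

  open Pochhammer Q oQ public

  d e : ℕ → S
  d r = (𝟏 ⊝ u ⊛ Q ↑ r) ⊛ (𝟏 ⊝ v ⊛ Q ↑ r)
  e r = geo (u ⊛ Q ↑ r) ⊛ geo (v ⊛ Q ↑ r)

  d-e : ∀ r → d r ⊛ e r ≋ 𝟏
  d-e r = ≋-trans
    (solve 4 (λ a b c d → a :* b :* (c :* d) := a :* c :* (b :* d)) ≋-refl
      (𝟏 ⊝ u ⊛ Q ↑ r) (𝟏 ⊝ v ⊛ Q ↑ r) (geo (u ⊛ Q ↑ r)) (geo (v ⊛ Q ↑ r)))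
    (≋-trans (⊛-cong (geo-inverse (Ord-⊛ ou Ord-0)) (geo-inverse (Ord-⊛ ov Ord-0))) (⊛-identityˡ 𝟏))

  -- The ℓ + 1 consecutive factors from index a on. Only a = 0 occurs in A, but the recursion for
  -- partial fractions moves the starting point.
  P : ℕ → ℕ → S
  P a ℓ = ∏ (suc ℓ) (λ j → e (a + j))

  P-sucˡ : ∀ a ℓ → P a (suc ℓ) ≋ e a ⊛ P (suc a) ℓ
  P-sucˡ a ℓ = ≋-trans (∏-sucˡ (suc ℓ) (λ j → e (a + j)))
    (⊛-cong (≡⇒≋ e (ℕₚ.+-identityʳ a)) (∏-cong (suc ℓ) (λ j → ≡⇒≋ e (ℕₚ.+-suc a j))))

  -- This is d_{a+ℓ+1} - Q^{ℓ+1} d_a: the terms linear in u and in v cancel, and uv = Q removes both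
  -- variables from the rest.
  κ : ℕ → ℕ → S
  κ a ℓ = (𝟏 ⊝ Q ↑ suc ℓ) ⊛ (𝟏 ⊝ Q ↑ suc (a + a + suc ℓ))

  κ-Unit : ∀ a ℓ → Unit (κ a ℓ)
  κ-Unit a ℓ = geo (Q ↑ suc ℓ) ⊛ geo (Q ↑ suc (a + a + suc ℓ)) , ≋-trans
    (solve 4 (λ a b c d → a :* b :* (c :* d) := a :* c :* (b :* d)) ≋-refl _ _ _ _)
    (≋-trans (⊛-cong (geo-Q ℓ) (geo-Q (a + a + suc ℓ))) (⊛-identityˡ 𝟏))

  -- Both sides are P a (suc ℓ) times d (a + suc ℓ) - Q^{ℓ+1} d a.
  P-rec : ∀ a ℓ → κ a ℓ ⊛ P a (suc ℓ) ≋ P a ℓ ⊝ Q ↑ suc ℓ ⊛ P (suc a) ℓ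
  P-rec a ℓ = ≋-sym (begin
    P a ℓ ⊝ L ⊛ P (suc a) ℓ
      ≈⟨ ⊕-cong (≋-sym (⊛-identityʳ _)) (⊖-cong (⊛-cong ≋-refl (≋-sym (⊛-identityʳ _)))) ⟩
    P a ℓ ⊛ 𝟏 ⊝ L ⊛ (P (suc a) ℓ ⊛ 𝟏)
      ≈⟨ ⊕-cong (⊛-cong ≋-refl (≋-sym (d-e n)))
                (⊖-cong (⊛-cong ≋-refl (⊛-cong ≋-refl (≋-sym (d-e a))))) ⟩
    P a ℓ ⊛ (d n ⊛ e n) ⊝ L ⊛ (P (suc a) ℓ ⊛ (d a ⊛ e a))
      ≈⟨ solve 7 (λ p d e l p′ d′ e′ → p :* (d :* e) :- l :* (p′ :* (d′ :* e′))
                      := d :* (p :* e) :- l :* d′ :* (e′ :* p′)) ≋-refl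
           (P a ℓ) (d n) (e n) L (P (suc a) ℓ) (d a) (e a) ⟩
    d n ⊛ P a (suc ℓ) ⊝ L ⊛ d a ⊛ (e a ⊛ P (suc a) ℓ)
      ≈⟨ ⊕-cong ≋-refl (⊖-cong (⊛-cong ≋-refl (≋-sym (P-sucˡ a ℓ)))) ⟩
    d n ⊛ P a (suc ℓ) ⊝ L ⊛ d a ⊛ P a (suc ℓ)
      ≈⟨ solve 4 (λ d l d′ p → d :* p :- l :* d′ :* p := (d :- l :* d′) :* p) ≋-refl
           (d n) L (d a) (P a (suc ℓ)) ⟩
    (d n ⊝ L ⊛ d a) ⊛ P a (suc ℓ)
      ≈⟨ ⊛-cong difference ≋-refl ⟩
    κ a ℓ ⊛ P a (suc ℓ) ∎)
    where
    open ≋-Reasoning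
    n = a + suc ℓ
    L = Q ↑ suc ℓ
    difference : d n ⊝ L ⊛ d a ≋ κ a ℓ
    difference = begin
      d n ⊝ L ⊛ d a
        ≈⟨ ⊕-cong (⊛-cong (⊕-cong ≋-refl (⊖-cong (⊛-cong ≋-refl (↑-+ Q a (suc ℓ)))))
                          (⊕-cong ≋-refl (⊖-cong (⊛-cong ≋-refl (↑-+ Q a (suc ℓ)))))) ≋-refl ⟩
      (𝟏 ⊝ u ⊛ (Q ↑ a ⊛ L)) ⊛ (𝟏 ⊝ v ⊛ (Q ↑ a ⊛ L)) ⊝ L ⊛ d a
        ≈⟨ solve 4 (λ u v A L →
             (c1 :- u :* (A :* L)) :* (c1 :- v :* (A :* L)) :- L :* ((c1 :- u :* A) :* (c1 :- v :* A))
               := (c1 :- L) :* (c1 :- (u :* v) :* (A :* A :* L))) ≋-refl u v (Q ↑ a) L ⟩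
      (𝟏 ⊝ L) ⊛ (𝟏 ⊝ Q ⊛ (Q ↑ a ⊛ Q ↑ a ⊛ L))
        ≈⟨ ⊛-cong ≋-refl (⊕-cong ≋-refl (⊖-cong (⊛-cong ≋-refl (≋-sym
             (≋-trans (↑-+ Q (a + a) (suc ℓ)) (⊛-cong (↑-+ Q a a) ≋-refl)))))) ⟩
      κ a ℓ ∎

  -- The coefficient of 1/d_r in the partial fraction expansion of `P a (i + j)`, where r = a + i.
  -- The index r is a separate argument because the recursion passes from (a, i + 1) to (a + 1, i)
  -- with r fixed.
  c : ℕ → ℕ → ℕ → ℕ → S
  c a r i j = sg i ⊛ Q ↑ T i ⊛ (𝟏 ⊝ Q ↑ suc (r + r)) ⊛ qq (a + r) ⊛ ip i ⊛ ip j ⊛ ip (suc (r + r + j))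

  pf-term : ℕ → ℕ → ℕ → S
  pf-term a i j = c a (a + i) i j ⊛ e (a + i)

  -- `c₁` is the share of the window starting at a, where j has dropped by one, and `c₂` the share
  -- of the window starting at a + 1, where i has dropped by one. Each vanishes when its index
  -- cannot drop.
  c₁ : ℕ → ℕ → ℕ → ℕ → S
  c₁ a r i j = sg i ⊛ Q ↑ T i ⊛ (𝟏 ⊝ Q ↑ suc (r + r)) ⊛ qq (a + r) ⊛ ip i ⊛ ip⁻ j ⊛ ip (r + r + j)

  c₂ : ℕ → ℕ → ℕ → ℕ → S
  c₂ a r zero    j = 𝟎
  c₂ a r (suc i) j = ⊖ (Q ↑ (suc i + j) ⊛ c (suc a) r i j)

  -- With the common q-factorials set aside this is a polynomial identity in Q, Q^a, Q^{i+1} and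
  -- Q^j. For i = 0 the two factors of κ lower exactly the two q-factorials that contain j, so no
  -- second share arises.
  c-rec : ∀ a ℓ i j → i + j ≡ suc ℓ → κ a ℓ ⊛ c a (a + i) i j ≋ c₁ a (a + i) i j ⊕ c₂ a (a + i) i j
  c-rec a ℓ zero j ≡.refl = begin
    κ a ℓ ⊛ c a r 0 j
      ≈⟨ ⊛-cong (⊛-cong ≋-refl (⊕-cong ≋-refl (⊖-cong (↑-≡ Q (exponent a j))))) ≋-refl ⟩
    (𝟏 ⊝ Q ↑ j) ⊛ (𝟏 ⊝ Q ↑ suc (r + r + j)) ⊛ c a r 0 j
      ≈⟨ solve 8 (λ J R s t D q p w → (c1 :- J) :* (c1 :- R) :* (s :* t :* D :* q :* c1 :* p :* w)
                    := s :* t :* D :* q :* c1 :* ((c1 :- J) :* p) :* ((c1 :- R) :* w)) ≋-refl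
           (Q ↑ j) (Q ↑ suc (r + r + j)) 𝟏 𝟏 (𝟏 ⊝ Q ↑ suc (r + r)) (qq (a + r)) (ip j) (ip (suc (r + r + j))) ⟩
    𝟏 ⊛ 𝟏 ⊛ (𝟏 ⊝ Q ↑ suc (r + r)) ⊛ qq (a + r) ⊛ 𝟏
      ⊛ ((𝟏 ⊝ Q ↑ j) ⊛ ip j) ⊛ ((𝟏 ⊝ Q ↑ suc (r + r + j)) ⊛ ip (suc (r + r + j)))
      ≈⟨ ⊛-cong (⊛-cong ≋-refl (≋-sym (ip⁻-≋ j))) (≋-sym (ip-suc (r + r + j))) ⟩
    c₁ a r 0 j
      ≈⟨ ≋-sym (⊕-identityʳ _) ⟩
    c₁ a r 0 j ⊕ 𝟎 ∎
    where
    open ≋-Reasoning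
    r = a + 0
    exponent : ∀ a j → suc (a + a + j) ≡ suc (a + 0 + (a + 0) + j)
    exponent = ℕ-Solver.solve-∀
  c-rec a ℓ (suc i) j ≡.refl = begin
    κ a ℓ ⊛ c a r (suc i) j
      ≈⟨ ⊛-cong (⊛-cong (⊕-cong ≋-refl (⊖-cong (↑-+ Q (suc i) j)))
                        (⊕-cong ≋-refl (⊖-cong Q-κ)))
                (⊛-cong (⊛-cong (⊛-cong (⊛-cong (⊛-cong (⊛-cong ≋-refl (↑-+ Q (T i) (suc i))) ≋-refl) ≋-refl) ≋-refl) ≋-refl) ≋-refl) ⟩
    (𝟏 ⊝ I ⊛ J) ⊛ (𝟏 ⊝ Q ⊛ A ⊛ A ⊛ I ⊛ J)
      ⊛ (⊖ 𝟏 ⊛ sg i ⊛ (Q ↑ T i ⊛ I) ⊛ D ⊛ q ⊛ ip (suc i) ⊛ ip j ⊛ w)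
      ≈⟨ solve 11 (λ Q A I J s t D q p p′ w →
            (c1 :- I :* J) :* (c1 :- Q :* A :* A :* I :* J)
              :* (:- c1 :* s :* (t :* I) :* D :* q :* p :* p′ :* w)
            := :- c1 :* s :* (t :* I) :* D :* q :* p :* ((c1 :- J) :* p′) :* ((c1 :- Q :* A :* A :* I :* I :* J) :* w)
               :- (I :* J) :* (s :* t :* D :* (q :* (c1 :- Q :* A :* A :* I)) :* ((c1 :- I) :* p) :* p′ :* w))
            ≋-refl Q A I J (sg i) (Q ↑ T i) D q (ip (suc i)) (ip j) w ⟩
    ⊖ 𝟏 ⊛ sg i ⊛ (Q ↑ T i ⊛ I) ⊛ D ⊛ q ⊛ ip (suc i) ⊛ ((𝟏 ⊝ J) ⊛ ip j) ⊛ ((𝟏 ⊝ Q ⊛ A ⊛ A ⊛ I ⊛ I ⊛ J) ⊛ w)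
      ⊝ (I ⊛ J) ⊛ (sg i ⊛ Q ↑ T i ⊛ D ⊛ (q ⊛ (𝟏 ⊝ Q ⊛ A ⊛ A ⊛ I)) ⊛ ((𝟏 ⊝ I) ⊛ ip (suc i)) ⊛ ip j ⊛ w)
      ≈⟨ ⊕-cong
           (⊛-cong (⊛-cong (⊛-cong (⊛-cong (⊛-cong (⊛-cong ≋-refl (≋-sym (↑-+ Q (T i) (suc i)))) ≋-refl) ≋-refl) ≋-refl)
                           (≋-sym (ip⁻-≋ j)))
                   (≋-trans (⊛-cong (⊕-cong ≋-refl (⊖-cong (≋-sym Q-w))) ≋-refl) (≋-sym (ip-suc (r + r + j)))))
           (⊖-cong (⊛-cong (≋-sym (↑-+ Q (suc i) j))
             (⊛-cong (⊛-cong (⊛-cong (⊛-cong ≋-refl (⊛-cong ≋-refl (⊕-cong ≋-refl (⊖-cong (≋-sym Q-q)))))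
                                     (≋-sym (ip-suc i))) ≋-refl) ≋-refl))) ⟩
    c₁ a r (suc i) j ⊕ c₂ a r (suc i) j ∎
    where
    open ≋-Reasoning
    r = a + suc i
    A = Q ↑ a
    I = Q ↑ suc i
    J = Q ↑ j
    D = 𝟏 ⊝ Q ↑ suc (r + r)
    q = qq (a + r)
    w = ip (suc (r + r + j))
    Q-q : Q ↑ suc (a + r) ≋ Q ⊛ A ⊛ A ⊛ I
    Q-q = ≋-trans (⊛-cong ≋-refl (≋-trans (↑-+ Q a r) (⊛-cong ≋-refl (↑-+ Q a (suc i)))))
      (solve 3 (λ Q A I → Q :* (A :* (A :* I)) := Q :* A :* A :* I) ≋-refl Q A I)
    Q-κ : Q ↑ suc (a + a + (suc i + j)) ≋ Q ⊛ A ⊛ A ⊛ I ⊛ J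
    Q-κ = ≋-trans (⊛-cong ≋-refl (≋-trans (↑-+ Q (a + a) (suc i + j)) (⊛-cong (↑-+ Q a a) (↑-+ Q (suc i) j))))
      (solve 4 (λ Q A I J → Q :* (A :* A :* (I :* J)) := Q :* A :* A :* I :* J) ≋-refl Q A I J)
    Q-w : Q ↑ suc (r + r + j) ≋ Q ⊛ A ⊛ A ⊛ I ⊛ I ⊛ J
    Q-w = ≋-trans (⊛-cong ≋-refl (≋-trans (↑-+ Q (r + r) j) (⊛-cong (≋-trans (↑-+ Q r r)
            (⊛-cong (↑-+ Q a (suc i)) (↑-+ Q a (suc i)))) ≋-refl)))
      (solve 4 (λ Q A I J → Q :* (A :* I :* (A :* I) :* J) := Q :* A :* A :* I :* I :* J) ≋-refl Q A I J)

  -- Induction on ℓ for all a: the products obey `P-rec`, the coefficients obey `c-rec`, and κ is a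
  -- unit that can be cancelled. The expansion is thus verified without evaluating residues.
  partial-fractions : ∀ ℓ a → P a ℓ ≋ csum (pf-term a) ℓ
  partial-fractions zero a = ⊛-cong (≋-sym (begin
    c a (a + 0) 0 0
      ≈⟨ solve 3 (λ D q w → c1 :* c1 :* D :* q :* c1 :* c1 :* w := q :* (D :* w)) ≋-refl
           (𝟏 ⊝ Q ↑ suc (r + r)) (qq (a + r)) (ip (suc (r + r + 0))) ⟩
    qq (a + r) ⊛ ((𝟏 ⊝ Q ↑ suc (r + r)) ⊛ ip (suc (r + r + 0)))
      ≈⟨ ⊛-cong ≋-refl (⊛-cong ≋-refl (≡⇒≋ ip (cong suc (ℕₚ.+-identityʳ (r + r))))) ⟩
    qq (a + r) ⊛ ((𝟏 ⊝ Q ↑ suc (r + r)) ⊛ ip (suc (r + r)))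
      ≈⟨ ⊛-cong (≡⇒≋ qq (cong (_+ r) (≡.sym (ℕₚ.+-identityʳ a)))) (≋-sym (ip-suc (r + r))) ⟩
    qq (r + r) ⊛ ip (r + r)
      ≈⟨ qq-ip (r + r) ⟩
    𝟏 ∎)) ≋-refl
    where
    open ≋-Reasoning
    r = a + 0
  partial-fractions (suc ℓ) a = ⊛-cancel (κ-Unit a ℓ) (begin
    κ a ℓ ⊛ P a (suc ℓ)
      ≈⟨ P-rec a ℓ ⟩
    P a ℓ ⊝ Q ↑ suc ℓ ⊛ P (suc a) ℓ
      ≈⟨ ⊕-cong (partial-fractions ℓ a) (⊖-cong (⊛-cong ≋-refl (partial-fractions ℓ (suc a)))) ⟩
    csum (pf-term a) ℓ ⊝ Q ↑ suc ℓ ⊛ csum (pf-term (suc a)) ℓ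
      ≈⟨ solve 3 (λ x l y → x :- l :* y := x :+ :- l :* y) ≋-refl
           (csum (pf-term a) ℓ) (Q ↑ suc ℓ) (csum (pf-term (suc a)) ℓ) ⟩
    csum (pf-term a) ℓ ⊕ ⊖ (Q ↑ suc ℓ) ⊛ csum (pf-term (suc a)) ℓ
      ≈⟨ ⊕-cong (≋-sym (≋-trans (⊕-cong (csum-cong ℓ g₁-suc) g₁-zero) (⊕-identityʳ _)))
                (≋-sym (≋-trans (⊕-identityˡ _) (≋-trans (csum-cong ℓ g₂-suc) (csum-⊛ˡ _ (pf-term (suc a)) ℓ)))) ⟩
    (csum (λ i j → g₁ i (suc j)) ℓ ⊕ g₁ (suc ℓ) 0) ⊕ (𝟎 ⊕ csum (λ i j → g₂ (suc i) j) ℓ)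
      ≈⟨ ⊕-cong (≋-sym (csum-sucʳ g₁ ℓ)) (⊕-cong (≋-sym (⊛-zeroˡ _)) ≋-refl) ⟩
    csum g₁ (suc ℓ) ⊕ csum g₂ (suc ℓ)
      ≈⟨ ≋-sym (csum-⊕ g₁ g₂ (suc ℓ)) ⟩
    csum (λ i j → g₁ i j ⊕ g₂ i j) (suc ℓ)
      ≈⟨ csum-cong (suc ℓ) (λ i j p → ≋-trans (≋-sym (⊛-distribʳ (e (a + i)) (c₁ a (a + i) i j) (c₂ a (a + i) i j)))
           (≋-trans (⊛-cong (≋-sym (c-rec a ℓ i j p)) ≋-refl) (⊛-assoc _ _ _))) ⟩
    csum (λ i j → κ a ℓ ⊛ pf-term a i j) (suc ℓ)
      ≈⟨ csum-⊛ˡ _ (pf-term a) (suc ℓ) ⟩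
    κ a ℓ ⊛ csum (pf-term a) (suc ℓ) ∎)
    where
    open ≋-Reasoning
    g₁ g₂ : ℕ → ℕ → S
    g₁ i j = c₁ a (a + i) i j ⊛ e (a + i)
    g₂ i j = c₂ a (a + i) i j ⊛ e (a + i)
    g₁-suc : ∀ i j → i + j ≡ ℓ → g₁ i (suc j) ≋ pf-term a i j
    g₁-suc i j _ = ⊛-cong (⊛-cong ≋-refl (≡⇒≋ ip (ℕₚ.+-suc (a + i + (a + i)) j))) ≋-refl
    g₁-zero : g₁ (suc ℓ) 0 ≋ 𝟎
    g₁-zero = ⊛-zero₃ _ _ (⊛-zeroʳ _)
    g₂-suc : ∀ i j → i + j ≡ ℓ → g₂ (suc i) j ≋ ⊖ (Q ↑ suc ℓ) ⊛ pf-term (suc a) i j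
    g₂-suc i j ≡.refl = ≋-trans
      (⊛-cong (⊖-cong (⊛-cong ≋-refl (≡⇒≋ (λ r → c (suc a) r i j) (ℕₚ.+-suc a i)))) (≡⇒≋ e (ℕₚ.+-suc a i)))
      (solve 3 (λ q c e → :- (q :* c) :* e := :- q :* (c :* e)) ≋-refl
        (Q ↑ (suc i + j)) (c (suc a) (suc a + i) i j) (e (suc a + i)))

  -- The terms r = i and r = -1 - i of Σ (-1)^r Q^{c r(r+1)/2} / (1 - u Q^r), combined, for c = 1
  -- and c = 3. Combining them avoids negative powers of Q.
  K₁ K₃ : ℕ → S
  K₁ i = sg i ⊛ Q ↑ T i ⊛ (𝟏 ⊝ Q ↑ suc (i + i)) ⊛ e i
  K₃ i = Q ↑ (i * suc i) ⊛ K₁ i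

  Ord-K₁ : ∀ i → Ord i (K₁ i)
  Ord-K₁ i = Ord-cong
    (solve 4 (λ s t D e → t :* (s :* D :* e) := s :* t :* D :* e) ≋-refl
      (sg i) (Q ↑ T i) (𝟏 ⊝ Q ↑ suc (i + i)) (e i))
    (≈-weaken (ℕₚ.≤-trans (n≤Tn i) (ℕₚ.m≤m+n (T i) 0))
      (Ord-⊛ (Ord₁-↑ oQ (T i)) (Ord-0 {sg i ⊛ (𝟏 ⊝ Q ↑ suc (i + i)) ⊛ e i})))

  Ord-K₃ : ∀ i → Ord i (K₃ i)
  Ord-K₃ i = ≈-weaken (ℕₚ.m≤n+m i 0) (Ord-⊛ Ord-0 (Ord-K₁ i))

  qq-stable : Stable qq
  qq-stable = ∏-stable (λ j → 𝟏⊝-≈ (≈-weaken (ℕₚ.n≤1+n j) (Ord₁-↑ oQ (suc j))))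

  qq∞ : S
  qq∞ = lim qq

  qq∞-ip : ∀ {m} n → m ≤ n → qq∞ ⊛ ip n ≈[ m ] 𝟏
  qq∞-ip n m≤n = ≈-trans (⊛-≈ (lim-≈ qq-stable m≤n) (λ _ _ → ≡.refl)) (≋⇒≈ (qq-ip n))

  -- What (Q;Q)_∞² makes of the two q-factorials that q-Vandermonde leaves behind; it tends to 1 as
  -- m grows.
  weight : ℕ → ℕ → S
  weight i m = (qq∞ ⊛ ip m) ⊛ (qq∞ ⊛ ip (m + suc (i + i)))

  weight-≈ : ∀ i m → weight i m ≈[ m ] 𝟏
  weight-≈ i m = ≈-trans (⊛-≈ (qq∞-ip m ℕₚ.≤-refl) (qq∞-ip (m + suc (i + i)) (ℕₚ.m≤m+n m _)))
                         (≋⇒≈ (⊛-identityˡ 𝟏))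

  -- At a = 0 the index r is i, so `qq (a + r)` and `ip i` cancel.
  term-K₁ : ∀ i j → pf-term 0 i j ≋ K₁ i ⊛ (ip j ⊛ ip (j + suc (i + i)))
  term-K₁ i j = ≋-trans
    (⊛-cong (⊛-cong ≋-refl (≡⇒≋ ip (exponent i j))) ≋-refl)
    (≋-trans
      (solve 8 (λ s t D q p p′ w e → s :* t :* D :* q :* p :* p′ :* w :* e
                  := (q :* p) :* (s :* t :* D :* e :* (p′ :* w))) ≋-refl
        (sg i) (Q ↑ T i) (𝟏 ⊝ Q ↑ suc (i + i)) (qq i) (ip i) (ip j) (ip (j + suc (i + i))) (e i))
      (≋-trans (⊛-cong (qq-ip i) ≋-refl) (⊛-identityˡ _)))
    where
    exponent : ∀ i j → suc (i + i + j) ≡ j + suc (i + i)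
    exponent = ℕ-Solver.solve-∀

  -- One step of Bailey's lemma. After expansion into partial fractions, n = i + j gives n(n + 1) =
  -- i(i + 1) + j(j + 2i + 1), so for fixed i the sum over j + t is q-Vandermonde with d = 2i + 1.
  -- The leftover Q^{i(i+1)} turns `K₁` into `K₃`.
  bailey : ∀ N → csum (λ n t → Q ↑ (n * suc n) ⊛ P 0 n ⊛ ip t) N
                 ≋ csum (λ i m → K₃ i ⊛ (ip m ⊛ ip (m + suc (i + i)))) N
  bailey N = begin
    csum (λ n t → Q ↑ (n * suc n) ⊛ P 0 n ⊛ ip t) N
      ≈⟨ csum-cong N (λ n t _ → ≋-trans (⊛-cong (⊛-cong ≋-refl (partial-fractions n 0)) ≋-refl)
           (≋-trans (solve 3 (λ q p i → q :* p :* i := (q :* i) :* p) ≋-refl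
                      (Q ↑ (n * suc n)) (csum (pf-term 0) n) (ip t))
           (≋-trans (≋-sym (csum-⊛ˡ _ (pf-term 0) n))
             (csum-cong n (λ i j p → inner n i j t p))))) ⟩
    csum (λ n t → csum (λ i j → K₃ i ⊛ vterm (suc (i + i)) j t) n) N
      ≈⟨ csum-assoc (λ i j t → K₃ i ⊛ vterm (suc (i + i)) j t) N ⟩
    csum (λ i m → csum (λ j t → K₃ i ⊛ vterm (suc (i + i)) j t) m) N
      ≈⟨ csum-cong N (λ i m _ → ≋-trans (csum-⊛ˡ (K₃ i) (vterm (suc (i + i))) m)
                                        (⊛-cong ≋-refl (q-Vandermonde m (suc (i + i))))) ⟩
    csum (λ i m → K₃ i ⊛ (ip m ⊛ ip (m + suc (i + i)))) N ∎
    where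
    open ≋-Reasoning
    exponent : ∀ i j → (i + j) * suc (i + j) ≡ i * suc i + j * (j + suc (i + i))
    exponent = ℕ-Solver.solve-∀
    inner : ∀ n i j t → i + j ≡ n →
            Q ↑ (n * suc n) ⊛ ip t ⊛ pf-term 0 i j ≋ K₃ i ⊛ vterm (suc (i + i)) j t
    inner n i j t ≡.refl = ≋-trans
      (⊛-cong (⊛-cong (↑-split Q (i * suc i) (j * (j + suc (i + i))) (exponent i j)) ≋-refl) (term-K₁ i j))
      (solve 6 (λ a b p K x y → a :* b :* p :* (K :* (x :* y)) := a :* K :* (b :* x :* y :* p)) ≋-refl
        (Q ↑ (i * suc i)) (Q ↑ (j * (j + suc (i + i)))) (ip t) (K₁ i) (ip j) (ip (j + suc (i + i))))

  -- For u = q and v = q⁵ this is summand n + 1 of A divided by q, because 6(n + 1)² - 6(n + 1) =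
  -- 6n(n + 1).
  durfee : ℕ → S
  durfee n = Q ↑ (n * suc n) ⊛ P 0 n

  Ord-durfee : ∀ n → Ord n (durfee n)
  Ord-durfee n = ≈-weaken (ℕₚ.≤-trans (ℕₚ.m≤m*n n (suc n)) (ℕₚ.m≤m+n (n * suc n) 0))
                          (Ord-⊛ (Ord₁-↑ oQ (n * suc n)) Ord-0)

  -- Multiply `bailey` by (Q;Q)_∞² and let N grow. On the left one factor absorbs 1/(Q;Q)_t and the
  -- other survives; on the right both are absorbed by the two q-factorials.
  qq∞-durfee : qq∞ ⊛ lim (λ N → ∑ N durfee) ≋ lim (λ N → ∑ N K₃)
  qq∞-durfee = ≈⇒≋ λ N → ≈-trans (⊛-≈ (λ _ _ → ≡.refl) (lim-≈ (∑-stable Ord-durfee) (ℕₚ.n≤1+n N)))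
    (≈-trans (⊛-≈ (λ _ _ → ≡.refl) (≈-sym (csum-limit Ord-durfee (λ _ t → qq∞-ip t ℕₚ.≤-refl) N)))
    (≈-trans (≋⇒≈ (exact N))
    (≈-trans (csum-limit Ord-K₃ weight-≈ N)
             (≈-sym (lim-≈ (∑-stable Ord-K₃) (ℕₚ.n≤1+n N))))))
    where
    open ≋-Reasoning
    exact : ∀ N → qq∞ ⊛ csum (λ n t → durfee n ⊛ (qq∞ ⊛ ip t)) N ≋ csum (λ i m → K₃ i ⊛ weight i m) N
    exact N = begin
      qq∞ ⊛ csum (λ n t → durfee n ⊛ (qq∞ ⊛ ip t)) N
        ≈⟨ ⊛-cong ≋-refl (≋-trans (csum-cong N (λ n t _ →
             solve 3 (λ a b c → a :* (b :* c) := b :* (a :* c)) ≋-refl (durfee n) qq∞ (ip t)))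
             (csum-⊛ˡ qq∞ (λ n t → durfee n ⊛ ip t) N)) ⟩
      qq∞ ⊛ (qq∞ ⊛ csum (λ n t → durfee n ⊛ ip t) N)
        ≈⟨ ⊛-cong ≋-refl (⊛-cong ≋-refl (bailey N)) ⟩
      qq∞ ⊛ (qq∞ ⊛ csum (λ i m → K₃ i ⊛ (ip m ⊛ ip (m + suc (i + i)))) N)
        ≈⟨ ≋-trans (⊛-cong ≋-refl (≋-sym (csum-⊛ˡ qq∞ _ N))) (≋-sym (csum-⊛ˡ qq∞ _ N)) ⟩
      csum (λ i m → qq∞ ⊛ (qq∞ ⊛ (K₃ i ⊛ (ip m ⊛ ip (m + suc (i + i)))))) N
        ≈⟨ csum-cong N (λ i m _ → solve 4 (λ q K a b → q :* (q :* (K :* (a :* b))) := K :* (q :* a :* (q :* b)))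
             ≋-refl qq∞ (K₃ i) (ip m) (ip (m + suc (i + i)))) ⟩
      csum (λ i m → K₃ i ⊛ weight i m) N ∎

  ∏d-stable : Stable (λ N → ∏ N d)
  ∏d-stable = ∏-stable λ r → ≈-trans
    (⊛-≈ (𝟏⊝-≈ (Ord-⊛ {0} {r} Ord-0 (Ord₁-↑ oQ r))) (𝟏⊝-≈ (Ord-⊛ {0} {r} Ord-0 (Ord₁-↑ oQ r))))
    (≋⇒≈ (⊛-identityˡ 𝟏))

  -- The same limit taken directly in the partial fractions of `P 0 N`: the classical expansion of
  -- the reciprocal of a theta function.
  reciprocal-theta : lim (λ N → ∏ N d) ⊛ lim (λ N → ∑ N K₁) ≋ qq∞ ⊛ qq∞
  reciprocal-theta = ≈⇒≋ λ N → ≈-trans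
    (⊛-≈ (lim-≈ ∏d-stable (ℕₚ.n≤1+n N)) (lim-≈ (∑-stable Ord-K₁) (ℕₚ.n≤1+n N)))
    (≈-trans (⊛-≈ (λ _ _ → ≡.refl) (≈-sym (csum-limit Ord-K₁ weight-≈ N)))
             (≋⇒≈ (exact N)))
    where
    open ≋-Reasoning
    exact : ∀ N → ∏ (suc N) d ⊛ csum (λ i m → K₁ i ⊛ weight i m) N ≋ qq∞ ⊛ qq∞
    exact N = begin
      ∏ (suc N) d ⊛ csum (λ i m → K₁ i ⊛ weight i m) N
        ≈⟨ ⊛-cong ≋-refl (≋-trans (csum-cong N (λ i m _ → ≋-trans
             (solve 4 (λ q K a b → K :* (q :* a :* (q :* b)) := (q :* q) :* (K :* (a :* b)))
               ≋-refl qq∞ (K₁ i) (ip m) (ip (m + suc (i + i))))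
             (⊛-cong ≋-refl (≋-sym (term-K₁ i m)))))
             (csum-⊛ˡ (qq∞ ⊛ qq∞) (pf-term 0) N)) ⟩
      ∏ (suc N) d ⊛ ((qq∞ ⊛ qq∞) ⊛ csum (pf-term 0) N)
        ≈⟨ ⊛-cong ≋-refl (⊛-cong ≋-refl (≋-sym (partial-fractions N 0))) ⟩
      ∏ (suc N) d ⊛ ((qq∞ ⊛ qq∞) ⊛ ∏ (suc N) e)
        ≈⟨ solve 3 (λ a q b → a :* (q :* b) := a :* b :* q) ≋-refl (∏ (suc N) d) (qq∞ ⊛ qq∞) (∏ (suc N) e) ⟩
      ∏ (suc N) d ⊛ ∏ (suc N) e ⊛ (qq∞ ⊛ qq∞)
        ≈⟨ ⊛-cong (≋-trans (≋-sym (∏-⊛ (suc N) d e)) (∏-𝟏 (suc N) d-e)) ≋-refl ⟩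
      𝟏 ⊛ (qq∞ ⊛ qq∞)
        ≈⟨ ⊛-identityˡ _ ⟩
      qq∞ ⊛ qq∞ ∎

-- k(k - 1)/2, in contrast to `T`, which is n(n + 1)/2.
tri : ℕ → ℕ
tri zero    = 0
tri (suc k) = tri k + k

-- Jacobi's triple product as the limit of a finite one

module TripleProduct (u v : S) (ou : Ord 1 u) (ov : Ord 1 v) where

  open Lambert u v ou ov public

  -- the coefficient of [2N choose i] in the finite triple product:
  -- Q^{k(k-1)/2} u^k if i = N + k, and Q^{k(k-1)/2} v^k if N = i + k
  θ : ℕ → ℕ → S
  θ i       zero    = Q ↑ tri i ⊛ u ↑ i
  θ zero    (suc N) = Q ↑ tri (suc N) ⊛ v ↑ suc N
  θ (suc i) (suc N) = θ i N

  bin : ℕ → ℕ → S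
  bin i j = qq (i + j) ⊛ ip i ⊛ ip j

  u-factor v-factor : ℕ → S
  u-factor j = 𝟏 ⊕ u ⊛ Q ↑ j
  v-factor j = 𝟏 ⊕ v ⊛ Q ↑ j

  θ-0 : ∀ N → θ 0 N ≋ Q ↑ tri N ⊛ v ↑ N
  θ-0 zero    = ≋-refl
  θ-0 (suc N) = ≋-refl

  -- With k = i - N this is θ_{k+1} = u Q^k θ_k, multiplied by Q^j to keep all exponents natural.
  -- Below k = 0 the factor u cancels a factor v through uv = Q.
  θ-u : ∀ M i j N → i + j ≡ M + N → u ⊛ Q ↑ M ⊛ θ i N ≋ Q ↑ j ⊛ θ (suc i) N
  θ-u M i j zero p = begin
    u ⊛ Q ↑ M ⊛ (Q ↑ tri i ⊛ u ↑ i)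
      ≈⟨ ⊛-cong (⊛-cong ≋-refl (↑-split Q i j (≡.trans (≡.sym (ℕₚ.+-identityʳ M)) (≡.sym p)))) ≋-refl ⟩
    u ⊛ (Q ↑ i ⊛ Q ↑ j) ⊛ (Q ↑ tri i ⊛ u ↑ i)
      ≈⟨ solve 5 (λ u a b t w → u :* (a :* b) :* (t :* w) := b :* ((t :* a) :* (u :* w))) ≋-refl
           u (Q ↑ i) (Q ↑ j) (Q ↑ tri i) (u ↑ i) ⟩
    Q ↑ j ⊛ ((Q ↑ tri i ⊛ Q ↑ i) ⊛ u ↑ suc i)
      ≈⟨ ⊛-cong ≋-refl (⊛-cong (≋-sym (↑-+ Q (tri i) i)) ≋-refl) ⟩
    Q ↑ j ⊛ θ (suc i) 0 ∎
    where open ≋-Reasoning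
  θ-u M zero j (suc N) p = begin
    u ⊛ Q ↑ M ⊛ (Q ↑ tri (suc N) ⊛ (v ⊛ v ↑ N))
      ≈⟨ ⊛-cong ≋-refl (⊛-cong (↑-+ Q (tri N) N) ≋-refl) ⟩
    u ⊛ Q ↑ M ⊛ ((Q ↑ tri N ⊛ Q ↑ N) ⊛ (v ⊛ v ↑ N))
      ≈⟨ solve 6 (λ u v m t n w → u :* m :* ((t :* n) :* (v :* w)) := m :* ((u :* v) :* n) :* (t :* w)) ≋-refl
           u v (Q ↑ M) (Q ↑ tri N) (Q ↑ N) (v ↑ N) ⟩
    Q ↑ M ⊛ Q ↑ suc N ⊛ (Q ↑ tri N ⊛ v ↑ N)
      ≈⟨ ⊛-cong (≋-sym (↑-split Q M (suc N) p)) (≋-sym (θ-0 N)) ⟩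
    Q ↑ j ⊛ θ 0 N ∎
    where open ≋-Reasoning
  θ-u M (suc i) j (suc N) p = θ-u M i j N (ℕₚ.suc-injective (≡.trans p (ℕₚ.+-suc M N)))

  θ-v : ∀ i N → v ⊛ Q ↑ N ⊛ θ i N ≋ Q ↑ i ⊛ θ i (suc N)
  θ-v zero N = begin
    v ⊛ Q ↑ N ⊛ θ 0 N
      ≈⟨ ⊛-cong ≋-refl (θ-0 N) ⟩
    v ⊛ Q ↑ N ⊛ (Q ↑ tri N ⊛ v ↑ N)
      ≈⟨ solve 4 (λ v n t w → v :* n :* (t :* w) := c1 :* ((t :* n) :* (v :* w))) ≋-refl
           v (Q ↑ N) (Q ↑ tri N) (v ↑ N) ⟩
    𝟏 ⊛ ((Q ↑ tri N ⊛ Q ↑ N) ⊛ v ↑ suc N)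
      ≈⟨ ⊛-cong ≋-refl (⊛-cong (≋-sym (↑-+ Q (tri N) N)) ≋-refl) ⟩
    Q ↑ 0 ⊛ θ 0 (suc N) ∎
    where open ≋-Reasoning
  θ-v (suc i) zero = begin
    v ⊛ 𝟏 ⊛ (Q ↑ tri (suc i) ⊛ (u ⊛ u ↑ i))
      ≈⟨ ⊛-cong ≋-refl (⊛-cong (↑-+ Q (tri i) i) ≋-refl) ⟩
    v ⊛ 𝟏 ⊛ ((Q ↑ tri i ⊛ Q ↑ i) ⊛ (u ⊛ u ↑ i))
      ≈⟨ solve 5 (λ u v t n w → v :* c1 :* ((t :* n) :* (u :* w)) := (u :* v) :* n :* (t :* w)) ≋-refl
           u v (Q ↑ tri i) (Q ↑ i) (u ↑ i) ⟩
    Q ↑ suc i ⊛ (Q ↑ tri i ⊛ u ↑ i) ∎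
    where open ≋-Reasoning
  θ-v (suc i) (suc N) = begin
    v ⊛ (Q ⊛ Q ↑ N) ⊛ θ i N
      ≈⟨ solve 4 (λ v q n t → v :* (q :* n) :* t := q :* (v :* n :* t)) ≋-refl v Q (Q ↑ N) (θ i N) ⟩
    Q ⊛ (v ⊛ Q ↑ N ⊛ θ i N)
      ≈⟨ ⊛-cong ≋-refl (θ-v i N) ⟩
    Q ⊛ (Q ↑ i ⊛ θ i (suc N))
      ≈⟨ ≋-sym (⊛-assoc _ _ _) ⟩
    Q ↑ suc i ⊛ θ i (suc N) ∎
    where open ≋-Reasoning

  bin-sum : (ℕ → S) → ℕ → S
  bin-sum w = csum (λ i j → bin i j ⊛ w i)

  -- Covers both q-Pascal rules: each way of writing 1 - Q^{i+j} as a combination of 1 - Q^j and 1 -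
  -- Q^i cancels one factor of a denominator and so splits the q-binomials of level L + 1 into those
  -- of level L.
  pascal : ∀ L (g₁ g₂ : ℕ → ℕ → S) (w : ℕ → S) →
    (∀ i j → 𝟏 ⊝ Q ↑ (i + j) ≋ g₁ i j ⊛ (𝟏 ⊝ Q ↑ j) ⊕ g₂ i j ⊛ (𝟏 ⊝ Q ↑ i)) →
    bin-sum w (suc L) ≋ csum (λ i j → bin i j ⊛ (g₁ i (suc j) ⊛ w i)) L
                        ⊕ csum (λ i j → bin i j ⊛ (g₂ (suc i) j ⊛ w (suc i))) L
  pascal L g₁ g₂ w split = begin
    csum (λ i j → bin i j ⊛ w i) (suc L)
      ≈⟨ csum-cong (suc L) (λ i j p → pointwise i j p) ⟩
    csum (λ i j → h₁ i j ⊕ h₂ i j) (suc L)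
      ≈⟨ csum-⊕ h₁ h₂ (suc L) ⟩
    csum h₁ (suc L) ⊕ csum h₂ (suc L)
      ≈⟨ ⊕-cong (≋-trans (csum-sucʳ h₁ L) (≋-trans (⊕-cong (csum-cong L h₁-suc) h₁-zero) (⊕-identityʳ _)))
                (≋-trans (⊕-cong h₂-zero (csum-cong L h₂-suc)) (⊕-identityˡ _)) ⟩
    csum (λ i j → bin i j ⊛ (g₁ i (suc j) ⊛ w i)) L
      ⊕ csum (λ i j → bin i j ⊛ (g₂ (suc i) j ⊛ w (suc i))) L ∎
    where
    open ≋-Reasoning
    h₁ h₂ : ℕ → ℕ → S
    h₁ i j = ip⁻ j ⊛ (qq L ⊛ ip i ⊛ (g₁ i j ⊛ w i))
    h₂ i j = ip⁻ i ⊛ (qq L ⊛ ip j ⊛ (g₂ i j ⊛ w i))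
    pointwise : ∀ i j → i + j ≡ suc L → bin i j ⊛ w i ≋ h₁ i j ⊕ h₂ i j
    pointwise i j p = ≋-trans
      (⊛-cong (⊛-cong (⊛-cong (≋-trans (≡⇒≋ qq p) (⊛-cong ≋-refl
        (≋-trans (⊕-cong ≋-refl (⊖-cong (↑-≡ Q (≡.sym p)))) (split i j)))) ≋-refl) ≋-refl) ≋-refl)
      (≋-trans
        (solve 8 (λ q g g′ x y a b w →
            q :* (g :* (c1 :- y) :+ g′ :* (c1 :- x)) :* a :* b :* w
              := ((c1 :- y) :* b) :* (q :* a :* (g :* w)) :+ ((c1 :- x) :* a) :* (q :* b :* (g′ :* w))) ≋-refl
          (qq L) (g₁ i j) (g₂ i j) (Q ↑ i) (Q ↑ j) (ip i) (ip j) (w i))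
        (⊕-cong (⊛-cong (≋-sym (ip⁻-≋ j)) ≋-refl) (⊛-cong (≋-sym (ip⁻-≋ i)) ≋-refl)))
    h₁-zero : h₁ (suc L) 0 ≋ 𝟎
    h₁-zero = ⊛-zeroˡ _
    h₂-zero : h₂ 0 (suc L) ≋ 𝟎
    h₂-zero = ⊛-zeroˡ _
    h₁-suc : ∀ i j → i + j ≡ L → h₁ i (suc j) ≋ bin i j ⊛ (g₁ i (suc j) ⊛ w i)
    h₁-suc i j ≡.refl = solve 4 (λ b q a w → b :* (q :* a :* w) := q :* a :* b :* w) ≋-refl
      (ip j) (qq (i + j)) (ip i) (g₁ i (suc j) ⊛ w i)
    h₂-suc : ∀ i j → i + j ≡ L → h₂ (suc i) j ≋ bin i j ⊛ (g₂ (suc i) j ⊛ w (suc i))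
    h₂-suc i j ≡.refl = solve 4 (λ a q b w → a :* (q :* b :* w) := q :* a :* b :* w) ≋-refl
      (ip i) (qq (i + j)) (ip j) (g₂ (suc i) j ⊛ w (suc i))

  -- One factor is added at a time, each v-factor by one q-Pascal rule and each u-factor by the
  -- other. Independent M and N make this possible; the triple product needs only M = N.
  finite-triple-product : ∀ M N → ∏ M u-factor ⊛ ∏ N v-factor ≋ bin-sum (λ i → θ i N) (M + N)
  finite-triple-product zero zero =
    solve 0 (c1 :* c1 := c1 :* c1 :* c1 :* (c1 :* c1)) ≋-refl
  finite-triple-product zero (suc N) = begin
    𝟏 ⊛ (∏ N v-factor ⊛ v-factor N)
      ≈⟨ ≋-sym (⊛-assoc _ _ _) ⟩
    𝟏 ⊛ ∏ N v-factor ⊛ v-factor N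
      ≈⟨ ⊛-cong (finite-triple-product zero N) ≋-refl ⟩
    bin-sum (λ i → θ i N) N ⊛ v-factor N
      ≈⟨ solve 2 (λ x y → x :* (c1 :+ y) := y :* x :+ x) ≋-refl (bin-sum (λ i → θ i N) N) (v ⊛ Q ↑ N) ⟩
    (v ⊛ Q ↑ N) ⊛ bin-sum (λ i → θ i N) N ⊕ bin-sum (λ i → θ i N) N
      ≈⟨ ⊕-cong (≋-trans (≋-sym (csum-⊛ˡ _ (λ i j → bin i j ⊛ θ i N) N))
                  (csum-cong N (λ i j _ → ≋-trans (solve 3 (λ y b t → y :* (b :* t) := b :* (y :* t)) ≋-refl
                      (v ⊛ Q ↑ N) (bin i j) (θ i N)) (⊛-cong ≋-refl (θ-v i N)))))
                (csum-cong N (λ i j _ → ⊛-cong ≋-refl (≋-sym (⊛-identityˡ (θ i N))))) ⟩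
    csum (λ i j → bin i j ⊛ (Q ↑ i ⊛ θ i (suc N))) N ⊕ csum (λ i j → bin i j ⊛ (𝟏 ⊛ θ i N)) N
      ≈⟨ ≋-sym (pascal N (λ i _ → Q ↑ i) (λ _ _ → 𝟏) (λ i → θ i (suc N)) split) ⟩
    bin-sum (λ i → θ i (suc N)) (suc N) ∎
    where
    open ≋-Reasoning
    split : ∀ i j → 𝟏 ⊝ Q ↑ (i + j) ≋ Q ↑ i ⊛ (𝟏 ⊝ Q ↑ j) ⊕ 𝟏 ⊛ (𝟏 ⊝ Q ↑ i)
    split i j = ≋-trans (⊕-cong ≋-refl (⊖-cong (↑-+ Q i j)))
      (solve 2 (λ a b → c1 :- a :* b := a :* (c1 :- b) :+ c1 :* (c1 :- a)) ≋-refl (Q ↑ i) (Q ↑ j))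
  finite-triple-product (suc M) N = begin
    ∏ M u-factor ⊛ u-factor M ⊛ ∏ N v-factor
      ≈⟨ solve 3 (λ a b c → a :* b :* c := a :* c :* b) ≋-refl (∏ M u-factor) (u-factor M) (∏ N v-factor) ⟩
    ∏ M u-factor ⊛ ∏ N v-factor ⊛ u-factor M
      ≈⟨ ⊛-cong (finite-triple-product M N) ≋-refl ⟩
    bin-sum (λ i → θ i N) (M + N) ⊛ u-factor M
      ≈⟨ solve 2 (λ x y → x :* (c1 :+ y) := x :+ y :* x) ≋-refl (bin-sum (λ i → θ i N) (M + N)) (u ⊛ Q ↑ M) ⟩
    bin-sum (λ i → θ i N) (M + N) ⊕ (u ⊛ Q ↑ M) ⊛ bin-sum (λ i → θ i N) (M + N)
      ≈⟨ ⊕-cong (csum-cong (M + N) (λ i j _ → ⊛-cong ≋-refl (≋-sym (⊛-identityˡ (θ i N)))))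
                (≋-trans (≋-sym (csum-⊛ˡ _ (λ i j → bin i j ⊛ θ i N) (M + N)))
                  (csum-cong (M + N) (λ i j p → ≋-trans (solve 3 (λ y b t → y :* (b :* t) := b :* (y :* t)) ≋-refl
                      (u ⊛ Q ↑ M) (bin i j) (θ i N)) (⊛-cong ≋-refl (θ-u M i j N p))))) ⟩
    csum (λ i j → bin i j ⊛ (𝟏 ⊛ θ i N)) (M + N)
      ⊕ csum (λ i j → bin i j ⊛ (Q ↑ j ⊛ θ (suc i) N)) (M + N)
      ≈⟨ ≋-sym (pascal (M + N) (λ _ _ → 𝟏) (λ _ j → Q ↑ j) (λ i → θ i N) split) ⟩
    bin-sum (λ i → θ i N) (suc M + N) ∎
    where
    open ≋-Reasoning
    split : ∀ i j → 𝟏 ⊝ Q ↑ (i + j) ≋ 𝟏 ⊛ (𝟏 ⊝ Q ↑ j) ⊕ Q ↑ j ⊛ (𝟏 ⊝ Q ↑ i)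
    split i j = ≋-trans (⊕-cong ≋-refl (⊖-cong (↑-+ Q i j)))
      (solve 2 (λ a b → c1 :- a :* b := c1 :* (c1 :- b) :+ b :* (c1 :- a)) ≋-refl (Q ↑ i) (Q ↑ j))

  Ord-θ-≤ : ∀ i k → Ord k (θ i (i + k))
  Ord-θ-≤ zero    k = Ord-cong (≋-sym (θ-0 k)) (Ord-⊛ {0} Ord-0 (Ord₁-↑ ov k))
  Ord-θ-≤ (suc i) k = Ord-θ-≤ i k

  θ-≥ : ∀ N k → θ (k + N) N ≋ θ k 0
  θ-≥ zero    k = ≡⇒≋ (λ i → θ i 0) (ℕₚ.+-identityʳ k)
  θ-≥ (suc N) k = ≋-trans (≡⇒≋ (λ i → θ i (suc N)) (ℕₚ.+-suc k N)) (θ-≥ N k)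

  Ord-θ-≥ : ∀ N k → Ord k (θ (k + N) N)
  Ord-θ-≥ N k = Ord-cong (≋-sym (θ-≥ N k)) (Ord-⊛ {0} Ord-0 (Ord₁-↑ ou k))

  bin-limit : ∀ m i j → m ≤ i → m ≤ j → qq∞ ⊛ bin i j ≈[ m ] 𝟏
  bin-limit m i j m≤i m≤j = ≈-trans
    (≋⇒≈ (solve 4 (λ x q a b → x :* (q :* a :* b) := (q :* a) :* (x :* b)) ≋-refl qq∞ (qq (i + j)) (ip i) (ip j)))
    (≈-trans (⊛-≈ (≈-trans (⊛-≈ (Stable-≤ qq-stable (ℕₚ.m≤m+n i j)) (λ _ _ → ≡.refl)) (≋⇒≈ (qq-ip i)) on m≤i)
                  (qq∞-ip j m≤j))
             (≋⇒≈ (⊛-identityˡ 𝟏)))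
    where
    _on_ : ∀ {m i f g} → f ≈[ i ] g → m ≤ i → f ≈[ m ] g
    p on l = ≈-weaken l p

  -- The term θ has order at least |i - N|, and (Q;Q)_∞ times the q-binomial is 1 up to degree
  -- min(i, j). Since i + j = 2N, these two gains add up to N.
  θ-limit : ∀ N i j → i + j ≡ N + N → qq∞ ⊛ (bin i j ⊛ θ i N) ≈[ N ] θ i N
  θ-limit N i j p = ≈-trans
    (≋⇒≈ (solve 3 (λ x b t → x :* (b :* t) := t :* (x :* b)) ≋-refl qq∞ (bin i j) (θ i N)))
    (≈-trans (gain (ℕₚ.≤-total i N)) (≋⇒≈ (⊛-identityʳ (θ i N))))
    where
    gain : i ≤ N ⊎ N ≤ i → θ i N ⊛ (qq∞ ⊛ bin i j) ≈[ N ] θ i N ⊛ 𝟏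
    gain (inj₁ i≤N) = ≈-weaken (ℕₚ.≤-reflexive (≡.sym (ℕₚ.m∸n+n≡m i≤N)))
      (⊛-gain (≡.subst (λ M → Ord (N ∸ i) (θ i M)) (ℕₚ.m+[n∸m]≡n i≤N) (Ord-θ-≤ i (N ∸ i)))
              (bin-limit i i j ℕₚ.≤-refl i≤j))
      where
      i≤j : i ≤ j
      i≤j = ℕₚ.≤-trans i≤N (ℕₚ.+-cancelˡ-≤ i N j
        (ℕₚ.≤-trans (ℕₚ.+-monoˡ-≤ N i≤N) (ℕₚ.≤-reflexive (≡.sym p))))
    gain (inj₂ N≤i) = ≈-weaken (ℕₚ.≤-reflexive (≡.sym k+j≡N))
      (⊛-gain (≡.subst (λ k → Ord (i ∸ N) (θ k N)) (ℕₚ.m∸n+n≡m N≤i) (Ord-θ-≥ N (i ∸ N)))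
              (bin-limit j i j (ℕₚ.≤-trans j≤N N≤i) ℕₚ.≤-refl))
      where
      k+j≡N : i ∸ N + j ≡ N
      k+j≡N = ℕₚ.+-cancelˡ-≡ N _ _ (≡.trans (≡.sym (ℕₚ.+-assoc N (i ∸ N) j))
        (≡.trans (cong (_+ j) (ℕₚ.m+[n∸m]≡n N≤i)) p))
      j≤N : j ≤ N
      j≤N = ℕₚ.≤-trans (ℕₚ.m≤n+m j (i ∸ N)) (ℕₚ.≤-reflexive k+j≡N)

  theta-term : ℕ → S
  theta-term k = Q ↑ tri (suc k) ⊛ (u ↑ suc k ⊕ v ↑ suc k)

  theta : S
  theta = 𝟏 ⊕ lim (λ N → ∑ N theta-term)

  Ord-theta-term : ∀ k → Ord k (theta-term k)
  Ord-theta-term k = ≈-weaken (ℕₚ.n≤1+n k) (Ord-⊛ {0} Ord-0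
    (≈-trans (⊕-≈ (Ord₁-↑ ou (suc k)) (Ord₁-↑ ov (suc k))) (≋⇒≈ (⊕-identityˡ 𝟎))))

  θ-sum : ∀ N → ∑ (suc (N + N)) (λ i → θ i N) ≋ 𝟏 ⊕ ∑ N theta-term
  θ-sum zero    = ≋-trans (⊕-comm 𝟎 _) (⊕-cong (⊛-identityˡ 𝟏) ≋-refl)
  θ-sum (suc N) = begin
    ∑ (suc (suc N + suc N)) (λ i → θ i (suc N))
      ≈⟨ ≡⇒≋ (λ m → ∑ (suc (suc m)) (λ i → θ i (suc N))) (ℕₚ.+-suc N N) ⟩
    ∑ (suc (suc (suc (N + N)))) (λ i → θ i (suc N))
      ≈⟨ ∑-sucˡ (suc (suc (N + N))) (λ i → θ i (suc N)) ⟩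
    θ 0 (suc N) ⊕ (∑ (suc (N + N)) (λ i → θ i N) ⊕ θ (suc N + N) N)
      ≈⟨ ⊕-cong ≋-refl (⊕-cong (θ-sum N) (θ-≥ N (suc N))) ⟩
    Q ↑ tri (suc N) ⊛ v ↑ suc N ⊕ (𝟏 ⊕ ∑ N theta-term ⊕ Q ↑ tri (suc N) ⊛ u ↑ suc N)
      ≈⟨ solve 5 (λ t v o s u → t :* v :+ (o :+ s :+ t :* u) := o :+ (s :+ t :* (u :+ v))) ≋-refl
           (Q ↑ tri (suc N)) (v ↑ suc N) 𝟏 (∑ N theta-term) (u ↑ suc N) ⟩
    𝟏 ⊕ ∑ (suc N) theta-term ∎
    where open ≋-Reasoning

  triple-product : qq∞ ⊛ (lim (λ N → ∏ N u-factor) ⊛ lim (λ N → ∏ N v-factor)) ≋ theta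
  triple-product = ≈⇒≋ λ N → ≈-trans
    (⊛-≈ (λ _ _ → ≡.refl) (⊛-≈ (lim-≈ (factor-stable ou) (ℕₚ.≤-refl {N})) (lim-≈ (factor-stable ov) (ℕₚ.≤-refl {N}))))
    (≈-trans (≋⇒≈ (≋-trans (⊛-cong ≋-refl (finite-triple-product N N))
                           (≋-sym (csum-⊛ˡ qq∞ (λ i j → bin i j ⊛ θ i N) (N + N)))))
    (≈-trans (csum-≈ (N + N) (θ-limit N))
    (≈-trans (≋⇒≈ (≋-trans (csum-∑ (λ i → θ i N) (N + N)) (θ-sum N)))
             (⊕-≈ (λ _ _ → ≡.refl) (≈-sym (lim-≈ (∑-stable Ord-theta-term) (ℕₚ.≤-refl {N})))))))
    where
    factor-stable : ∀ {w} → Ord 1 w → Stable (λ N → ∏ N (λ j → 𝟏 ⊕ w ⊛ Q ↑ j))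
    factor-stable ow = ∏-stable λ j → ≈-trans
      (⊕-≈ (λ _ _ → ≡.refl) (Ord-⊛ {0} Ord-0 (Ord₁-↑ oQ j))) (≋⇒≈ (⊕-identityʳ 𝟏))

-- Infinite products

lim-cong : ∀ {G H} → (∀ N → G N ≋ H N) → lim G ≋ lim H
lim-cong p n = p (suc n) n

lim-⊛ : ∀ {G H} → Stable G → Stable H → lim G ⊛ lim H ≋ lim (λ N → G N ⊛ H N)
lim-⊛ sG sH = ≈⇒≋ λ N → ≈-trans
  (⊛-≈ (lim-≈ sG (ℕₚ.≤-refl {N})) (lim-≈ sH (ℕₚ.≤-refl {N})))
  (≈-sym (lim-≈ (λ n → ⊛-≈ (sG n) (sH n)) (ℕₚ.≤-refl {N})))

Π∞ : (ℕ → S) → S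
Π∞ F = lim (λ N → ∏ N F)

Convergent : (ℕ → S) → Set
Convergent F = ∀ n → F n ≈[ n ] 𝟏

Π∞-cong : ∀ {F G} → (∀ n → F n ≋ G n) → Π∞ F ≋ Π∞ G
Π∞-cong p = lim-cong (λ N → ∏-cong N p)

Π∞-⊛ : ∀ {F G} → Convergent F → Convergent G → Π∞ F ⊛ Π∞ G ≋ Π∞ (λ n → F n ⊛ G n)
Π∞-⊛ {F} {G} cF cG = ≋-trans (lim-⊛ (∏-stable cF) (∏-stable cG))
                             (lim-cong (λ N → ≋-sym (∏-⊛ N F G)))

Convergent-⊛ : ∀ {F G} → Convergent F → Convergent G → Convergent (λ n → F n ⊛ G n)
Convergent-⊛ cF cG n = ≈-trans (⊛-≈ (cF n) (cG n)) (≋⇒≈ (⊛-identityˡ 𝟏))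

Convergent-∏ : ∀ m {F : ℕ → ℕ → S} → (∀ i → Convergent (F i)) → Convergent (λ n → ∏ m (λ i → F i n))
Convergent-∏ zero    cF n = λ _ _ → ≡.refl
Convergent-∏ (suc m) cF   = Convergent-⊛ (Convergent-∏ m cF) (cF m)

Π∞-∏ : ∀ m {F : ℕ → ℕ → S} → (∀ i → Convergent (F i)) → Π∞ (λ n → ∏ m (λ i → F i n)) ≋ ∏ m (λ i → Π∞ (F i))
Π∞-∏ zero    cF = ≋-trans (lim-cong (λ N → ∏-𝟏 N (λ _ → ≋-refl))) ≋-refl
Π∞-∏ (suc m) cF = ≋-trans (≋-sym (Π∞-⊛ (Convergent-∏ m cF) (cF m))) (⊛-cong (Π∞-∏ m cF) ≋-refl)

∏-+ : ∀ m n F → ∏ (m + n) F ≋ ∏ m F ⊛ ∏ n (λ i → F (m + i))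
∏-+ zero    n F = ≋-sym (⊛-identityˡ _)
∏-+ (suc m) n F = begin
  ∏ (suc m + n) F
    ≈⟨ ∏-sucˡ (m + n) F ⟩
  F 0 ⊛ ∏ (m + n) (λ i → F (suc i))
    ≈⟨ ⊛-cong ≋-refl (∏-+ m n (λ i → F (suc i))) ⟩
  F 0 ⊛ (∏ m (λ i → F (suc i)) ⊛ ∏ n (λ i → F (suc m + i)))
    ≈⟨ ≋-sym (⊛-assoc _ _ _) ⟩
  F 0 ⊛ ∏ m (λ i → F (suc i)) ⊛ ∏ n (λ i → F (suc m + i))
    ≈⟨ ⊛-cong (≋-sym (∏-sucˡ m F)) ≋-refl ⟩
  ∏ (suc m) F ⊛ ∏ n (λ i → F (suc m + i)) ∎
  where open ≋-Reasoning

∏-block : ∀ N m F → ∏ (N * m) F ≋ ∏ N (λ j → ∏ m (λ i → F (j * m + i)))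
∏-block zero    m F = ≋-refl
∏-block (suc N) m F = begin
  ∏ (m + N * m) F
    ≈⟨ ∏-+ m (N * m) F ⟩
  ∏ m F ⊛ ∏ (N * m) (λ i → F (m + i))
    ≈⟨ ⊛-cong ≋-refl (∏-block N m (λ i → F (m + i))) ⟩
  ∏ m F ⊛ ∏ N (λ j → ∏ m (λ i → F (m + (j * m + i))))
    ≈⟨ ⊛-cong ≋-refl (∏-cong N (λ j → ∏-cong m (λ i → ≡⇒≋ F (≡.sym (ℕₚ.+-assoc m (j * m) i))))) ⟩
  ∏ m F ⊛ ∏ N (λ j → ∏ m (λ i → F (suc j * m + i)))
    ≈⟨ ≋-sym (∏-sucˡ N (λ j → ∏ m (λ i → F (j * m + i)))) ⟩
  ∏ (suc N) (λ j → ∏ m (λ i → F (j * m + i))) ∎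
  where open ≋-Reasoning

Π∞-block : ∀ m .{{_ : NonZero m}} {F} → Convergent F → Π∞ F ≋ Π∞ (λ j → ∏ m (λ i → F (j * m + i)))
Π∞-block m {F} cF = ≈⇒≋ λ N → ≈-trans
  (lim-≈ (∏-stable cF) (ℕₚ.m≤m*n N m))
  (≈-trans (≋⇒≈ (∏-block N m F))
           (≈-sym (lim-≈ (∏-stable (Convergent-∏ m (λ i j →
              ≈-weaken (ℕₚ.≤-trans (ℕₚ.m≤m*n j m) (ℕₚ.m≤m+n (j * m) i)) (cF (j * m + i))))) (ℕₚ.≤-refl {N}))))

geo-≈ : ∀ {n y} → Ord 1 y → Ord n y → geo y ≈[ n ] 𝟏
geo-≈ {n} {y} o₁ oₙ = ≈-trans
  (≋⇒≈ (≋-trans (solve 2 (λ y g → g := (c1 :- y) :* g :+ y :* g) ≋-refl y (geo y))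
                (⊕-cong (geo-inverse o₁) ≋-refl)))
  (≈-trans (⊕-≈ (λ _ _ → ≡.refl)
    (≈-weaken (ℕₚ.m≤m+n n 0) (Ord-⊛ oₙ (Ord-0 {geo y})))) (≋⇒≈ (⊕-identityʳ 𝟏)))

⊖-even : ∀ y n → (⊖ y) ↑ (n * 2) ≋ y ↑ (n * 2)
⊖-even y n = ≋-trans (↑-* (⊖ y) n 2) (≋-trans
  (↑-cong n (solve 1 (λ y → :- y :* (:- y :* c1) := y :* (y :* c1)) ≋-refl y)) (≋-sym (↑-* y n 2)))

⊖-odd : ∀ y n → (⊖ y) ↑ suc (n * 2) ≋ ⊖ (y ↑ suc (n * 2))
⊖-odd y n = ≋-trans (⊛-cong ≋-refl (⊖-even y n))
  (solve 2 (λ y p → :- y :* p := :- (y :* p)) ≋-refl y (y ↑ (n * 2)))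

-- Products of 1 ∓ y^n over the arithmetic progression n ≡ a (mod k), n ≥ a

module Eta (y : S) (oy : Ord 1 y) where

  pm pp : ℕ → ℕ → S
  pm a k = Π∞ (λ j → 𝟏 ⊝ y ↑ (a + j * k))
  pp a k = Π∞ (λ j → 𝟏 ⊕ y ↑ (a + j * k))

  Ord-AP : ∀ a k .{{_ : NonZero k}} j → Ord j (y ↑ (a + j * k))
  Ord-AP a k j = ≈-weaken (ℕₚ.≤-trans (ℕₚ.m≤m*n j k) (ℕₚ.m≤n+m (j * k) a)) (Ord₁-↑ oy (a + j * k))

  pm-convergent : ∀ a k .{{_ : NonZero k}} → Convergent (λ j → 𝟏 ⊝ y ↑ (a + j * k))
  pm-convergent a k j = 𝟏⊝-≈ (Ord-AP a k j)

  pp-convergent : ∀ a k .{{_ : NonZero k}} → Convergent (λ j → 𝟏 ⊕ y ↑ (a + j * k))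
  pp-convergent a k j = ≈-trans (⊕-≈ (λ _ _ → ≡.refl) (Ord-AP a k j)) (≋⇒≈ (⊕-identityʳ 𝟏))

  η : ℕ → S
  η k = pm k k

  block-exponent : ∀ m a k i j → a + (j * m + i) * k ≡ a + i * k + j * (m * k)
  block-exponent = ℕ-Solver.solve-∀

  pm-block : ∀ m a k .{{_ : NonZero m}} .{{_ : NonZero k}} → pm a k ≋ ∏ m (λ i → pm (a + i * k) (m * k))
  pm-block m a k = ≋-trans (Π∞-block m (pm-convergent a k))
    (≋-trans (Π∞-cong (λ j → ∏-cong m (λ i →
                ⊕-cong ≋-refl (⊖-cong (↑-≡ y (block-exponent m a k i j))))))
             (Π∞-∏ m (λ i → pm-convergent (a + i * k) (m * k) {{ℕₚ.m*n≢0 m k}})))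

  pp-block : ∀ m a k .{{_ : NonZero m}} .{{_ : NonZero k}} → pp a k ≋ ∏ m (λ i → pp (a + i * k) (m * k))
  pp-block m a k = ≋-trans (Π∞-block m (pp-convergent a k))
    (≋-trans (Π∞-cong (λ j → ∏-cong m (λ i → ⊕-cong ≋-refl (↑-≡ y (block-exponent m a k i j)))))
             (Π∞-∏ m (λ i → pp-convergent (a + i * k) (m * k) {{ℕₚ.m*n≢0 m k}})))

  pp-pm : ∀ a k .{{_ : NonZero k}} → pp a k ⊛ pm a k ≋ pm (a + a) (k + k)
  pp-pm a k = ≋-trans (Π∞-⊛ (pp-convergent a k) (pm-convergent a k)) (Π∞-cong λ j → ≋-trans
    (solve 1 (λ x → (c1 :+ x) :* (c1 :- x) := c1 :- x :* x) ≋-refl (y ↑ (a + j * k)))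
    (⊕-cong ≋-refl (⊖-cong (≋-sym (↑-split y (a + j * k) (a + j * k) (exponent a k j))))))
    where
    exponent : ∀ a k j → a + a + j * (k + k) ≡ a + j * k + (a + j * k)
    exponent = ℕ-Solver.solve-∀

  pm-Unit : ∀ a k .{{_ : NonZero a}} .{{_ : NonZero k}} → Unit (pm a k)
  pm-Unit a@(suc _) k = Π∞ (λ j → geo (y ↑ (a + j * k))) , ≋-trans
    (Π∞-⊛ (pm-convergent a k) (λ j → geo-≈ (o₁ j) (Ord-AP a k j)))
    (≋-trans (Π∞-cong (λ j → geo-inverse (o₁ j))) (lim-cong (λ N → ∏-𝟏 N (λ _ → ≋-refl))))
    where
    o₁ : ∀ j → Ord 1 (y ↑ (a + j * k))
    o₁ j = ≈-weaken (s≤s z≤n) (Ord₁-↑ oy (a + j * k))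

  η-Unit : ∀ k .{{_ : NonZero k}} → Unit (η k)
  η-Unit k = pm-Unit k k

Unit-⊛ : ∀ {x y} → Unit x → Unit y → Unit (x ⊛ y)
Unit-⊛ {x} {y} (x⁻¹ , p) (y⁻¹ , r) = x⁻¹ ⊛ y⁻¹ , ≋-trans
  (solve 4 (λ x y a b → x :* y :* (a :* b) := x :* a :* (y :* b)) ≋-refl x y x⁻¹ y⁻¹)
  (≋-trans (⊛-cong p r) (⊛-identityˡ 𝟏))

-- Theta functions and the reciprocal theta function as eta quotients

module EtaIdentities (y : S) (oy : Ord 1 y) where

  open Eta y oy public
  open ≋-Reasoning

  private
    o : ∀ a .{{_ : NonZero a}} → Ord 1 (y ↑ a)
    o (suc a) = ≈-weaken (s≤s z≤n) (Ord₁-↑ oy (suc a))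

    block₂ : ∀ a k .{{_ : NonZero k}} → pm a k ≋ pm (a + 0) (k + (k + 0)) ⊛ pm (a + (k + 0)) (k + (k + 0))
    block₂ a k = ≋-trans (pm-block 2 a k) (⊛-cong (⊛-identityˡ _) ≋-refl)

    block₃ : ∀ a k .{{_ : NonZero k}} → pm a k
      ≋ pm (a + 0) (3 * k) ⊛ pm (a + (k + 0)) (3 * k) ⊛ pm (a + (k + (k + 0))) (3 * k)
    block₃ a k = ≋-trans (pm-block 3 a k) (⊛-cong (⊛-cong (⊛-identityˡ _) ≋-refl) ≋-refl)

    block₆ : ∀ a k .{{_ : NonZero k}} → pm a k
      ≋ pm (a + 0) (6 * k) ⊛ pm (a + 1 * k) (6 * k) ⊛ pm (a + 2 * k) (6 * k)
        ⊛ pm (a + 3 * k) (6 * k) ⊛ pm (a + 4 * k) (6 * k) ⊛ pm (a + 5 * k) (6 * k)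
    block₆ a k = ≋-trans (pm-block 6 a k)
      (⊛-cong (⊛-cong (⊛-cong (⊛-cong (⊛-cong (⊛-identityˡ _) ≋-refl) ≋-refl) ≋-refl) ≋-refl) ≋-refl)

  Q-power : ∀ a b j → (y ↑ a ⊛ y ↑ b) ↑ j ≋ y ↑ (j * (a + b))
  Q-power a b j = ≋-trans (↑-cong j (≋-sym (↑-+ y a b))) (≋-sym (↑-* y j (a + b)))

  -- Here `theta` is Ramanujan's f(y^a, y^b), with Q = y^{a+b}.
  module Θ (a b : ℕ) .{{_ : NonZero a}} .{{_ : NonZero b}} = TripleProduct (y ↑ a) (y ↑ b) (o a) (o b)

  module _ (a b : ℕ) .{{_ : NonZero a}} .{{_ : NonZero b}} where

    qq∞-η : Θ.qq∞ a b ≋ η (a + b)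
    qq∞-η = Π∞-cong (λ j → ⊕-cong ≋-refl (⊖-cong (Q-power a b (suc j))))

    theta-product : Θ.theta a b ≋ η (a + b) ⊛ (pp a (a + b) ⊛ pp b (a + b))
    theta-product = ≋-trans (≋-sym (Θ.triple-product a b)) (⊛-cong qq∞-η (⊛-cong (side a) (side b)))
      where
      side : ∀ c → Π∞ (λ j → 𝟏 ⊕ y ↑ c ⊛ (y ↑ a ⊛ y ↑ b) ↑ j) ≋ pp c (a + b)
      side c = Π∞-cong (λ j → ⊕-cong ≋-refl
        (≋-trans (⊛-cong ≋-refl (Q-power a b j)) (≋-sym (↑-+ y c (j * (a + b))))))

    lambert-product : (pm a (a + b) ⊛ pm b (a + b)) ⊛ lim (λ N → ∑ N (Θ.K₁ a b)) ≋ η (a + b) ⊛ η (a + b)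
    lambert-product = begin
      (pm a (a + b) ⊛ pm b (a + b)) ⊛ lim (λ N → ∑ N (Θ.K₁ a b))
        ≈⟨ ⊛-cong (≋-trans (Π∞-⊛ (pm-convergent a (a + b) {{nz}}) (pm-convergent b (a + b) {{nz}}))
             (Π∞-cong (λ j → ⊛-cong (side a j) (side b j)))) ≋-refl ⟩
      Π∞ (Θ.d a b) ⊛ lim (λ N → ∑ N (Θ.K₁ a b))
        ≈⟨ Θ.reciprocal-theta a b ⟩
      Θ.qq∞ a b ⊛ Θ.qq∞ a b
        ≈⟨ ⊛-cong qq∞-η qq∞-η ⟩
      η (a + b) ⊛ η (a + b) ∎
      where
      nz : NonZero (a + b)
      nz = ℕ.>-nonZero (ℕₚ.≤-trans (ℕ.>-nonZero⁻¹ a) (ℕₚ.m≤m+n a b))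
      side : ∀ c j → 𝟏 ⊝ y ↑ (c + j * (a + b)) ≋ 𝟏 ⊝ y ↑ c ⊛ (y ↑ a ⊛ y ↑ b) ↑ j
      side c j = ⊕-cong ≋-refl (⊖-cong
        (≋-trans (↑-+ y c (j * (a + b))) (⊛-cong ≋-refl (≋-sym (Q-power a b j)))))

  -- Gauss's product for ψ(y) = f(y, y³). The two progressions modulo 4 join to all odd n, where
  -- each 1 + y^n meets 1 - y^n from f_1.
  ψ-product : Θ.theta 1 3 ⊛ η 1 ≋ η 2 ⊛ η 2
  ψ-product = begin
    Θ.theta 1 3 ⊛ η 1
      ≈⟨ ⊛-cong (theta-product 1 3) (block₂ 1 1) ⟩
    η 4 ⊛ (pp 1 4 ⊛ pp 3 4) ⊛ (pm 1 2 ⊛ η 2)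
      ≈⟨ solve 5 (λ e p p′ m f → e :* (p :* p′) :* (m :* f) := ((c1 :* p :* p′) :* m) :* e :* f) ≋-refl
           (η 4) (pp 1 4) (pp 3 4) (pm 1 2) (η 2) ⟩
    (𝟏 ⊛ pp 1 4 ⊛ pp 3 4) ⊛ pm 1 2 ⊛ η 4 ⊛ η 2
      ≈⟨ ⊛-cong (⊛-cong (≋-trans (⊛-cong (≋-sym (pp-block 2 1 2)) ≋-refl) (pp-pm 1 2)) ≋-refl) ≋-refl ⟩
    pm 2 4 ⊛ η 4 ⊛ η 2
      ≈⟨ ⊛-cong (≋-sym (block₂ 2 2)) ≋-refl ⟩
    η 2 ⊛ η 2 ∎

  -- With u = v = -y one has Q = y², so `theta` is φ(-y).
  module φ⁻ = TripleProduct (⊖ y) (⊖ y) (Ord-⊖ oy) (Ord-⊖ oy)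

  φ⁻-product : φ⁻.theta ⊛ η 2 ≋ η 1 ⊛ η 1
  φ⁻-product = begin
    φ⁻.theta ⊛ η 2
      ≈⟨ ⊛-cong (≋-sym φ⁻.triple-product) ≋-refl ⟩
    φ⁻.qq∞ ⊛ (Π∞ φ⁻.u-factor ⊛ Π∞ φ⁻.v-factor) ⊛ η 2
      ≈⟨ ⊛-cong (⊛-cong (Π∞-cong (λ j → ⊕-cong ≋-refl (⊖-cong (Q-power′ (suc j))))) (⊛-cong side side)) ≋-refl ⟩
    η 2 ⊛ (pm 1 2 ⊛ pm 1 2) ⊛ η 2
      ≈⟨ solve 2 (λ e p → e :* (p :* p) :* e := p :* e :* (p :* e)) ≋-refl (η 2) (pm 1 2) ⟩
    pm 1 2 ⊛ η 2 ⊛ (pm 1 2 ⊛ η 2)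
      ≈⟨ ≋-sym (⊛-cong (block₂ 1 1) (block₂ 1 1)) ⟩
    η 1 ⊛ η 1 ∎
    where
    Q-power′ : ∀ j → (⊖ y ⊛ ⊖ y) ↑ j ≋ y ↑ (j * 2)
    Q-power′ j = ≋-trans (↑-cong j (solve 1 (λ y → :- y :* :- y := y :* (y :* c1)) ≋-refl y)) (≋-sym (↑-* y j 2))
    side : Π∞ φ⁻.u-factor ≋ pm 1 2
    side = Π∞-cong (λ j → ⊕-cong ≋-refl (≋-trans (⊛-cong ≋-refl (Q-power′ j))
      (solve 2 (λ y p → :- y :* p := :- (y :* p)) ≋-refl y (y ↑ (j * 2)))))

  -- Each factor 1 + y^n with n prime to 3 is completed to 1 - y^{2n} by a factor of f_1; together
  -- with f_6 these make up f_2.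
  theta₁₂-product : Θ.theta 1 2 ⊛ (η 1 ⊛ η 6) ≋ η 2 ⊛ (η 3 ⊛ η 3)
  theta₁₂-product = begin
    Θ.theta 1 2 ⊛ (η 1 ⊛ η 6)
      ≈⟨ ⊛-cong (theta-product 1 2) (⊛-cong (block₃ 1 1) ≋-refl) ⟩
    η 3 ⊛ (pp 1 3 ⊛ pp 2 3) ⊛ (pm 1 3 ⊛ pm 2 3 ⊛ η 3 ⊛ η 6)
      ≈⟨ solve 6 (λ e p p′ m m′ f → e :* (p :* p′) :* (m :* m′ :* e :* f) := (p :* m) :* (p′ :* m′) :* f :* (e :* e))
           ≋-refl (η 3) (pp 1 3) (pp 2 3) (pm 1 3) (pm 2 3) (η 6) ⟩
    (pp 1 3 ⊛ pm 1 3) ⊛ (pp 2 3 ⊛ pm 2 3) ⊛ η 6 ⊛ (η 3 ⊛ η 3)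
      ≈⟨ ⊛-cong (⊛-cong (⊛-cong (pp-pm 1 3) (pp-pm 2 3)) ≋-refl) ≋-refl ⟩
    pm 2 6 ⊛ pm 4 6 ⊛ η 6 ⊛ (η 3 ⊛ η 3)
      ≈⟨ ⊛-cong (≋-sym (block₃ 2 2)) ≋-refl ⟩
    η 2 ⊛ (η 3 ⊛ η 3) ∎

  theta₂₄-product : Θ.theta 2 4 ⊛ (η 2 ⊛ η 12) ≋ η 4 ⊛ (η 6 ⊛ η 6)
  theta₂₄-product = begin
    Θ.theta 2 4 ⊛ (η 2 ⊛ η 12)
      ≈⟨ ⊛-cong (theta-product 2 4) (⊛-cong (block₃ 2 2) ≋-refl) ⟩
    η 6 ⊛ (pp 2 6 ⊛ pp 4 6) ⊛ (pm 2 6 ⊛ pm 4 6 ⊛ η 6 ⊛ η 12)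
      ≈⟨ solve 6 (λ e p p′ m m′ f → e :* (p :* p′) :* (m :* m′ :* e :* f) := (p :* m) :* (p′ :* m′) :* f :* (e :* e))
           ≋-refl (η 6) (pp 2 6) (pp 4 6) (pm 2 6) (pm 4 6) (η 12) ⟩
    (pp 2 6 ⊛ pm 2 6) ⊛ (pp 4 6 ⊛ pm 4 6) ⊛ η 12 ⊛ (η 6 ⊛ η 6)
      ≈⟨ ⊛-cong (⊛-cong (⊛-cong (pp-pm 2 6) (pp-pm 4 6)) ≋-refl) ≋-refl ⟩
    pm 4 12 ⊛ pm 8 12 ⊛ η 12 ⊛ (η 6 ⊛ η 6)
      ≈⟨ ⊛-cong (≋-sym (block₃ 4 4)) ≋-refl ⟩
    η 4 ⊛ (η 6 ⊛ η 6) ∎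

  -- Inclusion and exclusion for the exponents prime to 6: remove the multiples of 2 and of 3 from
  -- all exponents, restore the multiples of 6.
  pm-1-5 : pm 1 6 ⊛ pm 5 6 ⊛ (η 2 ⊛ η 3) ≋ η 1 ⊛ η 6
  pm-1-5 = begin
    pm 1 6 ⊛ pm 5 6 ⊛ (η 2 ⊛ η 3)
      ≈⟨ ⊛-cong ≋-refl (⊛-cong (block₃ 2 2) (block₂ 3 3)) ⟩
    pm 1 6 ⊛ pm 5 6 ⊛ (pm 2 6 ⊛ pm 4 6 ⊛ η 6 ⊛ (pm 3 6 ⊛ η 6))
      ≈⟨ solve 6 (λ a b c d e f → a :* e :* (b :* d :* f :* (c :* f)) := a :* b :* c :* d :* e :* f :* f) ≋-refl
           (pm 1 6) (pm 2 6) (pm 3 6) (pm 4 6) (pm 5 6) (η 6) ⟩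
    pm 1 6 ⊛ pm 2 6 ⊛ pm 3 6 ⊛ pm 4 6 ⊛ pm 5 6 ⊛ η 6 ⊛ η 6
      ≈⟨ ⊛-cong (≋-sym (block₆ 1 1)) ≋-refl ⟩
    η 1 ⊛ η 6 ∎

  theta₁₅-product : Θ.theta 1 5 ⊛ (η 1 ⊛ η 6 ⊛ η 4) ≋ η 2 ⊛ η 2 ⊛ η 3 ⊛ η 12
  theta₁₅-product = begin
    Θ.theta 1 5 ⊛ (η 1 ⊛ η 6 ⊛ η 4)
      ≈⟨ ⊛-cong (theta-product 1 5) (⊛-cong (≋-sym pm-1-5) (block₃ 4 4)) ⟩
    η 6 ⊛ (pp 1 6 ⊛ pp 5 6) ⊛ (pm 1 6 ⊛ pm 5 6 ⊛ (η 2 ⊛ η 3) ⊛ (pm 4 12 ⊛ pm 8 12 ⊛ η 12))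
      ≈⟨ solve 10 (λ e p p′ m m′ e₂ e₃ a b e₁₂ →
           e :* (p :* p′) :* (m :* m′ :* (e₂ :* e₃) :* (a :* b :* e₁₂))
             := ((p :* m) :* a :* e :* b :* (p′ :* m′) :* e₁₂) :* e₂ :* e₃) ≋-refl
           (η 6) (pp 1 6) (pp 5 6) (pm 1 6) (pm 5 6) (η 2) (η 3) (pm 4 12) (pm 8 12) (η 12) ⟩
    ((pp 1 6 ⊛ pm 1 6) ⊛ pm 4 12 ⊛ η 6 ⊛ pm 8 12 ⊛ (pp 5 6 ⊛ pm 5 6) ⊛ η 12) ⊛ η 2 ⊛ η 3
      ≈⟨ ⊛-cong (⊛-cong (⊛-cong (⊛-cong (⊛-cong (⊛-cong (⊛-cong (pp-pm 1 6) ≋-refl) (block₂ 6 6)) ≋-refl)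
           (pp-pm 5 6)) ≋-refl) ≋-refl) ≋-refl ⟩
    (pm 2 12 ⊛ pm 4 12 ⊛ (pm 6 12 ⊛ η 12) ⊛ pm 8 12 ⊛ pm 10 12 ⊛ η 12) ⊛ η 2 ⊛ η 3
      ≈⟨ solve 8 (λ a b c d e f e₂ e₃ → (a :* b :* (c :* f) :* d :* e :* f) :* e₂ :* e₃
             := a :* b :* c :* d :* e :* f :* e₂ :* e₃ :* f) ≋-refl
           (pm 2 12) (pm 4 12) (pm 6 12) (pm 8 12) (pm 10 12) (η 12) (η 2) (η 3) ⟩
    pm 2 12 ⊛ pm 4 12 ⊛ pm 6 12 ⊛ pm 8 12 ⊛ pm 10 12 ⊛ η 12 ⊛ η 2 ⊛ η 3 ⊛ η 12
      ≈⟨ ⊛-cong (⊛-cong (⊛-cong (≋-sym (block₆ 2 2)) ≋-refl) ≋-refl) ≋-refl ⟩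
    η 2 ⊛ η 2 ⊛ η 3 ⊛ η 12 ∎

  -- The reciprocal theta function is f_6² over the product of 1 - y^n with n prime to 6, and that
  -- product is f_1 f_6 / (f_2 f_3).
  lambert₁₅-product : lim (λ N → ∑ N (Θ.K₁ 1 5)) ⊛ η 1 ≋ η 2 ⊛ η 3 ⊛ η 6
  lambert₁₅-product = ⊛-cancel (η-Unit 6) (begin
    η 6 ⊛ (V ⊛ η 1)
      ≈⟨ solve 3 (λ e v f → e :* (v :* f) := v :* (f :* e)) ≋-refl (η 6) V (η 1) ⟩
    V ⊛ (η 1 ⊛ η 6)
      ≈⟨ ⊛-cong ≋-refl (≋-sym pm-1-5) ⟩
    V ⊛ (pm 1 6 ⊛ pm 5 6 ⊛ (η 2 ⊛ η 3))
      ≈⟨ solve 4 (λ v p a b → v :* (p :* (a :* b)) := p :* v :* (a :* b)) ≋-refl V (pm 1 6 ⊛ pm 5 6) (η 2) (η 3) ⟩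
    (pm 1 6 ⊛ pm 5 6) ⊛ V ⊛ (η 2 ⊛ η 3)
      ≈⟨ ⊛-cong (lambert-product 1 5) ≋-refl ⟩
    η 6 ⊛ η 6 ⊛ (η 2 ⊛ η 3)
      ≈⟨ solve 3 (λ e a b → e :* e :* (a :* b) := e :* (a :* b :* e)) ≋-refl (η 6) (η 2) (η 3) ⟩
    η 6 ⊛ (η 2 ⊛ η 3 ⊛ η 6) ∎)
    where V = lim (λ N → ∑ N (Θ.K₁ 1 5))

  module Eta⁻ = Eta (⊖ y) (Ord-⊖ oy)

  η⁻-even : ∀ k → Eta⁻.η (k * 2) ≋ η (k * 2)
  η⁻-even k = Π∞-cong (λ j → ⊕-cong ≋-refl (⊖-cong (≋-trans
    (↑-≡ (⊖ y) (exponent j)) (≋-trans (⊖-even y (suc j * k)) (↑-≡ y (≡.sym (exponent j)))))))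
    where
    exponent : ∀ j → k * 2 + j * (k * 2) ≡ suc j * k * 2
    exponent j = ≡.sym (ℕₚ.*-assoc (suc j) k 2)

  -- The substitution of -y changes only the factors with odd n, to 1 + y^n; those of f_1 complete
  -- them to 1 - y^{2n}.
  η⁻-product : Eta⁻.η 1 ⊛ η 1 ⊛ η 4 ≋ η 2 ⊛ η 2 ⊛ η 2
  η⁻-product = begin
    Eta⁻.η 1 ⊛ η 1 ⊛ η 4
      ≈⟨ ⊛-cong (⊛-cong (≋-trans (≋-trans (Eta⁻.pm-block 2 1 1) (⊛-cong (⊛-identityˡ _) ≋-refl))
           (⊛-cong odd (η⁻-even 1))) (block₂ 1 1)) ≋-refl ⟩
    pp 1 2 ⊛ η 2 ⊛ (pm 1 2 ⊛ η 2) ⊛ η 4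
      ≈⟨ solve 4 (λ p m e f → p :* e :* (m :* e) :* f := (p :* m) :* f :* e :* e) ≋-refl
           (pp 1 2) (pm 1 2) (η 2) (η 4) ⟩
    (pp 1 2 ⊛ pm 1 2) ⊛ η 4 ⊛ η 2 ⊛ η 2
      ≈⟨ ⊛-cong (⊛-cong (⊛-cong (pp-pm 1 2) ≋-refl) ≋-refl) ≋-refl ⟩
    pm 2 4 ⊛ η 4 ⊛ η 2 ⊛ η 2
      ≈⟨ ⊛-cong (⊛-cong (≋-sym (block₂ 2 2)) ≋-refl) ≋-refl ⟩
    η 2 ⊛ η 2 ⊛ η 2 ∎
    where
    odd : Eta⁻.pm 1 2 ≋ pp 1 2
    odd = Π∞-cong (λ j → ≋-trans (⊕-cong ≋-refl (⊖-cong (⊖-odd y j)))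
      (solve 1 (λ x → c1 :- (:- x) := c1 :+ x) ≋-refl (y ↑ suc (j * 2))))

η-↑ : ∀ y (oy : Ord 1 y) m (om : Ord 1 (y ↑ m)) k → Eta.η (y ↑ m) om k ≋ Eta.η y oy (k * m)
η-↑ y oy m om k = Π∞-cong (λ j → ⊕-cong ≋-refl (⊖-cong
  (≋-trans (≋-sym (↑-* y (k + j * k) m)) (↑-≡ y (exponent m k j)))))
  where
  exponent : ∀ m k j → (k + j * k) * m ≡ k * m + j * (k * m)
  exponent = ℕ-Solver.solve-∀

-- Sums of integers over finite boxes

Σ< : ℕ → (ℕ → ℤ) → ℤ
Σ< zero    f = ℤ.0ℤ
Σ< (suc N) f = Σ< N f ℤ.+ f N

Σ<-cong : ∀ N {f g} → (∀ i → i < N → f i ≡ g i) → Σ< N f ≡ Σ< N g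
Σ<-cong zero    p = ≡.refl
Σ<-cong (suc N) p = cong₂ ℤ._+_ (Σ<-cong N (λ i l → p i (ℕₚ.m≤n⇒m≤1+n l))) (p N ℕₚ.≤-refl)

Σ<-0 : ∀ N {f} → (∀ i → i < N → f i ≡ ℤ.0ℤ) → Σ< N f ≡ ℤ.0ℤ
Σ<-0 zero    p = ≡.refl
Σ<-0 (suc N) p = cong₂ ℤ._+_ (Σ<-0 N (λ i l → p i (ℕₚ.m≤n⇒m≤1+n l))) (p N ℕₚ.≤-refl)

interchange : ∀ a b c d → (a ℤ.+ b) ℤ.+ (c ℤ.+ d) ≡ (a ℤ.+ c) ℤ.+ (b ℤ.+ d)
interchange = solve-∀

Σ<-+ : ∀ N f g → Σ< N (λ i → f i ℤ.+ g i) ≡ Σ< N f ℤ.+ Σ< N g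
Σ<-+ zero    f g = ≡.refl
Σ<-+ (suc N) f g = ≡.trans (cong (ℤ._+ (f N ℤ.+ g N)) (Σ<-+ N f g))
                           (interchange (Σ< N f) (Σ< N g) (f N) (g N))

Σ<-* : ∀ N c f → Σ< N (λ i → c ℤ.* f i) ≡ c ℤ.* Σ< N f
Σ<-* zero    c f = ≡.sym (ℤₚ.*-zeroʳ c)
Σ<-* (suc N) c f = ≡.trans (cong (ℤ._+ c ℤ.* f N) (Σ<-* N c f)) (≡.sym (ℤₚ.*-distribˡ-+ c (Σ< N f) (f N)))

Σ<-swap : ∀ M N (f : ℕ → ℕ → ℤ) → Σ< M (λ i → Σ< N (f i)) ≡ Σ< N (λ j → Σ< M (λ i → f i j))
Σ<-swap zero    N f = ≡.sym (Σ<-0 N (λ _ _ → ≡.refl))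
Σ<-swap (suc M) N f = ≡.trans (cong (ℤ._+ Σ< N (f M)) (Σ<-swap M N f))
                              (≡.sym (Σ<-+ N (λ j → Σ< M (λ i → f i j)) (f M)))

Σ<-single : ∀ N {f} i → i < N → (∀ j → j ≢ i → f j ≡ ℤ.0ℤ) → Σ< N f ≡ f i
Σ<-single (suc N) {f} i l p with i ℕ.≟ N
... | yes ≡.refl = ≡.trans
      (cong (ℤ._+ f N) (Σ<-0 N (λ j j<N → p j (ℕₚ.<⇒≢ j<N)))) (ℤₚ.+-identityˡ (f N))
... | no i≢N = ≡.trans
      (cong₂ ℤ._+_ (Σ<-single N i (ℕₚ.≤∧≢⇒< (ℕₚ.≤-pred l) i≢N) p) (p N (λ e → i≢N (≡.sym e))))
      (ℤₚ.+-identityʳ (f i))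

Σ<-witness : ∀ N {f} → Σ< N f ≢ ℤ.0ℤ → Σ ℕ λ i → i < N × f i ≢ ℤ.0ℤ
Σ<-witness zero    nz = contradiction ≡.refl nz
Σ<-witness (suc N) {f} nz with f N ℤ.≟ ℤ.0ℤ
... | no  fN≢0 = N , ℕₚ.≤-refl , fN≢0
... | yes fN≡0 with Σ<-witness N (λ e → nz (cong₂ ℤ._+_ e fN≡0))
...   | i , l , fi≢0 = i , ℕₚ.m≤n⇒m≤1+n l , fi≢0

pattern neg k = ℤ.-[1+ k ]
pattern pos k = ℤ.+ k

-- The box -B ≤ x < B, in which each k stands for the pair k and -1 - k.
Σℤ : ℕ → (ℤ → ℤ) → ℤ
Σℤ B f = Σ< B (λ k → f (pos k) ℤ.+ f (neg k))

Σℤ-cong : ∀ B {f g} → (∀ x → ℤ.∣ x ∣ ≤ B → f x ≡ g x) → Σℤ B f ≡ Σℤ B g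
Σℤ-cong B p = Σ<-cong B (λ k l → cong₂ ℤ._+_ (p (pos k) (ℕₚ.<⇒≤ l)) (p (neg k) l))

Σℤ-0 : ∀ B {f} → (∀ x → f x ≡ ℤ.0ℤ) → Σℤ B f ≡ ℤ.0ℤ
Σℤ-0 B p = Σ<-0 B (λ k _ → cong₂ ℤ._+_ (p (pos k)) (p (neg k)))

Σℤ-* : ∀ B c f → Σℤ B (λ x → c ℤ.* f x) ≡ c ℤ.* Σℤ B f
Σℤ-* B c f = ≡.trans (Σ<-cong B (λ k _ → ≡.sym (ℤₚ.*-distribˡ-+ c (f (pos k)) (f (neg k)))))
                     (Σ<-* B c (λ k → f (pos k) ℤ.+ f (neg k)))

Σ<-Σℤ-swap : ∀ N B (f : ℕ → ℤ → ℤ) → Σ< N (λ i → Σℤ B (f i)) ≡ Σℤ B (λ x → Σ< N (λ i → f i x))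
Σ<-Σℤ-swap N B f = ≡.trans (Σ<-swap N B (λ i k → f i (pos k) ℤ.+ f i (neg k)))
  (Σ<-cong B (λ k _ → Σ<-+ N (λ i → f i (pos k)) (λ i → f i (neg k))))

Σℤ-swap : ∀ A B (f : ℤ → ℤ → ℤ) → Σℤ A (λ x → Σℤ B (f x)) ≡ Σℤ B (λ y → Σℤ A (λ x → f x y))
Σℤ-swap A B f = ≡.trans
  (Σ<-cong A (λ k _ → ≡.sym (Σ<-+ B (λ j → f (pos k) (pos j) ℤ.+ f (pos k) (neg j))
                                    (λ j → f (neg k) (pos j) ℤ.+ f (neg k) (neg j)))))
  (≡.trans (Σ<-cong A (λ k _ → Σ<-cong B (λ j _ →
      interchange (f (pos k) (pos j)) (f (pos k) (neg j)) (f (neg k) (pos j)) (f (neg k) (neg j)))))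
    (Σ<-Σℤ-swap A B (λ k y → f (pos k) y ℤ.+ f (neg k) y)))

Σℤ-single : ∀ B {f} y → ℤ.∣ y ∣ < B → (∀ x → x ≢ y → f x ≡ ℤ.0ℤ) → Σℤ B f ≡ f y
Σℤ-single B {f} (pos k) l p = ≡.trans
  (Σ<-single B k l (λ j j≢k → cong₂ ℤ._+_ (p (pos j) (λ { ≡.refl → j≢k ≡.refl })) (p (neg j) (λ ()))))
  (≡.trans (cong (λ z → f (pos k) ℤ.+ z) (p (neg k) (λ ()))) (ℤₚ.+-identityʳ _))
Σℤ-single B {f} (neg k) l p = ≡.trans
  (Σ<-single B k (ℕₚ.≤-trans (ℕₚ.n≤1+n (suc k)) l)
     (λ j j≢k → cong₂ ℤ._+_ (p (pos j) (λ ())) (p (neg j) (λ { ≡.refl → j≢k ≡.refl }))))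
  (≡.trans (cong (ℤ._+ f (neg k)) (p (pos k) (λ ()))) (ℤₚ.+-identityˡ _))

-- A change of variables need not map the box to itself; it suffices that the support of f and its
-- preimages lie inside. Both sums are evaluations of the matrix with entry f x where ι k = x and 0
-- elsewhere, one by rows and one by columns.
reindex : ∀ B (f : ℤ → ℤ) (ι : ℤ → ℤ) →
          (∀ x → f x ≢ ℤ.0ℤ → ℤ.∣ x ∣ < B) →
          (∀ x → f x ≢ ℤ.0ℤ → Σ ℤ λ k → ι k ≡ x × ℤ.∣ k ∣ < B) →
          (∀ k l → ι k ≡ ι l → k ≡ l) →
          Σℤ B f ≡ Σℤ B (λ k → f (ι k))
reindex B f ι supp onto inj = begin
  Σℤ B f                           ≡⟨ Σℤ-cong B (λ x _ → row x) ⟩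
  Σℤ B (λ x → Σℤ B (λ k → D x k))  ≡⟨ Σℤ-swap B B D ⟩
  Σℤ B (λ k → Σℤ B (λ x → D x k))  ≡⟨ Σℤ-cong B (λ k _ → ≡.sym (column k)) ⟩
  Σℤ B (λ k → f (ι k))             ∎
  where
  open ≡.≡-Reasoning
  D : ℤ → ℤ → ℤ
  D x k with ι k ℤ.≟ x
  ... | yes _ = f x
  ... | no  _ = ℤ.0ℤ
  D-yes : ∀ x k → ι k ≡ x → D x k ≡ f x
  D-yes x k e with ι k ℤ.≟ x
  ... | yes _ = ≡.refl
  ... | no ne = contradiction e ne
  D-no : ∀ x k → ι k ≢ x → D x k ≡ ℤ.0ℤ
  D-no x k ne with ι k ℤ.≟ x
  ... | yes e = contradiction e ne
  ... | no _  = ≡.refl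
  D-0 : ∀ x k → f x ≡ ℤ.0ℤ → D x k ≡ ℤ.0ℤ
  D-0 x k fx≡0 with ι k ℤ.≟ x
  ... | yes e = fx≡0
  ... | no _  = ≡.refl
  row : ∀ x → f x ≡ Σℤ B (D x)
  row x with f x ℤ.≟ ℤ.0ℤ
  ... | yes fx≡0 = ≡.trans fx≡0 (≡.sym (Σℤ-0 B (λ k → D-0 x k fx≡0)))
  ... | no  fx≢0 with onto x fx≢0
  ...   | k , ιk≡x , l = ≡.trans (≡.sym (D-yes x k ιk≡x))
            (≡.sym (Σℤ-single B k l (λ j j≢k → D-no x j (λ e → j≢k (inj j k (≡.trans e (≡.sym ιk≡x)))))))
  column : ∀ k → f (ι k) ≡ Σℤ B (λ x → D x k)
  column k with f (ι k) ℤ.≟ ℤ.0ℤ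
  ... | no  nz = ≡.trans (≡.sym (D-yes (ι k) k ≡.refl))
          (≡.sym (Σℤ-single B (ι k) (supp (ι k) nz) (λ x x≢ → D-no x k (λ e → x≢ (≡.sym e)))))
  ... | yes z  = ≡.trans z (≡.sym (Σℤ-0 B all))
    where
    all : ∀ x → D x k ≡ ℤ.0ℤ
    all x with ι k ℤ.≟ x
    ... | yes ≡.refl = z
    ... | no _       = ≡.refl

-- Signs and alternating sums over half lines

sgn : ℕ → ℤ
sgn zero    = ℤ.1ℤ
sgn (suc n) = ℤ.- sgn n

sgℤ : ℤ → ℤ
sgℤ (pos n) = sgn n
sgℤ (neg n) = ℤ.- sgn n

sgℤ-suc : ∀ x → sgℤ (ℤ.1ℤ ℤ.+ x) ≡ ℤ.- sgℤ x
sgℤ-suc (pos n)       = ≡.refl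
sgℤ-suc (neg zero)    = ≡.refl
sgℤ-suc (neg (suc n)) = ≡.sym (ℤₚ.neg-involutive _)

sgℤ-reflect : ∀ x → sgℤ (ℤ.-1ℤ ℤ.- x) ≡ ℤ.- sgℤ x
sgℤ-reflect (pos zero)    = ≡.refl
sgℤ-reflect (pos (suc n)) = ≡.refl
sgℤ-reflect (neg n)       = ≡.trans (cong sgℤ (lemma (pos n))) (≡.sym (ℤₚ.neg-involutive _))
  where
  lemma : ∀ n → ℤ.-1ℤ ℤ.- (ℤ.- (ℤ.1ℤ ℤ.+ n)) ≡ n
  lemma = solve-∀

sgℤ-even⁺ : ∀ n x → sgℤ (pos 2 ℤ.* pos n ℤ.+ x) ≡ sgℤ x
sgℤ-even⁺ zero    x = cong sgℤ (ℤₚ.+-identityˡ x)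
sgℤ-even⁺ (suc n) x = begin
  sgℤ (pos 2 ℤ.* (ℤ.1ℤ ℤ.+ pos n) ℤ.+ x)
    ≡⟨ cong sgℤ (lemma (pos n) x) ⟩
  sgℤ (ℤ.1ℤ ℤ.+ (ℤ.1ℤ ℤ.+ (pos 2 ℤ.* pos n ℤ.+ x)))
    ≡⟨ ≡.trans (sgℤ-suc (ℤ.1ℤ ℤ.+ (pos 2 ℤ.* pos n ℤ.+ x))) (cong ℤ.-_ (sgℤ-suc (pos 2 ℤ.* pos n ℤ.+ x))) ⟩
  ℤ.- (ℤ.- sgℤ (pos 2 ℤ.* pos n ℤ.+ x))
    ≡⟨ ≡.trans (ℤₚ.neg-involutive _) (sgℤ-even⁺ n x) ⟩
  sgℤ x ∎
  where
  open ≡.≡-Reasoning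
  lemma : ∀ n x → pos 2 ℤ.* (ℤ.1ℤ ℤ.+ n) ℤ.+ x ≡ ℤ.1ℤ ℤ.+ (ℤ.1ℤ ℤ.+ (pos 2 ℤ.* n ℤ.+ x))
  lemma = solve-∀

sgℤ-even : ∀ m x → sgℤ (pos 2 ℤ.* m ℤ.+ x) ≡ sgℤ x
sgℤ-even (pos n) x = sgℤ-even⁺ n x
sgℤ-even (neg n) x = ≡.trans (≡.sym (sgℤ-even⁺ (suc n) (pos 2 ℤ.* neg n ℤ.+ x)))
  (cong sgℤ (lemma (pos n) x))
  where
  lemma : ∀ n x → pos 2 ℤ.* (ℤ.1ℤ ℤ.+ n) ℤ.+ (pos 2 ℤ.* (ℤ.- (ℤ.1ℤ ℤ.+ n)) ℤ.+ x) ≡ x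
  lemma = solve-∀

-- The index pairs (M, r) of u^M Q^{rM} in the bilateral Lambert series: 1/(1 - u Q^r) is expanded
-- in nonnegative powers of u for r ≥ 0 and in negative powers for r < 0.
data Valid : ℤ → ℤ → Set where
  pos-pos : ∀ m s → Valid (pos m) (pos s)
  neg-neg : ∀ m s → Valid (neg m) (neg s)

-- The sum over the half line of r that M selects. At r = -1 - s the sign (-1)^s is -(-1)^r, since
-- the expansion in negative powers of u contributes a further minus.
half : ℕ → ℤ → (ℤ → ℤ) → ℤ
half B (pos _) g = Σ< B (λ s → sgn s ℤ.* g (pos s))
half B (neg _) g = Σ< B (λ s → sgn s ℤ.* g (neg s))

half-cong : ∀ B M {g h} → (∀ r → Valid M r → g r ≡ h r) → half B M g ≡ half B M h
half-cong B (pos m) p = Σ<-cong B (λ s _ → cong (sgn s ℤ.*_) (p (pos s) (pos-pos m s)))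
half-cong B (neg m) p = Σ<-cong B (λ s _ → cong (sgn s ℤ.*_) (p (neg s) (neg-neg m s)))

half-Σℤ : ∀ B M A (f : ℤ → ℤ → ℤ) → half B M (λ r → Σℤ A (λ x → f x r)) ≡ Σℤ A (λ x → half B M (f x))
half-Σℤ B (pos m) A f = ≡.trans
  (Σ<-cong B (λ s _ → ≡.sym (Σℤ-* A (sgn s) (λ x → f x (pos s)))))
  (Σ<-Σℤ-swap B A (λ s x → sgn s ℤ.* f x (pos s)))
half-Σℤ B (neg m) A f = ≡.trans
  (Σ<-cong B (λ s _ → ≡.sym (Σℤ-* A (sgn s) (λ x → f x (neg s)))))
  (Σ<-Σℤ-swap B A (λ s x → sgn s ℤ.* f x (neg s)))

half-witness : ∀ B M {g} → half B M g ≢ ℤ.0ℤ → Σ ℤ λ r → Valid M r × g r ≢ ℤ.0ℤ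
half-witness B (pos m) nz with Σ<-witness B nz
... | s , _ , p = pos s , pos-pos m s , λ e → p (≡.trans (cong (sgn s ℤ.*_) e) (ℤₚ.*-zeroʳ (sgn s)))
half-witness B (neg m) nz with Σ<-witness B nz
... | s , _ , p = neg s , neg-neg m s , λ e → p (≡.trans (cong (sgn s ℤ.*_) e) (ℤₚ.*-zeroʳ (sgn s)))

self-neg⇒0 : ∀ x → x ≡ ℤ.- x → x ≡ ℤ.0ℤ
self-neg⇒0 (pos zero) _ = ≡.refl

-- The involution r ↦ -1 - 2m - r reverses the sign (-1)^r.
half-independent : ∀ B m {g} → (∀ r → g r ≢ ℤ.0ℤ → ℤ.∣ r ∣ < B) →
  (∀ r → g (ℤ.-1ℤ ℤ.- (pos 2 ℤ.* m ℤ.+ r)) ≡ g r) → ∀ M M′ → half B M g ≡ half B M′ g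
half-independent B m {g} supp sym-g = cases
  where
  open ≡.≡-Reasoning
  f : ℤ → ℤ
  f r = sgℤ r ℤ.* g r
  ι : ℤ → ℤ
  ι r = ℤ.-1ℤ ℤ.- (pos 2 ℤ.* m ℤ.+ r)
  ι-involutive : ∀ r → ι (ι r) ≡ r
  ι-involutive r = lemma m r
    where
    lemma : ∀ m r → ℤ.-1ℤ ℤ.- (pos 2 ℤ.* m ℤ.+ (ℤ.-1ℤ ℤ.- (pos 2 ℤ.* m ℤ.+ r))) ≡ r
    lemma = solve-∀
  f-nonzero : ∀ r → f r ≢ ℤ.0ℤ → g r ≢ ℤ.0ℤ
  f-nonzero r nz e = nz (≡.trans (cong (sgℤ r ℤ.*_) e) (ℤₚ.*-zeroʳ (sgℤ r)))
  f-ι : ∀ r → f (ι r) ≡ ℤ.- f r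
  f-ι r = ≡.trans (cong₂ ℤ._*_ (≡.trans (sgℤ-reflect (pos 2 ℤ.* m ℤ.+ r)) (cong ℤ.-_ (sgℤ-even m r))) (sym-g r))
                  (≡.sym (ℤₚ.neg-distribˡ-* (sgℤ r) (g r)))
  total : Σℤ B f ≡ ℤ.0ℤ
  total = self-neg⇒0 _ (begin
    Σℤ B f
      ≡⟨ reindex B f ι (λ r nz → supp r (f-nonzero r nz))
           (λ r nz → ι r , ι-involutive r , supp (ι r) (λ e → f-nonzero r nz (≡.trans (≡.sym (sym-g r)) e)))
           (λ k l e → ≡.trans (≡.sym (ι-involutive k)) (≡.trans (cong ι e) (ι-involutive l))) ⟩
    Σℤ B (λ r → f (ι r))
      ≡⟨ Σℤ-cong B (λ r _ → ≡.trans (f-ι r) (≡.sym (ℤₚ.-1*i≡-i (f r)))) ⟩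
    Σℤ B (λ r → ℤ.-1ℤ ℤ.* f r)
      ≡⟨ ≡.trans (Σℤ-* B ℤ.-1ℤ f) (ℤₚ.-1*i≡-i (Σℤ B f)) ⟩
    ℤ.- Σℤ B f ∎)
  -- As the negative half carries the sign -(-1)^r, the difference of the halves is the sum over all
  -- r, which the reflection has shown to be zero.
  pos≡neg : half B (pos 0) g ≡ half B (neg 0) g
  pos≡neg = ℤₚ.i-j≡0⇒i≡j _ _ (begin
    half B (pos 0) g ℤ.- half B (neg 0) g
      ≡⟨ cong (λ z → half B (pos 0) g ℤ.+ z) (≡.trans (≡.sym (ℤₚ.-1*i≡-i (half B (neg 0) g)))
           (≡.sym (Σ<-* B ℤ.-1ℤ (λ s → sgn s ℤ.* g (neg s))))) ⟩
    half B (pos 0) g ℤ.+ Σ< B (λ s → ℤ.-1ℤ ℤ.* (sgn s ℤ.* g (neg s)))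
      ≡⟨ ≡.sym (Σ<-+ B (λ s → sgn s ℤ.* g (pos s)) (λ s → ℤ.-1ℤ ℤ.* (sgn s ℤ.* g (neg s)))) ⟩
    Σ< B (λ s → sgn s ℤ.* g (pos s) ℤ.+ ℤ.-1ℤ ℤ.* (sgn s ℤ.* g (neg s)))
      ≡⟨ Σ<-cong B (λ s _ → cong (λ z → sgn s ℤ.* g (pos s) ℤ.+ z)
           (≡.trans (ℤₚ.-1*i≡-i _) (ℤₚ.neg-distribˡ-* (sgn s) (g (neg s))))) ⟩
    Σℤ B f
      ≡⟨ total ⟩
    ℤ.0ℤ ∎)
  cases : ∀ M M′ → half B M g ≡ half B M′ g
  cases (pos _) (pos _) = ≡.refl
  cases (pos _) (neg _) = pos≡neg
  cases (neg _) (pos _) = ≡.sym pos≡neg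
  cases (neg _) (neg _) = ≡.refl

-- the coefficient of q^n in q^e, which is 0 for e < 0
δ : ℤ → ℕ → ℤ
δ e n with e ℤ.≟ pos n
... | yes _ = ℤ.1ℤ
... | no  _ = ℤ.0ℤ

δ-support : ∀ e n → δ e n ≢ ℤ.0ℤ → e ≡ pos n
δ-support e n nz with e ℤ.≟ pos n
... | yes p = p
... | no  _ = contradiction ≡.refl nz

δ-≡ : ∀ {e e′ n n′} → (e ≡ pos n → e′ ≡ pos n′) → (e′ ≡ pos n′ → e ≡ pos n) → δ e n ≡ δ e′ n′
δ-≡ {e} {e′} {n} {n′} f g with e ℤ.≟ pos n | e′ ℤ.≟ pos n′
... | yes _ | yes _ = ≡.refl
... | no  _ | no  _ = ≡.refl
... | yes p | no ¬p = contradiction (f p) ¬p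
... | no ¬p | yes p = contradiction (g p) ¬p

pos-sum⇒≤ : ∀ {x n} a b → x ≡ pos n → x ≡ pos a ℤ.+ pos b → a ≤ n
pos-sum⇒≤ a b p e = ℕₚ.≤-trans (ℕₚ.m≤m+n a b) (ℕₚ.≤-reflexive (ℤₚ.+-injective (≡.trans (≡.sym e) p)))

-- Parities and the lattice sum modulo 4

Parity : ℤ → Set
Parity r = Σ ℤ λ t → (r ≡ pos 2 ℤ.* t ⊎ r ≡ pos 2 ℤ.* t ℤ.+ ℤ.1ℤ) × ℤ.∣ t ∣ ≤ ℤ.∣ r ∣

parityℕ : ∀ n → Σ ℕ λ t → (n ≡ t + t ⊎ n ≡ suc (t + t))
parityℕ zero = 0 , inj₁ ≡.refl
parityℕ (suc n) with parityℕ n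
... | t , inj₁ p = t , inj₂ (cong suc p)
... | t , inj₂ p = suc t , inj₁ (≡.trans (cong suc p) (cong suc (≡.sym (ℕₚ.+-suc t t))))

parity : ∀ r → Parity r
parity (pos n) with parityℕ n
... | t , inj₁ ≡.refl = pos t , inj₁ (lemma (pos t)) , ℕₚ.m≤m+n t t
  where
  lemma : ∀ t → t ℤ.+ t ≡ pos 2 ℤ.* t
  lemma = solve-∀
... | t , inj₂ ≡.refl = pos t , inj₂ (lemma (pos t)) , ℕₚ.≤-trans (ℕₚ.m≤m+n t t) (ℕₚ.n≤1+n (t + t))
  where
  lemma : ∀ t → ℤ.1ℤ ℤ.+ (t ℤ.+ t) ≡ pos 2 ℤ.* t ℤ.+ ℤ.1ℤ
  lemma = solve-∀
parity (neg n) with parityℕ n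
... | t , inj₁ ≡.refl = neg t , inj₂ (lemma (pos t)) , s≤s (ℕₚ.m≤m+n t t)
  where
  lemma : ∀ t → ℤ.- (ℤ.1ℤ ℤ.+ (t ℤ.+ t)) ≡ pos 2 ℤ.* (ℤ.- (ℤ.1ℤ ℤ.+ t)) ℤ.+ ℤ.1ℤ
  lemma = solve-∀
... | t , inj₂ ≡.refl = neg t , inj₁ (lemma (pos t)) , s≤s (ℕₚ.≤-trans (ℕₚ.m≤m+n t t) (ℕₚ.n≤1+n (t + t)))
  where
  lemma : ∀ t → ℤ.- (ℤ.1ℤ ℤ.+ (ℤ.1ℤ ℤ.+ (t ℤ.+ t))) ≡ pos 2 ℤ.* (ℤ.- (ℤ.1ℤ ℤ.+ t))
  lemma = solve-∀

-- The exponent of the general monomial of ψ(q⁶) Σ `K₃`: the index x belongs to ψ(q⁶), the pair (M,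
-- r) to the Lambert series.
E₁ : ℤ → ℤ → ℤ → ℤ
E₁ x M r = (pos 12 ℤ.* (x ℤ.* x ℤ.- x) ℤ.+ pos 6 ℤ.* x)
           ℤ.+ (pos 9 ℤ.* (r ℤ.* r ℤ.+ r) ℤ.+ pos 6 ℤ.* (r ℤ.* M) ℤ.+ M)

-- The exponent of the general monomial of the reciprocal theta function. Being 3r(r + 2m + 1) + m,
-- it is fixed by r ↦ -1 - 2m - r.
e₃ : ℤ → ℤ → ℤ
e₃ m r = pos 3 ℤ.* (r ℤ.* r ℤ.+ r) ℤ.+ pos 6 ℤ.* (r ℤ.* m) ℤ.+ m

-- If m and r lie on the same side of zero, the exponent is a sum of natural numbers and |r| ≤ n is
-- immediate. Otherwise 6rm is negative, and r² outweighs it only once |r| exceeds about 2|m|; this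
-- is the reason for the two copies of B.
e₃-bound : ∀ B B′ n c m r → n + B + B + 2 ≤ B′ → ℤ.∣ m ∣ ≤ B →
           pos c ℤ.+ e₃ m r ≡ pos n → ℤ.∣ r ∣ < B′
e₃-bound B B′ n c m r large m≤B eq = bound m r m≤B eq
  where
  n<B′ : n < B′
  n<B′ = ℕₚ.≤-trans (ℕₚ.≤-reflexive (ℕₚ.+-comm 1 n)) (ℕₚ.≤-trans
    (ℕₚ.+-mono-≤ (ℕₚ.≤-trans (ℕₚ.m≤m+n n B) (ℕₚ.m≤m+n (n + B) B)) (s≤s (z≤n {1}))) large)
  n+B<B′ : n + B < B′
  n+B<B′ = ℕₚ.≤-trans (ℕₚ.≤-reflexive (ℕₚ.+-comm 1 (n + B))) (ℕₚ.≤-trans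
    (ℕₚ.+-mono-≤ (ℕₚ.m≤m+n (n + B) B) (s≤s (z≤n {1}))) large)
  2B+2≤B′ : B + B + 2 ≤ B′
  2B+2≤B′ = ℕₚ.≤-trans (ℕₚ.+-monoˡ-≤ 2 (ℕₚ.+-monoˡ-≤ B (ℕₚ.m≤n+m B n))) large
  bound : ∀ m r → ℤ.∣ m ∣ ≤ B → pos c ℤ.+ e₃ m r ≡ pos n → ℤ.∣ r ∣ < B′
  bound (pos j) (pos s) _ eq = ℕₚ.≤-<-trans
    (pos-sum⇒≤ s _ eq (≡.trans
      (cong₂ (λ p t → pos c ℤ.+ (pos 3 ℤ.* (p ℤ.+ pos s) ℤ.+ pos 6 ℤ.* t ℤ.+ pos j))
        (≡.sym (ℤₚ.pos-* s s)) (≡.sym (ℤₚ.pos-* s j)))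
      (lemma (pos c) (pos s) (pos j) (pos (s * s)) (pos (s * j))))) n<B′
    where
    lemma : ∀ c s j p t → c ℤ.+ (pos 3 ℤ.* (p ℤ.+ s) ℤ.+ pos 6 ℤ.* t ℤ.+ j)
              ≡ s ℤ.+ (c ℤ.+ (p ℤ.+ p ℤ.+ p ℤ.+ s ℤ.+ s ℤ.+ (t ℤ.+ t ℤ.+ t ℤ.+ t ℤ.+ t ℤ.+ t) ℤ.+ j))
    lemma = solve-∀
  bound (neg j) (pos s) j<B eq with s ℕ.<? B′
  ... | yes s<B′ = s<B′
  ... | no  s≮B′ = contradiction (ℕₚ.≤-<-trans s≤n+J (ℕₚ.≤-<-trans (ℕₚ.+-monoʳ-≤ n j<B) n+B<B′)) s≮B′
    where
    J = suc j
    J+J≤s : J + J ≤ s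
    J+J≤s = ℕₚ.≤-trans (ℕₚ.+-mono-≤ j<B j<B) (ℕₚ.≤-trans (ℕₚ.m≤m+n (B + B) 2)
              (ℕₚ.≤-trans 2B+2≤B′ (ℕₚ.≮⇒≥ s≮B′)))
    d = s ∸ (J + J)
    -- Here m = -J, and s = 2J + d turns the indefinite part 3s² - 6sJ into 3sd.
    split : ∀ d s → J + J + d ≡ s → pos c ℤ.+ e₃ (neg j) (pos s) ≡ pos n → s ≤ n + J
    split d s ≡.refl eq = pos-sum⇒≤ (J + J + d) _ (cong (ℤ._+ pos J) eq)
      (≡.trans (lemma (pos c) (pos J) (pos d))
        (cong (λ p → pos (J + J + d) ℤ.+ (pos c ℤ.+ (p ℤ.+ p ℤ.+ p ℤ.+ pos (J + J + d) ℤ.+ pos (J + J + d))))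
          (≡.sym (ℤₚ.pos-* (J + J + d) d))))
      where
      lemma : ∀ c J d → c ℤ.+ (pos 3 ℤ.* ((J ℤ.+ J ℤ.+ d) ℤ.* (J ℤ.+ J ℤ.+ d) ℤ.+ (J ℤ.+ J ℤ.+ d))
                          ℤ.+ pos 6 ℤ.* ((J ℤ.+ J ℤ.+ d) ℤ.* (ℤ.- J)) ℤ.+ ℤ.- J) ℤ.+ J
                ≡ (J ℤ.+ J ℤ.+ d) ℤ.+ (c ℤ.+ ((J ℤ.+ J ℤ.+ d) ℤ.* d ℤ.+ (J ℤ.+ J ℤ.+ d) ℤ.* d
                    ℤ.+ (J ℤ.+ J ℤ.+ d) ℤ.* d ℤ.+ (J ℤ.+ J ℤ.+ d) ℤ.+ (J ℤ.+ J ℤ.+ d)))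
      lemma = solve-∀
    s≤n+J : s ≤ n + J
    s≤n+J = split d s (ℕₚ.m+[n∸m]≡n J+J≤s) eq
  bound (pos j) (neg s) j≤B eq with suc s ℕ.<? B′
  ... | yes s<B′ = s<B′
  ... | no  s≮B′ = contradiction (ℕₚ.≤-<-trans R≤n n<B′) s≮B′
    where
    j+j+2≤R : j + j + 2 ≤ suc s
    j+j+2≤R = ℕₚ.≤-trans (ℕₚ.+-monoˡ-≤ 2 (ℕₚ.+-mono-≤ j≤B j≤B)) (ℕₚ.≤-trans 2B+2≤B′ (ℕₚ.≮⇒≥ s≮B′))
    -- For r = -R with R = 2j + 2 + d the part 3(r² + r) + 6rj equals 3R(d + 1), which is at least
    -- R.
    split : ∀ d R → j + j + 2 + d ≡ R → pos c ℤ.+ e₃ (pos j) (ℤ.- pos R) ≡ pos n → R ≤ n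
    split d R ≡.refl eq = pos-sum⇒≤ (j + j + 2 + d) _ eq
      (≡.trans (lemma (pos c) (pos j) (pos d))
        (cong (λ p → pos (j + j + 2 + d) ℤ.+ (pos c ℤ.+ (pos j ℤ.+ (p ℤ.+ p ℤ.+ p
                 ℤ.+ pos (j + j + 2 + d) ℤ.+ pos (j + j + 2 + d)))))
          (≡.sym (ℤₚ.pos-* (j + j + 2 + d) d))))
      where
      lemma : ∀ c j d → c ℤ.+ (pos 3 ℤ.* ((ℤ.- (j ℤ.+ j ℤ.+ pos 2 ℤ.+ d)) ℤ.* (ℤ.- (j ℤ.+ j ℤ.+ pos 2 ℤ.+ d)) ℤ.+ (ℤ.- (j ℤ.+ j ℤ.+ pos 2 ℤ.+ d)))
                          ℤ.+ pos 6 ℤ.* ((ℤ.- (j ℤ.+ j ℤ.+ pos 2 ℤ.+ d)) ℤ.* j) ℤ.+ j)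
                ≡ (j ℤ.+ j ℤ.+ pos 2 ℤ.+ d) ℤ.+ (c ℤ.+ (j ℤ.+ ((j ℤ.+ j ℤ.+ pos 2 ℤ.+ d) ℤ.* d ℤ.+ (j ℤ.+ j ℤ.+ pos 2 ℤ.+ d) ℤ.* d
                    ℤ.+ (j ℤ.+ j ℤ.+ pos 2 ℤ.+ d) ℤ.* d ℤ.+ (j ℤ.+ j ℤ.+ pos 2 ℤ.+ d) ℤ.+ (j ℤ.+ j ℤ.+ pos 2 ℤ.+ d))))
      lemma = solve-∀
    R≤n : suc s ≤ n
    R≤n = split (suc s ∸ (j + j + 2)) (suc s) (ℕₚ.m+[n∸m]≡n j+j+2≤R) eq
  bound (neg j) (neg s) _ eq = ℕₚ.≤-<-trans
    (pos-sum⇒≤ (suc s) _ eq (≡.trans (lemma (pos c) (pos j) (pos s))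
      (cong₂ (λ p t → pos (suc s) ℤ.+ (pos c ℤ.+ (p ℤ.+ p ℤ.+ p
                ℤ.+ (pos (suc s) ℤ.+ pos (suc s) ℤ.+ pos (suc s) ℤ.+ pos (suc s))
                ℤ.+ (t ℤ.+ t ℤ.+ t ℤ.+ t ℤ.+ t ℤ.+ t ℤ.+ pos s ℤ.+ (pos j ℤ.+ pos j ℤ.+ pos j ℤ.+ pos j ℤ.+ pos j)))))
        (≡.sym (ℤₚ.pos-* (suc s) s)) (≡.sym (ℤₚ.pos-* s j))))) n<B′
    where
    lemma : ∀ c j s → c ℤ.+ (pos 3 ℤ.* ((ℤ.- (ℤ.1ℤ ℤ.+ s)) ℤ.* (ℤ.- (ℤ.1ℤ ℤ.+ s)) ℤ.+ (ℤ.- (ℤ.1ℤ ℤ.+ s)))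
                        ℤ.+ pos 6 ℤ.* ((ℤ.- (ℤ.1ℤ ℤ.+ s)) ℤ.* (ℤ.- (ℤ.1ℤ ℤ.+ j))) ℤ.+ (ℤ.- (ℤ.1ℤ ℤ.+ j)))
              ≡ (ℤ.1ℤ ℤ.+ s) ℤ.+ (c ℤ.+ ((ℤ.1ℤ ℤ.+ s) ℤ.* s ℤ.+ (ℤ.1ℤ ℤ.+ s) ℤ.* s ℤ.+ (ℤ.1ℤ ℤ.+ s) ℤ.* s
                  ℤ.+ ((ℤ.1ℤ ℤ.+ s) ℤ.+ (ℤ.1ℤ ℤ.+ s) ℤ.+ (ℤ.1ℤ ℤ.+ s) ℤ.+ (ℤ.1ℤ ℤ.+ s))
                  ℤ.+ (s ℤ.* j ℤ.+ s ℤ.* j ℤ.+ s ℤ.* j ℤ.+ s ℤ.* j ℤ.+ s ℤ.* j ℤ.+ s ℤ.* j ℤ.+ s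
                       ℤ.+ (j ℤ.+ j ℤ.+ j ℤ.+ j ℤ.+ j))))
    lemma = solve-∀

-- The reindexing of the lattice sum, for an arbitrary change of variables
-- x = π r k, M = ι k m which turns E₁ into 4 (ε k + e₃ m r) + c.
lattice-section :
  ∀ (n c : ℕ) (π ι : ℤ → ℤ → ℤ) (ε : ℤ → ℕ) → let N = 4 * n + c in
  (∀ x M r → Valid M r → E₁ x M r ≡ pos N → ℤ.∣ x ∣ ≤ N × ℤ.∣ M ∣ ≤ N × ℤ.∣ r ∣ ≤ N) →
  (∀ r x → Σ ℤ λ k → π r k ≡ x × ℤ.∣ k ∣ ≤ ℤ.∣ x ∣ + ℤ.∣ r ∣ + 1) →
  (∀ r k l → π r k ≡ π r l → k ≡ l) →
  (∀ k M r → E₁ (π r k) M r ≡ pos N → Σ ℤ λ m → ι k m ≡ M) →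
  (∀ k m → 4 * ℤ.∣ m ∣ ≤ ℤ.∣ ι k m ∣ + 2 * ℤ.∣ k ∣ + 1) →
  (∀ k m l → ι k m ≡ ι k l → m ≡ l) →
  (∀ k m r → E₁ (π r k) (ι k m) r ≡ pos 4 ℤ.* (pos (ε k) ℤ.+ e₃ m r) ℤ.+ pos c) →
  ∀ B B′ → 2 * N + 2 ≤ B → n + B + B + 2 ≤ B′ →
  Σℤ B (λ x → Σℤ B (λ M → half B′ M (λ r → δ (E₁ x M r) N)))
    ≡ Σℤ B (λ k → Σℤ B (λ m → half B′ m (λ r → δ (pos (ε k) ℤ.+ e₃ m r) n)))
lattice-section n c π ι ε bound π-onto π-inj ι-onto ι-bound ι-inj exponent B B′ N≪B B≪B′ = begin
  Σℤ B (λ x → Σℤ B (λ M → half B′ M (λ r → δ (E₁ x M r) N)))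
    ≡⟨ Σℤ-swap B B (λ x M → half B′ M (λ r → δ (E₁ x M r) N)) ⟩
  Σℤ B (λ M → Σℤ B (λ x → half B′ M (λ r → δ (E₁ x M r) N)))
    ≡⟨ Σℤ-cong B (λ M _ → ≡.sym (half-Σℤ B′ M B (λ x r → δ (E₁ x M r) N))) ⟩
  Σℤ B (λ M → half B′ M (λ r → Σℤ B (λ x → δ (E₁ x M r) N)))
    -- The substitution for x depends on r, so the sum over x has to be the innermost one here.
    ≡⟨ Σℤ-cong B (λ M _ → half-cong B′ M (λ r v → reindex-x M r v)) ⟩
  Σℤ B (λ M → half B′ M (λ r → Σℤ B (λ k → δ (E₁ (π r k) M r) N)))
    ≡⟨ Σℤ-cong B (λ M _ → half-Σℤ B′ M B (λ k r → δ (E₁ (π r k) M r) N)) ⟩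
  Σℤ B (λ M → Σℤ B (λ k → half B′ M (λ r → δ (E₁ (π r k) M r) N)))
    ≡⟨ Σℤ-swap B B (λ M k → half B′ M (λ r → δ (E₁ (π r k) M r) N)) ⟩
  Σℤ B (λ k → Σℤ B (λ M → half B′ M (λ r → δ (E₁ (π r k) M r) N)))
    ≡⟨ Σℤ-cong B (λ k k≤B → reindex-M k k≤B) ⟩
  Σℤ B (λ k → Σℤ B (λ m → half B′ (ι k m) (λ r → δ (E₁ (π r k) (ι k m) r) N)))
    -- The exponents agree already; what changes is the half line of r, from the side of M to the
    -- side of m.
    ≡⟨ Σℤ-cong B (λ k _ → Σℤ-cong B (λ m m≤B → other-half k m m≤B)) ⟩
  Σℤ B (λ k → Σℤ B (λ m → half B′ m (λ r → δ (pos (ε k) ℤ.+ e₃ m r) n))) ∎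
  where
  open ≡.≡-Reasoning
  N = 4 * n + c
  N<B : N < B
  N<B = ℕₚ.≤-trans (ℕₚ.≤-trans (ℕₚ.≤-reflexive (ℕₚ.+-comm 1 N))
          (ℕₚ.+-mono-≤ (ℕₚ.m≤m+n N (N + 0)) (s≤s (z≤n {1})))) N≪B
  reindex-x : ∀ M r → Valid M r → Σℤ B (λ x → δ (E₁ x M r) N) ≡ Σℤ B (λ k → δ (E₁ (π r k) M r) N)
  reindex-x M r v = reindex B (λ x → δ (E₁ x M r) N) (π r)
    (λ x nz → ℕₚ.≤-<-trans (proj₁ (bound x M r v (δ-support _ N nz))) N<B)
    (λ x nz → onto x (bound x M r v (δ-support _ N nz)) (π-onto r x))
    (π-inj r)
    where
    onto : ∀ x → ℤ.∣ x ∣ ≤ N × ℤ.∣ M ∣ ≤ N × ℤ.∣ r ∣ ≤ N →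
           (Σ ℤ λ k → π r k ≡ x × ℤ.∣ k ∣ ≤ ℤ.∣ x ∣ + ℤ.∣ r ∣ + 1) → Σ ℤ λ k → π r k ≡ x × ℤ.∣ k ∣ < B
    -- |k| ≤ |x| + |r| + 1 ≤ 2N + 1, which explains the size 2N + 2 of the box.
    onto x (x≤N , _ , r≤N) (k , e , l) = k , e , ℕₚ.≤-trans (s≤s l) (ℕₚ.≤-trans
      (s≤s (ℕₚ.+-monoˡ-≤ 1 (ℕₚ.+-mono-≤ x≤N r≤N)))
      (ℕₚ.≤-trans (ℕₚ.≤-reflexive (arith N)) N≪B))
      where
      arith : ∀ N → suc (N + N + 1) ≡ 2 * N + 2
      arith = ℕ-Solver.solve-∀
  witness : ∀ k M → half B′ M (λ r → δ (E₁ (π r k) M r) N) ≢ ℤ.0ℤ →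
            Σ ℤ λ r → Valid M r × E₁ (π r k) M r ≡ pos N
  witness k M nz with half-witness B′ M nz
  ... | r , v , p = r , v , δ-support _ N p
  reindex-M : ∀ k → ℤ.∣ k ∣ ≤ B → Σℤ B (λ M → half B′ M (λ r → δ (E₁ (π r k) M r) N))
                ≡ Σℤ B (λ m → half B′ (ι k m) (λ r → δ (E₁ (π r k) (ι k m) r) N))
  reindex-M k k≤B = reindex B (λ M → half B′ M (λ r → δ (E₁ (π r k) M r) N)) (ι k)
    (λ M nz → ℕₚ.≤-<-trans (M≤N M (witness k M nz)) N<B)
    (λ M nz → onto M (witness k M nz))
    (ι-inj k)
    where
    M≤N : ∀ M → (Σ ℤ λ r → Valid M r × E₁ (π r k) M r ≡ pos N) → ℤ.∣ M ∣ ≤ N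
    M≤N M (r , v , p) = proj₁ (proj₂ (bound (π r k) M r v p))
    onto : ∀ M → (Σ ℤ λ r → Valid M r × E₁ (π r k) M r ≡ pos N) → Σ ℤ λ m → ι k m ≡ M × ℤ.∣ m ∣ < B
    onto M w@(r , v , p) with ι-onto k M r p
    -- 4|m| ≤ N + 2B + 1 < 4B, because N + 2 ≤ 2B.
    ... | m , ≡.refl = m , ≡.refl , ℕₚ.*-cancelˡ-< 4 ℤ.∣ m ∣ B (ℕₚ.≤-trans (s≤s (ι-bound k m))
      (ℕₚ.≤-trans (s≤s (ℕₚ.+-monoˡ-≤ 1 (ℕₚ.+-mono-≤ (M≤N M w) (ℕₚ.*-monoʳ-≤ 2 k≤B))))
      (ℕₚ.≤-trans (ℕₚ.≤-reflexive (arith₁ N B)) (ℕₚ.≤-trans (ℕₚ.+-monoˡ-≤ (2 * B) N+2≤2B)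
        (ℕₚ.≤-reflexive (arith₂ B))))))
      where
      N+2≤2B : N + 2 ≤ 2 * B
      N+2≤2B = ℕₚ.≤-trans (ℕₚ.+-monoˡ-≤ 2 (ℕₚ.m≤m+n N (N + 0))) (ℕₚ.≤-trans N≪B (ℕₚ.m≤m+n B (B + 0)))
      arith₁ : ∀ N B → suc (N + 2 * B + 1) ≡ N + 2 + 2 * B
      arith₁ = ℕ-Solver.solve-∀
      arith₂ : ∀ B → 2 * B + 2 * B ≡ 4 * B
      arith₂ = ℕ-Solver.solve-∀
  other-half : ∀ k m → ℤ.∣ m ∣ ≤ B → half B′ (ι k m) (λ r → δ (E₁ (π r k) (ι k m) r) N)
                 ≡ half B′ m (λ r → δ (pos (ε k) ℤ.+ e₃ m r) n)
  other-half k m m≤B = ≡.trans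
    (half-cong B′ (ι k m) (λ r _ → δ-≡
      (λ p → ℤₚ.*-cancelˡ-≡ (pos 4) _ _ (ℤ-+-cancelʳ (pos c) _ _
        (≡.trans (≡.sym (exponent k m r)) (≡.trans p (cong (ℤ._+ pos c) (ℤₚ.pos-* 4 n))))))
      (λ p → ≡.trans (exponent k m r)
        (≡.trans (cong (λ z → pos 4 ℤ.* z ℤ.+ pos c) p) (cong (ℤ._+ pos c) (≡.sym (ℤₚ.pos-* 4 n)))))))
    (half-independent B′ m
      (λ r nz → e₃-bound B B′ n (ε k) m r B≪B′ m≤B (δ-support _ n nz))
      (λ r → cong (λ e → δ (pos (ε k) ℤ.+ e) n) (reflection m r))
      (ι k m) m)
    where
    reflection : ∀ m r → e₃ m (ℤ.-1ℤ ℤ.- (pos 2 ℤ.* m ℤ.+ r)) ≡ e₃ m r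
    reflection m r = lemma m r
      where
      lemma : ∀ m r → pos 3 ℤ.* ((ℤ.-1ℤ ℤ.- (pos 2 ℤ.* m ℤ.+ r)) ℤ.* (ℤ.-1ℤ ℤ.- (pos 2 ℤ.* m ℤ.+ r)) ℤ.+ (ℤ.-1ℤ ℤ.- (pos 2 ℤ.* m ℤ.+ r)))
                ℤ.+ pos 6 ℤ.* ((ℤ.-1ℤ ℤ.- (pos 2 ℤ.* m ℤ.+ r)) ℤ.* m) ℤ.+ m
                ≡ pos 3 ℤ.* (r ℤ.* r ℤ.+ r) ℤ.+ pos 6 ℤ.* (r ℤ.* m) ℤ.+ m
      lemma = solve-∀

-- Exponents of theta and Lambert series as polynomials

tri-poly : ∀ k → pos (tri k) ℤ.+ pos (tri k) ≡ pos k ℤ.* pos k ℤ.- pos k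
tri-poly zero    = ≡.refl
tri-poly (suc k) = ≡.trans (lemma₁ (pos (tri k)) (pos k))
  (≡.trans (cong (ℤ._+ (pos k ℤ.+ pos k)) (tri-poly k)) (lemma₂ (pos k)))
  where
  lemma₁ : ∀ t k → (t ℤ.+ k) ℤ.+ (t ℤ.+ k) ≡ (t ℤ.+ t) ℤ.+ (k ℤ.+ k)
  lemma₁ = solve-∀
  lemma₂ : ∀ k → k ℤ.* k ℤ.- k ℤ.+ (k ℤ.+ k) ≡ (ℤ.1ℤ ℤ.+ k) ℤ.* (ℤ.1ℤ ℤ.+ k) ℤ.- (ℤ.1ℤ ℤ.+ k)
  lemma₂ = solve-∀

T≡tri : ∀ s → T s ≡ tri (suc s)
T≡tri zero    = ≡.refl
T≡tri (suc s) = cong (_+ suc s) (T≡tri s)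

-- the exponents of the theta series Θ(q^α, q^β)
ε : ℕ → ℕ → ℤ → ℕ
ε α β (pos k) = tri k * (α + β) + k * α
ε α β (neg k) = tri (suc k) * (α + β) + suc k * β

ε-poly : ∀ α β h → α + β ≡ h + h → ∀ x →
         pos (ε α β x) ≡ pos h ℤ.* (x ℤ.* x ℤ.- x) ℤ.+ pos α ℤ.* x
ε-poly α β h e (pos k) = begin
  pos (tri k * (α + β)) ℤ.+ pos (k * α)
    ≡⟨ cong₂ ℤ._+_ (≡.trans (cong (λ z → pos (tri k * z)) e) (ℤₚ.pos-* (tri k) (h + h))) (ℤₚ.pos-* k α) ⟩
  pos (tri k) ℤ.* (pos h ℤ.+ pos h) ℤ.+ pos k ℤ.* pos α
    ≡⟨ lemma (pos (tri k)) (pos h) (pos k) (pos α) ⟩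
  pos h ℤ.* (pos (tri k) ℤ.+ pos (tri k)) ℤ.+ pos α ℤ.* pos k
    ≡⟨ cong (λ z → pos h ℤ.* z ℤ.+ pos α ℤ.* pos k) (tri-poly k) ⟩
  pos h ℤ.* (pos k ℤ.* pos k ℤ.- pos k) ℤ.+ pos α ℤ.* pos k ∎
  where
  open ≡.≡-Reasoning
  lemma : ∀ t h k a → t ℤ.* (h ℤ.+ h) ℤ.+ k ℤ.* a ≡ h ℤ.* (t ℤ.+ t) ℤ.+ a ℤ.* k
  lemma = solve-∀
ε-poly α β h e (neg k) = begin
  pos (tri K * (α + β)) ℤ.+ pos (K * β)
    ≡⟨ cong₂ ℤ._+_ (≡.trans (cong (λ z → pos (tri K * z)) e) (ℤₚ.pos-* (tri K) (h + h))) (ℤₚ.pos-* K β) ⟩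
  pos (tri K) ℤ.* (pos h ℤ.+ pos h) ℤ.+ pos K ℤ.* pos β
    ≡⟨ lemma₁ (pos (tri K)) (pos h) (pos K) (pos α) (pos β) ⟩
  pos h ℤ.* (pos (tri K) ℤ.+ pos (tri K)) ℤ.+ (pos K ℤ.* (pos α ℤ.+ pos β) ℤ.- pos K ℤ.* pos α)
    ≡⟨ cong₂ (λ z w → pos h ℤ.* z ℤ.+ (pos K ℤ.* pos w ℤ.- pos K ℤ.* pos α)) (tri-poly K) e ⟩
  pos h ℤ.* (pos K ℤ.* pos K ℤ.- pos K) ℤ.+ (pos K ℤ.* (pos h ℤ.+ pos h) ℤ.- pos K ℤ.* pos α)
    ≡⟨ lemma₂ (pos h) (pos K) (pos α) ⟩
  pos h ℤ.* (neg k ℤ.* neg k ℤ.- neg k) ℤ.+ pos α ℤ.* neg k ∎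
  where
  open ≡.≡-Reasoning
  K = suc k
  lemma₁ : ∀ t h k a b → t ℤ.* (h ℤ.+ h) ℤ.+ k ℤ.* b ≡ h ℤ.* (t ℤ.+ t) ℤ.+ (k ℤ.* (a ℤ.+ b) ℤ.- k ℤ.* a)
  lemma₁ = solve-∀
  lemma₂ : ∀ h k a → h ℤ.* (k ℤ.* k ℤ.- k) ℤ.+ (k ℤ.* (h ℤ.+ h) ℤ.- k ℤ.* a)
             ≡ h ℤ.* ((ℤ.- k) ℤ.* (ℤ.- k) ℤ.- (ℤ.- k)) ℤ.+ a ℤ.* (ℤ.- k)
  lemma₂ = solve-∀

-- the exponents of the bilateral Lambert series with u = q and v = q^5
κ : (ℕ → ℕ) → ℤ → ℕ → ℕ
κ w (pos m) s = w s + m * (1 + s * 6)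
κ w (neg m) s = w s + suc m * (5 + s * 6)

w₁ w₃ : ℕ → ℕ
w₁ s = T s * 6
w₃ s = s * suc s * 6 + T s * 6

T-poly : ∀ s → pos (T s) ℤ.+ pos (T s) ≡ pos s ℤ.* pos s ℤ.+ pos s
T-poly s = ≡.trans (cong (λ t → pos t ℤ.+ pos t) (T≡tri s)) (≡.trans (tri-poly (suc s)) (lemma (pos s)))
  where
  lemma : ∀ s → (ℤ.1ℤ ℤ.+ s) ℤ.* (ℤ.1ℤ ℤ.+ s) ℤ.- (ℤ.1ℤ ℤ.+ s) ≡ s ℤ.* s ℤ.+ s
  lemma = solve-∀

w₁-poly : ∀ s → pos (w₁ s) ≡ pos 3 ℤ.* (pos s ℤ.* pos s ℤ.+ pos s)
w₁-poly s = ≡.trans (ℤₚ.pos-* (T s) 6) (≡.trans (lemma (pos (T s))) (cong (pos 3 ℤ.*_) (T-poly s)))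
  where
  lemma : ∀ t → t ℤ.* pos 6 ≡ pos 3 ℤ.* (t ℤ.+ t)
  lemma = solve-∀

w₃-poly : ∀ s → pos (w₃ s) ≡ pos 9 ℤ.* (pos s ℤ.* pos s ℤ.+ pos s)
w₃-poly s = ≡.trans
  (cong₂ ℤ._+_ (≡.trans (ℤₚ.pos-* (s * suc s) 6) (cong (ℤ._* pos 6) (ℤₚ.pos-* s (suc s)))) (w₁-poly s))
  (lemma (pos s))
  where
  lemma : ∀ s → s ℤ.* (ℤ.1ℤ ℤ.+ s) ℤ.* pos 6 ℤ.+ pos 3 ℤ.* (s ℤ.* s ℤ.+ s) ≡ pos 9 ℤ.* (s ℤ.* s ℤ.+ s)
  lemma = solve-∀

-- s for r = s and for r = -1 - s
index : ℤ → ℕ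
index (pos s) = s
index (neg s) = s

-- One polynomial serves both halves: for r = -1 - s one has r² + r = s² + s and 1 + 6r = -(5 + 6s),
-- and the last minus is compensated by the sign of M.
κ-poly : ∀ c w → (∀ s → pos (w s) ≡ pos c ℤ.* (pos s ℤ.* pos s ℤ.+ pos s)) → ∀ {M r} → Valid M r →
         pos (κ w M (index r)) ≡ pos c ℤ.* (r ℤ.* r ℤ.+ r) ℤ.+ pos 6 ℤ.* (r ℤ.* M) ℤ.+ M
κ-poly c w p (pos-pos m s) = ≡.trans
  (cong₂ ℤ._+_ (p s) (≡.trans (ℤₚ.pos-* m (1 + s * 6)) (cong (λ z → pos m ℤ.* (ℤ.1ℤ ℤ.+ z)) (ℤₚ.pos-* s 6))))
  (lemma (pos c) (pos m) (pos s))
  where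
  lemma : ∀ c m s → c ℤ.* (s ℤ.* s ℤ.+ s) ℤ.+ m ℤ.* (ℤ.1ℤ ℤ.+ s ℤ.* pos 6)
            ≡ c ℤ.* (s ℤ.* s ℤ.+ s) ℤ.+ pos 6 ℤ.* (s ℤ.* m) ℤ.+ m
  lemma = solve-∀
κ-poly c w p (neg-neg m s) = ≡.trans
  (cong₂ ℤ._+_ (p s) (≡.trans (ℤₚ.pos-* (suc m) (5 + s * 6)) (cong (λ z → pos (suc m) ℤ.* (pos 5 ℤ.+ z)) (ℤₚ.pos-* s 6))))
  (lemma (pos c) (pos m) (pos s))
  where
  lemma : ∀ c m s → c ℤ.* (s ℤ.* s ℤ.+ s) ℤ.+ (ℤ.1ℤ ℤ.+ m) ℤ.* (pos 5 ℤ.+ s ℤ.* pos 6)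
            ≡ c ℤ.* ((ℤ.- (ℤ.1ℤ ℤ.+ s)) ℤ.* (ℤ.- (ℤ.1ℤ ℤ.+ s)) ℤ.+ (ℤ.- (ℤ.1ℤ ℤ.+ s)))
              ℤ.+ pos 6 ℤ.* ((ℤ.- (ℤ.1ℤ ℤ.+ s)) ℤ.* (ℤ.- (ℤ.1ℤ ℤ.+ m))) ℤ.+ (ℤ.- (ℤ.1ℤ ℤ.+ m))
  lemma = solve-∀

E₁-natural : ∀ x {M r} → Valid M r → E₁ x M r ≡ pos (ε 6 18 x + κ w₃ M (index r))
E₁-natural x v = ≡.sym (cong₂ ℤ._+_ (ε-poly 6 18 12 ≡.refl x) (κ-poly 9 w₃ w₃-poly v))

-- The form is indefinite in (M, r), but on valid pairs it is a sum of natural numbers that dominate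
-- each variable.
E₁-bound : ∀ N x M r → Valid M r → E₁ x M r ≡ pos N → ℤ.∣ x ∣ ≤ N × ℤ.∣ M ∣ ≤ N × ℤ.∣ r ∣ ≤ N
E₁-bound N x M r v p = ℕₚ.≤-trans (ε-≥ x) (ℕₚ.≤-trans (ℕₚ.m≤m+n _ _) total)
                     , ℕₚ.≤-trans (κ-≥M v) (ℕₚ.≤-trans (ℕₚ.m≤n+m _ (ε 6 18 x)) total)
                     , ℕₚ.≤-trans (κ-≥r v) (ℕₚ.≤-trans (ℕₚ.m≤n+m _ (ε 6 18 x)) total)
  where
  total : ε 6 18 x + κ w₃ M (index r) ≤ N
  total = ℕₚ.≤-reflexive (ℤₚ.+-injective (≡.trans (≡.sym (E₁-natural x v)) p))
  ε-≥ : ∀ x → ℤ.∣ x ∣ ≤ ε 6 18 x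
  ε-≥ (pos k) = ℕₚ.≤-trans (ℕₚ.m≤m*n k 6) (ℕₚ.m≤n+m (k * 6) _)
  ε-≥ (neg k) = ℕₚ.≤-trans (ℕₚ.m≤m*n (suc k) 18) (ℕₚ.m≤n+m (suc k * 18) _)
  κ-≥M : ∀ {M r} → Valid M r → ℤ.∣ M ∣ ≤ κ w₃ M (index r)
  κ-≥M (pos-pos m s) = ℕₚ.≤-trans (ℕₚ.m≤m*n m (1 + s * 6)) (ℕₚ.m≤n+m _ (w₃ s))
  κ-≥M (neg-neg m s) = ℕₚ.≤-trans (ℕₚ.m≤m*n (suc m) (5 + s * 6)) (ℕₚ.m≤n+m _ (w₃ s))
  κ-≥r : ∀ {M r} → Valid M r → ℤ.∣ r ∣ ≤ κ w₃ M (index r)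
  κ-≥r (pos-pos m s) = ℕₚ.≤-trans (ℕₚ.m≤m*n s (suc s)) (ℕₚ.≤-trans (ℕₚ.m≤m*n (s * suc s) 6)
    (ℕₚ.≤-trans (ℕₚ.m≤m+n _ (T s * 6)) (ℕₚ.m≤m+n (w₃ s) _)))
  κ-≥r (neg-neg m s) = ℕₚ.≤-trans (ℕₚ.+-mono-≤ (s≤s (z≤n {4})) (ℕₚ.m≤m*n s 6))
    (ℕₚ.≤-trans (ℕₚ.m≤n*m (5 + s * 6) (suc m)) (ℕₚ.m≤n+m _ (w₃ s)))

odd≢even : ∀ a b → pos 2 ℤ.* a ℤ.+ ℤ.1ℤ ≢ pos 2 ℤ.* b
odd≢even a b e = no-half ℤ.∣ b ℤ.- a ∣ (≡.trans (≡.sym (ℤₚ.abs-* (pos 2) (b ℤ.- a)))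
  (cong ℤ.∣_∣ (≡.trans (lemma₁ a b) (≡.trans (cong (ℤ._- pos 2 ℤ.* a) (≡.sym e)) (lemma₂ a)))))
  where
  lemma₁ : ∀ a b → pos 2 ℤ.* (b ℤ.- a) ≡ pos 2 ℤ.* b ℤ.- pos 2 ℤ.* a
  lemma₁ = solve-∀
  lemma₂ : ∀ a → pos 2 ℤ.* a ℤ.+ ℤ.1ℤ ℤ.- pos 2 ℤ.* a ≡ ℤ.1ℤ
  lemma₂ = solve-∀
  no-half : ∀ n → 2 * n ≢ 1
  no-half zero ()
  no-half (suc n) e = ℕₚ.m+1+n≢0 n (ℕₚ.suc-injective e)

-- chosen so that 4x - 1 becomes ±(4k - 2r - 1) and ±(4k + 2r - 1), respectively
π₀ π₁ : ∀ r → Parity r → ℤ → ℤ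
π₀ r (t , inj₁ _ , _) k = k ℤ.- t
π₀ r (t , inj₂ _ , _) k = t ℤ.+ ℤ.1ℤ ℤ.- k
π₁ r (t , inj₁ _ , _) k = k ℤ.+ t
π₁ r (t , inj₂ _ , _) k = ℤ.- k ℤ.- t

-- The parts 2k and 1 - 2k of M make 6rM cancel the mixed terms of `E₂⁰` and `E₂¹`; the part 4m is
-- what divisibility by 4 leaves free.
ι₀ ι₁ : ℤ → ℤ → ℤ
ι₀ k m = pos 2 ℤ.* k ℤ.+ pos 4 ℤ.* m
ι₁ k m = ℤ.1ℤ ℤ.- pos 2 ℤ.* k ℤ.+ pos 4 ℤ.* m

-- The exponent after the substitution for x. Although that substitution distinguishes the parities
-- of r, the result is one polynomial, with 12(r² + r) in place of 9(r² + r).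
E₂⁰ E₂¹ : ℤ → ℤ → ℤ → ℤ
E₂⁰ k M r = pos 12 ℤ.* (k ℤ.* k) ℤ.- pos 6 ℤ.* k ℤ.- pos 12 ℤ.* (r ℤ.* k)
            ℤ.+ pos 12 ℤ.* (r ℤ.* r ℤ.+ r) ℤ.+ pos 6 ℤ.* (r ℤ.* M) ℤ.+ M
E₂¹ k M r = pos 12 ℤ.* (k ℤ.* k) ℤ.- pos 6 ℤ.* k ℤ.+ pos 12 ℤ.* (r ℤ.* k)
            ℤ.+ pos 12 ℤ.* (r ℤ.* r ℤ.+ r) ℤ.+ pos 6 ℤ.* (r ℤ.* M) ℤ.- pos 6 ℤ.* r ℤ.+ M

E₁-π₀ : ∀ k M r (P : Parity r) → E₁ (π₀ r P k) M r ≡ E₂⁰ k M r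
E₁-π₀ k M r (t , inj₁ ≡.refl , _) = lemma k M t
  where
  lemma : ∀ k M t →
    (pos 12 ℤ.* ((k ℤ.- t) ℤ.* (k ℤ.- t) ℤ.- (k ℤ.- t)) ℤ.+ pos 6 ℤ.* (k ℤ.- t))
    ℤ.+ (pos 9 ℤ.* ((pos 2 ℤ.* t) ℤ.* (pos 2 ℤ.* t) ℤ.+ (pos 2 ℤ.* t)) ℤ.+ pos 6 ℤ.* ((pos 2 ℤ.* t) ℤ.* M) ℤ.+ M)
    ≡ pos 12 ℤ.* (k ℤ.* k) ℤ.- pos 6 ℤ.* k ℤ.- pos 12 ℤ.* ((pos 2 ℤ.* t) ℤ.* k)
            ℤ.+ pos 12 ℤ.* ((pos 2 ℤ.* t) ℤ.* (pos 2 ℤ.* t) ℤ.+ (pos 2 ℤ.* t)) ℤ.+ pos 6 ℤ.* ((pos 2 ℤ.* t) ℤ.* M) ℤ.+ M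
  lemma = solve-∀
E₁-π₀ k M r (t , inj₂ ≡.refl , _) = lemma k M t
  where
  lemma : ∀ k M t →
    (pos 12 ℤ.* ((t ℤ.+ ℤ.1ℤ ℤ.- k) ℤ.* (t ℤ.+ ℤ.1ℤ ℤ.- k) ℤ.- (t ℤ.+ ℤ.1ℤ ℤ.- k)) ℤ.+ pos 6 ℤ.* (t ℤ.+ ℤ.1ℤ ℤ.- k))
    ℤ.+ (pos 9 ℤ.* ((pos 2 ℤ.* t ℤ.+ ℤ.1ℤ) ℤ.* (pos 2 ℤ.* t ℤ.+ ℤ.1ℤ) ℤ.+ (pos 2 ℤ.* t ℤ.+ ℤ.1ℤ)) ℤ.+ pos 6 ℤ.* ((pos 2 ℤ.* t ℤ.+ ℤ.1ℤ) ℤ.* M) ℤ.+ M)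
    ≡ pos 12 ℤ.* (k ℤ.* k) ℤ.- pos 6 ℤ.* k ℤ.- pos 12 ℤ.* ((pos 2 ℤ.* t ℤ.+ ℤ.1ℤ) ℤ.* k)
            ℤ.+ pos 12 ℤ.* ((pos 2 ℤ.* t ℤ.+ ℤ.1ℤ) ℤ.* (pos 2 ℤ.* t ℤ.+ ℤ.1ℤ) ℤ.+ (pos 2 ℤ.* t ℤ.+ ℤ.1ℤ)) ℤ.+ pos 6 ℤ.* ((pos 2 ℤ.* t ℤ.+ ℤ.1ℤ) ℤ.* M) ℤ.+ M
  lemma = solve-∀

E₁-π₁ : ∀ k M r (P : Parity r) → E₁ (π₁ r P k) M r ≡ E₂¹ k M r
E₁-π₁ k M r (t , inj₁ ≡.refl , _) = lemma k M t
  where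
  lemma : ∀ k M t →
    (pos 12 ℤ.* ((k ℤ.+ t) ℤ.* (k ℤ.+ t) ℤ.- (k ℤ.+ t)) ℤ.+ pos 6 ℤ.* (k ℤ.+ t))
    ℤ.+ (pos 9 ℤ.* ((pos 2 ℤ.* t) ℤ.* (pos 2 ℤ.* t) ℤ.+ (pos 2 ℤ.* t)) ℤ.+ pos 6 ℤ.* ((pos 2 ℤ.* t) ℤ.* M) ℤ.+ M)
    ≡ pos 12 ℤ.* (k ℤ.* k) ℤ.- pos 6 ℤ.* k ℤ.+ pos 12 ℤ.* ((pos 2 ℤ.* t) ℤ.* k)
            ℤ.+ pos 12 ℤ.* ((pos 2 ℤ.* t) ℤ.* (pos 2 ℤ.* t) ℤ.+ (pos 2 ℤ.* t)) ℤ.+ pos 6 ℤ.* ((pos 2 ℤ.* t) ℤ.* M) ℤ.- pos 6 ℤ.* (pos 2 ℤ.* t) ℤ.+ M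
  lemma = solve-∀
E₁-π₁ k M r (t , inj₂ ≡.refl , _) = lemma k M t
  where
  lemma : ∀ k M t →
    (pos 12 ℤ.* ((ℤ.- k ℤ.- t) ℤ.* (ℤ.- k ℤ.- t) ℤ.- (ℤ.- k ℤ.- t)) ℤ.+ pos 6 ℤ.* (ℤ.- k ℤ.- t))
    ℤ.+ (pos 9 ℤ.* ((pos 2 ℤ.* t ℤ.+ ℤ.1ℤ) ℤ.* (pos 2 ℤ.* t ℤ.+ ℤ.1ℤ) ℤ.+ (pos 2 ℤ.* t ℤ.+ ℤ.1ℤ)) ℤ.+ pos 6 ℤ.* ((pos 2 ℤ.* t ℤ.+ ℤ.1ℤ) ℤ.* M) ℤ.+ M)
    ≡ pos 12 ℤ.* (k ℤ.* k) ℤ.- pos 6 ℤ.* k ℤ.+ pos 12 ℤ.* ((pos 2 ℤ.* t ℤ.+ ℤ.1ℤ) ℤ.* k)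
            ℤ.+ pos 12 ℤ.* ((pos 2 ℤ.* t ℤ.+ ℤ.1ℤ) ℤ.* (pos 2 ℤ.* t ℤ.+ ℤ.1ℤ) ℤ.+ (pos 2 ℤ.* t ℤ.+ ℤ.1ℤ)) ℤ.+ pos 6 ℤ.* ((pos 2 ℤ.* t ℤ.+ ℤ.1ℤ) ℤ.* M) ℤ.- pos 6 ℤ.* (pos 2 ℤ.* t ℤ.+ ℤ.1ℤ) ℤ.+ M
  lemma = solve-∀

∣4m∣ : ∀ m k b → 4 * ℤ.∣ m ∣ ≤ ℤ.∣ b ∣ + ℤ.∣ pos 2 ℤ.* k ∣ + 1 → 4 * ℤ.∣ m ∣ ≤ ℤ.∣ b ∣ + 2 * ℤ.∣ k ∣ + 1
∣4m∣ m k b l = ℕₚ.≤-trans l (ℕₚ.≤-reflexive (cong (λ z → ℤ.∣ b ∣ + z + 1) (ℤₚ.abs-* (pos 2) k)))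

-- Modulo 4 the form `E₂⁰` is 2k + 2rM + M. Its vanishing forces M to be even and then M ≡ 2k, so
-- `ι₀` reaches every M that contributes.
lattice-even : ∀ n B B′ → let N = 4 * n + 0 in 2 * N + 2 ≤ B → n + B + B + 2 ≤ B′ →
  Σℤ B (λ x → Σℤ B (λ M → half B′ M (λ r → δ (E₁ x M r) N)))
    ≡ Σℤ B (λ k → Σℤ B (λ m → half B′ m (λ r → δ (pos (ε 2 4 k) ℤ.+ e₃ m r) n)))
lattice-even n = lattice-section n 0 π ι₀ (ε 2 4) (E₁-bound _) π-onto π-inj ι-onto ι-bound ι-inj exponent
  where
  π : ℤ → ℤ → ℤ
  π r k = π₀ r (parity r) k
  ∣∣≤ : ∀ r x t → ℤ.∣ t ∣ ≤ ℤ.∣ r ∣ → ℤ.∣ x ∣ + ℤ.∣ t ∣ ≤ ℤ.∣ x ∣ + ℤ.∣ r ∣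
  ∣∣≤ r x t = ℕₚ.+-monoʳ-≤ ℤ.∣ x ∣
  π-onto : ∀ r x → Σ ℤ λ k → π r k ≡ x × ℤ.∣ k ∣ ≤ ℤ.∣ x ∣ + ℤ.∣ r ∣ + 1
  π-onto r x with parity r
  ... | t , inj₁ _ , l = x ℤ.+ t , lemma x t ,
        ℕₚ.≤-trans (ℤₚ.∣i+j∣≤∣i∣+∣j∣ x t) (ℕₚ.≤-trans (∣∣≤ r x t l) (ℕₚ.m≤m+n _ 1))
    where
    lemma : ∀ x t → x ℤ.+ t ℤ.- t ≡ x
    lemma = solve-∀
  ... | t , inj₂ _ , l = t ℤ.+ ℤ.1ℤ ℤ.- x , lemma x t ,
        ℕₚ.≤-trans (ℤₚ.∣i-j∣≤∣i∣+∣j∣ (t ℤ.+ ℤ.1ℤ) x) (ℕₚ.≤-trans (ℕₚ.+-monoˡ-≤ ℤ.∣ x ∣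
          (ℕₚ.≤-trans (ℤₚ.∣i+j∣≤∣i∣+∣j∣ t ℤ.1ℤ) (ℕₚ.+-monoˡ-≤ 1 l))) (ℕₚ.≤-reflexive (arith ℤ.∣ r ∣ ℤ.∣ x ∣)))
    where
    lemma : ∀ x t → t ℤ.+ ℤ.1ℤ ℤ.- (t ℤ.+ ℤ.1ℤ ℤ.- x) ≡ x
    lemma = solve-∀
    arith : ∀ r x → r + 1 + x ≡ x + r + 1
    arith = ℕ-Solver.solve-∀
  π-inj : ∀ r k l → π r k ≡ π r l → k ≡ l
  π-inj r k l e with parity r
  ... | t , inj₁ _ , _ = ℤ-+-cancelʳ (ℤ.- t) k l e
  ... | t , inj₂ _ , _ = ≡.trans (≡.sym (lemma k t)) (≡.trans (cong (λ z → t ℤ.+ ℤ.1ℤ ℤ.- z) e) (lemma l t))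
    where
    lemma : ∀ k t → t ℤ.+ ℤ.1ℤ ℤ.- (t ℤ.+ ℤ.1ℤ ℤ.- k) ≡ k
    lemma = solve-∀
  4n+0 : pos (4 * n + 0) ≡ pos 4 ℤ.* pos n
  4n+0 = ≡.trans (cong pos (ℕₚ.+-identityʳ (4 * n))) (ℤₚ.pos-* 4 n)
  ι-onto : ∀ k M r → E₁ (π r k) M r ≡ pos (4 * n + 0) → Σ ℤ λ m → ι₀ k m ≡ M
  ι-onto k M r e = cases M (parity M) (≡.trans (≡.sym (E₁-π₀ k M r (parity r))) (≡.trans e 4n+0))
    where
    cases : ∀ M → Parity M → E₂⁰ k M r ≡ pos 4 ℤ.* pos n → Σ ℤ λ m → ι₀ k m ≡ M
    cases _ (h , inj₁ ≡.refl , _) e = m , ≡.trans (lemma₁ k r h (pos n)) (≡.trans (cong (ℤ._- rest) (≡.sym e)) (lemma₂ k r h))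
      where
      -- This is (M - 2k)/4 for M = 2h, with the division made explicit by the equation for 4n.
      m = pos n ℤ.- pos 3 ℤ.* (k ℤ.* k) ℤ.+ k ℤ.+ pos 3 ℤ.* (r ℤ.* k) ℤ.- pos 3 ℤ.* (r ℤ.* r ℤ.+ r) ℤ.- pos 3 ℤ.* (r ℤ.* h)
      rest = pos 12 ℤ.* (k ℤ.* k) ℤ.- pos 6 ℤ.* k ℤ.- pos 12 ℤ.* (r ℤ.* k) ℤ.+ pos 12 ℤ.* (r ℤ.* r ℤ.+ r) ℤ.+ pos 12 ℤ.* (r ℤ.* h)
      lemma₁ : ∀ k r h n →
        pos 2 ℤ.* k ℤ.+ pos 4 ℤ.* (n ℤ.- pos 3 ℤ.* (k ℤ.* k) ℤ.+ k ℤ.+ pos 3 ℤ.* (r ℤ.* k) ℤ.- pos 3 ℤ.* (r ℤ.* r ℤ.+ r) ℤ.- pos 3 ℤ.* (r ℤ.* h))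
        ≡ pos 4 ℤ.* n ℤ.- (pos 12 ℤ.* (k ℤ.* k) ℤ.- pos 6 ℤ.* k ℤ.- pos 12 ℤ.* (r ℤ.* k) ℤ.+ pos 12 ℤ.* (r ℤ.* r ℤ.+ r) ℤ.+ pos 12 ℤ.* (r ℤ.* h))
      lemma₁ = solve-∀
      lemma₂ : ∀ k r h →
        pos 12 ℤ.* (k ℤ.* k) ℤ.- pos 6 ℤ.* k ℤ.- pos 12 ℤ.* (r ℤ.* k)
            ℤ.+ pos 12 ℤ.* (r ℤ.* r ℤ.+ r) ℤ.+ pos 6 ℤ.* (r ℤ.* (pos 2 ℤ.* h)) ℤ.+ pos 2 ℤ.* h
          ℤ.- (pos 12 ℤ.* (k ℤ.* k) ℤ.- pos 6 ℤ.* k ℤ.- pos 12 ℤ.* (r ℤ.* k) ℤ.+ pos 12 ℤ.* (r ℤ.* r ℤ.+ r) ℤ.+ pos 12 ℤ.* (r ℤ.* h))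
        ≡ pos 2 ℤ.* h
      lemma₂ = solve-∀
    -- An odd M makes `E₂⁰` odd, whereas 4n is even.
    cases _ (h , inj₂ ≡.refl , _) e = contradiction
      (≡.trans (lemma₁ k r h) (≡.trans e (lemma₂ (pos n)))) (odd≢even X (pos 2 ℤ.* pos n))
      where
      X = pos 6 ℤ.* (k ℤ.* k) ℤ.- pos 3 ℤ.* k ℤ.- pos 6 ℤ.* (r ℤ.* k) ℤ.+ pos 6 ℤ.* (r ℤ.* r ℤ.+ r)
            ℤ.+ pos 6 ℤ.* (r ℤ.* h) ℤ.+ pos 3 ℤ.* r ℤ.+ h
      lemma₁ : ∀ k r h →
        pos 2 ℤ.* (pos 6 ℤ.* (k ℤ.* k) ℤ.- pos 3 ℤ.* k ℤ.- pos 6 ℤ.* (r ℤ.* k) ℤ.+ pos 6 ℤ.* (r ℤ.* r ℤ.+ r)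
                   ℤ.+ pos 6 ℤ.* (r ℤ.* h) ℤ.+ pos 3 ℤ.* r ℤ.+ h) ℤ.+ ℤ.1ℤ
        ≡ pos 12 ℤ.* (k ℤ.* k) ℤ.- pos 6 ℤ.* k ℤ.- pos 12 ℤ.* (r ℤ.* k)
            ℤ.+ pos 12 ℤ.* (r ℤ.* r ℤ.+ r) ℤ.+ pos 6 ℤ.* (r ℤ.* (pos 2 ℤ.* h ℤ.+ ℤ.1ℤ)) ℤ.+ (pos 2 ℤ.* h ℤ.+ ℤ.1ℤ)
      lemma₁ = solve-∀
      lemma₂ : ∀ n → pos 4 ℤ.* n ≡ pos 2 ℤ.* (pos 2 ℤ.* n)
      lemma₂ = solve-∀
  ι-bound : ∀ k m → 4 * ℤ.∣ m ∣ ≤ ℤ.∣ ι₀ k m ∣ + 2 * ℤ.∣ k ∣ + 1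
  ι-bound k m = ∣4m∣ m k (ι₀ k m) (ℕₚ.≤-trans (ℕₚ.≤-reflexive
    (≡.trans (≡.sym (ℤₚ.abs-* (pos 4) m)) (cong ℤ.∣_∣ (lemma k m))))
    (ℕₚ.≤-trans (ℤₚ.∣i-j∣≤∣i∣+∣j∣ (ι₀ k m) (pos 2 ℤ.* k)) (ℕₚ.m≤m+n _ 1)))
    where
    lemma : ∀ k m → pos 4 ℤ.* m ≡ pos 2 ℤ.* k ℤ.+ pos 4 ℤ.* m ℤ.- pos 2 ℤ.* k
    lemma = solve-∀
  ι-inj : ∀ k m l → ι₀ k m ≡ ι₀ k l → m ≡ l
  ι-inj k m l e = ℤₚ.*-cancelˡ-≡ (pos 4) m l
    (≡.trans (lemma k m) (≡.trans (cong (ℤ._- pos 2 ℤ.* k) e) (≡.sym (lemma k l))))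
    where
    lemma : ∀ k m → pos 4 ℤ.* m ≡ pos 2 ℤ.* k ℤ.+ pos 4 ℤ.* m ℤ.- pos 2 ℤ.* k
    lemma = solve-∀
  exponent : ∀ k m r → E₁ (π r k) (ι₀ k m) r ≡ pos 4 ℤ.* (pos (ε 2 4 k) ℤ.+ e₃ m r) ℤ.+ pos 0
  exponent k m r = ≡.trans (E₁-π₀ k (ι₀ k m) r (parity r)) (≡.trans (lemma k m r)
    (cong (λ z → pos 4 ℤ.* (z ℤ.+ e₃ m r) ℤ.+ pos 0) (≡.sym (ε-poly 2 4 3 ≡.refl k))))
    where
    lemma : ∀ k m r →
      pos 12 ℤ.* (k ℤ.* k) ℤ.- pos 6 ℤ.* k ℤ.- pos 12 ℤ.* (r ℤ.* k)
        ℤ.+ pos 12 ℤ.* (r ℤ.* r ℤ.+ r) ℤ.+ pos 6 ℤ.* (r ℤ.* (pos 2 ℤ.* k ℤ.+ pos 4 ℤ.* m)) ℤ.+ (pos 2 ℤ.* k ℤ.+ pos 4 ℤ.* m)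
      ≡ pos 4 ℤ.* ((pos 3 ℤ.* (k ℤ.* k ℤ.- k) ℤ.+ pos 2 ℤ.* k)
          ℤ.+ (pos 3 ℤ.* (r ℤ.* r ℤ.+ r) ℤ.+ pos 6 ℤ.* (r ℤ.* m) ℤ.+ m)) ℤ.+ pos 0
    lemma = solve-∀

-- `E₂¹` has the parity of M, so M is odd. Then 6rM - 6r is divisible by 4 after the multiple 12 is
-- split off, and M ≡ 1 - 2k modulo 4 remains.
lattice-odd : ∀ n B B′ → let N = 4 * n + 1 in 2 * N + 2 ≤ B → n + B + B + 2 ≤ B′ →
  Σℤ B (λ x → Σℤ B (λ M → half B′ M (λ r → δ (E₁ x M r) N)))
    ≡ Σℤ B (λ k → Σℤ B (λ m → half B′ m (λ r → δ (pos (ε 1 5 k) ℤ.+ e₃ m r) n)))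
lattice-odd n = lattice-section n 1 π ι₁ (ε 1 5) (E₁-bound _) π-onto π-inj ι-onto ι-bound ι-inj exponent
  where
  π : ℤ → ℤ → ℤ
  π r k = π₁ r (parity r) k
  ∣∣≤ : ∀ r x t → ℤ.∣ t ∣ ≤ ℤ.∣ r ∣ → ℤ.∣ x ∣ + ℤ.∣ t ∣ ≤ ℤ.∣ x ∣ + ℤ.∣ r ∣
  ∣∣≤ r x t = ℕₚ.+-monoʳ-≤ ℤ.∣ x ∣
  π-onto : ∀ r x → Σ ℤ λ k → π r k ≡ x × ℤ.∣ k ∣ ≤ ℤ.∣ x ∣ + ℤ.∣ r ∣ + 1
  π-onto r x with parity r
  ... | t , inj₁ _ , l = x ℤ.- t , lemma x t ,
        ℕₚ.≤-trans (ℤₚ.∣i-j∣≤∣i∣+∣j∣ x t) (ℕₚ.≤-trans (∣∣≤ r x t l) (ℕₚ.m≤m+n _ 1))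
    where
    lemma : ∀ x t → x ℤ.- t ℤ.+ t ≡ x
    lemma = solve-∀
  ... | t , inj₂ _ , l = ℤ.- x ℤ.- t , lemma x t ,
        ℕₚ.≤-trans (ℤₚ.∣i-j∣≤∣i∣+∣j∣ (ℤ.- x) t) (ℕₚ.≤-trans (ℕₚ.+-monoˡ-≤ ℤ.∣ t ∣
          (ℕₚ.≤-reflexive (ℤₚ.∣-i∣≡∣i∣ x))) (ℕₚ.≤-trans (∣∣≤ r x t l) (ℕₚ.m≤m+n _ 1)))
    where
    lemma : ∀ x t → ℤ.- (ℤ.- x ℤ.- t) ℤ.- t ≡ x
    lemma = solve-∀
  π-inj : ∀ r k l → π r k ≡ π r l → k ≡ l
  π-inj r k l e with parity r
  ... | t , inj₁ _ , _ = ℤ-+-cancelʳ t k l e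
  ... | t , inj₂ _ , _ = ℤₚ.neg-injective (ℤ-+-cancelʳ (ℤ.- t) (ℤ.- k) (ℤ.- l) e)
  4n+1 : pos (4 * n + 1) ≡ pos 4 ℤ.* pos n ℤ.+ ℤ.1ℤ
  4n+1 = cong (ℤ._+ ℤ.1ℤ) (ℤₚ.pos-* 4 n)
  ι-onto : ∀ k M r → E₁ (π r k) M r ≡ pos (4 * n + 1) → Σ ℤ λ m → ι₁ k m ≡ M
  ι-onto k M r e = cases M (parity M) (≡.trans (≡.sym (E₁-π₁ k M r (parity r))) (≡.trans e 4n+1))
    where
    cases : ∀ M → Parity M → E₂¹ k M r ≡ pos 4 ℤ.* pos n ℤ.+ ℤ.1ℤ → Σ ℤ λ m → ι₁ k m ≡ M
    cases _ (h , inj₂ ≡.refl , _) e = m , ≡.trans (lemma₁ k r h (pos n)) (≡.trans (cong (ℤ._- rest) (≡.sym e)) (lemma₂ k r h))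
      where
      m = pos n ℤ.- pos 3 ℤ.* (k ℤ.* k) ℤ.+ pos 2 ℤ.* k ℤ.- pos 3 ℤ.* (r ℤ.* k) ℤ.- pos 3 ℤ.* (r ℤ.* r ℤ.+ r) ℤ.- pos 3 ℤ.* (r ℤ.* h)
      rest = pos 12 ℤ.* (k ℤ.* k) ℤ.- pos 6 ℤ.* k ℤ.+ pos 12 ℤ.* (r ℤ.* k) ℤ.+ pos 12 ℤ.* (r ℤ.* r ℤ.+ r) ℤ.+ pos 12 ℤ.* (r ℤ.* h)
      lemma₁ : ∀ k r h n →
        ℤ.1ℤ ℤ.- pos 2 ℤ.* k ℤ.+ pos 4 ℤ.* (n ℤ.- pos 3 ℤ.* (k ℤ.* k) ℤ.+ pos 2 ℤ.* k ℤ.- pos 3 ℤ.* (r ℤ.* k) ℤ.- pos 3 ℤ.* (r ℤ.* r ℤ.+ r) ℤ.- pos 3 ℤ.* (r ℤ.* h))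
        ≡ pos 4 ℤ.* n ℤ.+ ℤ.1ℤ ℤ.- (pos 12 ℤ.* (k ℤ.* k) ℤ.- pos 6 ℤ.* k ℤ.+ pos 12 ℤ.* (r ℤ.* k) ℤ.+ pos 12 ℤ.* (r ℤ.* r ℤ.+ r) ℤ.+ pos 12 ℤ.* (r ℤ.* h))
      lemma₁ = solve-∀
      lemma₂ : ∀ k r h →
        pos 12 ℤ.* (k ℤ.* k) ℤ.- pos 6 ℤ.* k ℤ.+ pos 12 ℤ.* (r ℤ.* k)
            ℤ.+ pos 12 ℤ.* (r ℤ.* r ℤ.+ r) ℤ.+ pos 6 ℤ.* (r ℤ.* (pos 2 ℤ.* h ℤ.+ ℤ.1ℤ)) ℤ.- pos 6 ℤ.* r ℤ.+ (pos 2 ℤ.* h ℤ.+ ℤ.1ℤ)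
          ℤ.- (pos 12 ℤ.* (k ℤ.* k) ℤ.- pos 6 ℤ.* k ℤ.+ pos 12 ℤ.* (r ℤ.* k) ℤ.+ pos 12 ℤ.* (r ℤ.* r ℤ.+ r) ℤ.+ pos 12 ℤ.* (r ℤ.* h))
        ≡ pos 2 ℤ.* h ℤ.+ ℤ.1ℤ
      lemma₂ = solve-∀
    cases _ (h , inj₁ ≡.refl , _) e = contradiction
      (≡.trans (lemma₂ (pos n)) (≡.trans (≡.sym e) (lemma₁ k r h))) (odd≢even (pos 2 ℤ.* pos n) X)
      where
      X = pos 6 ℤ.* (k ℤ.* k) ℤ.- pos 3 ℤ.* k ℤ.+ pos 6 ℤ.* (r ℤ.* k) ℤ.+ pos 6 ℤ.* (r ℤ.* r ℤ.+ r)
            ℤ.+ pos 6 ℤ.* (r ℤ.* h) ℤ.- pos 3 ℤ.* r ℤ.+ h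
      lemma₁ : ∀ k r h →
        pos 12 ℤ.* (k ℤ.* k) ℤ.- pos 6 ℤ.* k ℤ.+ pos 12 ℤ.* (r ℤ.* k)
            ℤ.+ pos 12 ℤ.* (r ℤ.* r ℤ.+ r) ℤ.+ pos 6 ℤ.* (r ℤ.* (pos 2 ℤ.* h)) ℤ.- pos 6 ℤ.* r ℤ.+ pos 2 ℤ.* h
        ≡ pos 2 ℤ.* (pos 6 ℤ.* (k ℤ.* k) ℤ.- pos 3 ℤ.* k ℤ.+ pos 6 ℤ.* (r ℤ.* k) ℤ.+ pos 6 ℤ.* (r ℤ.* r ℤ.+ r)
                   ℤ.+ pos 6 ℤ.* (r ℤ.* h) ℤ.- pos 3 ℤ.* r ℤ.+ h)
      lemma₁ = solve-∀
      lemma₂ : ∀ n → pos 2 ℤ.* (pos 2 ℤ.* n) ℤ.+ ℤ.1ℤ ≡ pos 4 ℤ.* n ℤ.+ ℤ.1ℤ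
      lemma₂ = solve-∀
  ι-bound : ∀ k m → 4 * ℤ.∣ m ∣ ≤ ℤ.∣ ι₁ k m ∣ + 2 * ℤ.∣ k ∣ + 1
  ι-bound k m = ∣4m∣ m k (ι₁ k m) (ℕₚ.≤-trans (ℕₚ.≤-reflexive
    (≡.trans (≡.sym (ℤₚ.abs-* (pos 4) m)) (cong ℤ.∣_∣ (lemma k m))))
    (ℕₚ.≤-trans (ℤₚ.∣i-j∣≤∣i∣+∣j∣ (ι₁ k m ℤ.+ pos 2 ℤ.* k) ℤ.1ℤ)
                (ℕₚ.+-monoˡ-≤ 1 (ℤₚ.∣i+j∣≤∣i∣+∣j∣ (ι₁ k m) (pos 2 ℤ.* k)))))
    where
    lemma : ∀ k m → pos 4 ℤ.* m ≡ ℤ.1ℤ ℤ.- pos 2 ℤ.* k ℤ.+ pos 4 ℤ.* m ℤ.+ pos 2 ℤ.* k ℤ.- ℤ.1ℤ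
    lemma = solve-∀
  ι-inj : ∀ k m l → ι₁ k m ≡ ι₁ k l → m ≡ l
  ι-inj k m l e = ℤₚ.*-cancelˡ-≡ (pos 4) m l
    (≡.trans (lemma k m) (≡.trans (cong (λ z → z ℤ.+ pos 2 ℤ.* k ℤ.- ℤ.1ℤ) e) (≡.sym (lemma k l))))
    where
    lemma : ∀ k m → pos 4 ℤ.* m ≡ ℤ.1ℤ ℤ.- pos 2 ℤ.* k ℤ.+ pos 4 ℤ.* m ℤ.+ pos 2 ℤ.* k ℤ.- ℤ.1ℤ
    lemma = solve-∀
  exponent : ∀ k m r → E₁ (π r k) (ι₁ k m) r ≡ pos 4 ℤ.* (pos (ε 1 5 k) ℤ.+ e₃ m r) ℤ.+ pos 1
  exponent k m r = ≡.trans (E₁-π₁ k (ι₁ k m) r (parity r)) (≡.trans (lemma k m r)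
    (cong (λ z → pos 4 ℤ.* (z ℤ.+ e₃ m r) ℤ.+ pos 1) (≡.sym (ε-poly 1 5 3 ≡.refl k))))
    where
    lemma : ∀ k m r →
      pos 12 ℤ.* (k ℤ.* k) ℤ.- pos 6 ℤ.* k ℤ.+ pos 12 ℤ.* (r ℤ.* k)
        ℤ.+ pos 12 ℤ.* (r ℤ.* r ℤ.+ r) ℤ.+ pos 6 ℤ.* (r ℤ.* (ℤ.1ℤ ℤ.- pos 2 ℤ.* k ℤ.+ pos 4 ℤ.* m))
        ℤ.- pos 6 ℤ.* r ℤ.+ (ℤ.1ℤ ℤ.- pos 2 ℤ.* k ℤ.+ pos 4 ℤ.* m)
      ≡ pos 4 ℤ.* ((pos 3 ℤ.* (k ℤ.* k ℤ.- k) ℤ.+ ℤ.1ℤ ℤ.* k)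
          ℤ.+ (pos 3 ℤ.* (r ℤ.* r ℤ.+ r) ℤ.+ pos 6 ℤ.* (r ℤ.* m) ℤ.+ m)) ℤ.+ ℤ.1ℤ
    lemma = solve-∀

-- Bilateral expansions of theta series and Lambert series

∑ℤ : ℕ → (ℤ → S) → S
∑ℤ B F = ∑ B (λ k → F (pos k) ⊕ F (neg k))

∑ℤ-cong : ∀ B {F G} → (∀ x → F x ≋ G x) → ∑ℤ B F ≋ ∑ℤ B G
∑ℤ-cong B p = ∑-cong B (λ k _ → ⊕-cong (p (pos k)) (p (neg k)))

∑ℤ-⊛ˡ : ∀ B c F → ∑ℤ B (λ x → c ⊛ F x) ≋ c ⊛ ∑ℤ B F
∑ℤ-⊛ˡ B c F = ≋-trans (∑-cong B (λ k _ → ≋-sym (⊛-distribˡ c (F (pos k)) (F (neg k)))))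
                       (∑-⊛ˡ B c (λ k → F (pos k) ⊕ F (neg k)))

coeff-∑ : ∀ N F n → ∑ N F n ≡ Σ< N (λ i → F i n)
coeff-∑ zero    F n = coeff-𝟎 n
coeff-∑ (suc N) F n = ≡.trans (coeff-⊕ (∑ N F) (F N) n) (cong (ℤ._+ F N n) (coeff-∑ N F n))

coeff-∑ℤ : ∀ B F n → ∑ℤ B F n ≡ Σℤ B (λ x → F x n)
coeff-∑ℤ B F n = ≡.trans (coeff-∑ B (λ k → F (pos k) ⊕ F (neg k)) n)
                         (Σ<-cong B (λ k _ → coeff-⊕ (F (pos k)) (F (neg k)) n))

module Expansions (u v : S) (ou : Ord 1 u) (ov : Ord 1 v) where

  open TripleProduct u v ou ov

  ϑ : ℤ → S
  ϑ (pos k) = Q ↑ tri k ⊛ u ↑ k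
  ϑ (neg k) = Q ↑ tri (suc k) ⊛ v ↑ suc k

  -- The box -B ≤ x < B lacks only the term x = B of the symmetric partial sum, and that term has
  -- order at least B.
  theta-bilateral : ∀ B → theta ≈[ B ] ∑ℤ B ϑ
  theta-bilateral B = ≈-trans (⊕-≈ (λ _ _ → ≡.refl) (lim-≈ (∑-stable Ord-theta-term) (ℕₚ.≤-refl {B})))
    (≈-trans (≋⇒≈ (≋-sym (telescoped B)))
      (≈-trans (⊕-≈ (λ _ _ → ≡.refl) (Ord-⊛ {0} Ord-0 (Ord₁-↑ ou B))) (≋⇒≈ (⊕-identityʳ _))))
    where
    telescoped : ∀ B → ∑ℤ B ϑ ⊕ ϑ (pos B) ≋ 𝟏 ⊕ ∑ B theta-term
    telescoped zero    = ≋-trans (⊕-comm 𝟎 _) (⊕-cong (⊛-identityˡ 𝟏) ≋-refl)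
    telescoped (suc B) = begin
      ∑ℤ B ϑ ⊕ (ϑ (pos B) ⊕ ϑ (neg B)) ⊕ ϑ (pos (suc B))
        ≈⟨ solve 5 (λ s p t v u → s :+ (p :+ t :* v) :+ t :* u := s :+ p :+ t :* (u :+ v)) ≋-refl
             (∑ℤ B ϑ) (ϑ (pos B)) (Q ↑ tri (suc B)) (v ↑ suc B) (u ↑ suc B) ⟩
      ∑ℤ B ϑ ⊕ ϑ (pos B) ⊕ theta-term B
        ≈⟨ ⊕-cong (telescoped B) ≋-refl ⟩
      𝟏 ⊕ ∑ B theta-term ⊕ theta-term B
        ≈⟨ ⊕-assoc _ _ _ ⟩
      𝟏 ⊕ ∑ (suc B) theta-term ∎
      where open ≋-Reasoning

  ℓ : ℕ → ℤ → S
  ℓ s (pos m) = (u ⊛ Q ↑ s) ↑ m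
  ℓ s (neg m) = (v ⊛ Q ↑ s) ↑ suc m

  -- For a = u Q^s and b = v Q^s the numerator is 1 - ab = (1 - b) + b(1 - a), so the quotient is
  -- 1/(1 - a) + b/(1 - b).
  lambert-bilateral : ∀ B s → (𝟏 ⊝ Q ↑ suc (s + s)) ⊛ e s ≈[ B ] ∑ℤ B (ℓ s)
  lambert-bilateral B s = ≈-trans (≋⇒≈ split)
    (≈-trans (⊕-≈ (lim-≈ (geo-stable oa) (ℕₚ.≤-refl {B}))
                  (⊛-≈ (λ _ _ → ≡.refl) (lim-≈ (geo-stable ob) (ℕₚ.≤-refl {B}))))
      (≋⇒≈ (≋-trans (⊕-cong ≋-refl (≋-sym (∑-⊛ˡ B b (b ↑_)))) (≋-sym (∑-⊕ B (a ↑_) (λ m → b ↑ suc m))))))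
    where
    open ≋-Reasoning
    a = u ⊛ Q ↑ s
    b = v ⊛ Q ↑ s
    oa : Ord 1 a
    oa = Ord-⊛ ou Ord-0
    ob : Ord 1 b
    ob = Ord-⊛ ov Ord-0
    split : (𝟏 ⊝ Q ↑ suc (s + s)) ⊛ e s ≋ geo a ⊕ b ⊛ geo b
    split = begin
      (𝟏 ⊝ Q ⊛ Q ↑ (s + s)) ⊛ (geo a ⊛ geo b)
        ≈⟨ ⊛-cong (⊕-cong ≋-refl (⊖-cong (⊛-cong ≋-refl (↑-+ Q s s)))) ≋-refl ⟩
      (𝟏 ⊝ Q ⊛ (Q ↑ s ⊛ Q ↑ s)) ⊛ (geo a ⊛ geo b)
        ≈⟨ solve 5 (λ u v p g h → (c1 :- u :* v :* (p :* p)) :* (g :* h)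
             := g :* ((c1 :- v :* p) :* h) :+ v :* p :* h :* ((c1 :- u :* p) :* g)) ≋-refl
             u v (Q ↑ s) (geo a) (geo b) ⟩
      geo a ⊛ ((𝟏 ⊝ b) ⊛ geo b) ⊕ b ⊛ geo b ⊛ ((𝟏 ⊝ a) ⊛ geo a)
        ≈⟨ ⊕-cong (⊛-cong ≋-refl (geo-inverse ob)) (⊛-cong ≋-refl (geo-inverse oa)) ⟩
      geo a ⊛ 𝟏 ⊕ b ⊛ geo b ⊛ 𝟏
        ≈⟨ ⊕-cong (⊛-identityʳ _) (⊛-identityʳ _) ⟩
      geo a ⊕ b ⊛ geo b ∎

-- Coefficients of the products as signed counts of lattice points

q : S
q 1 = ℤ.1ℤ
q _ = ℤ.0ℤ

oq : Ord 1 q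
oq zero    _        = ≡.sym (coeff-𝟎 0)
oq (suc n) (s≤s ())

opaque
  unfolding _⊕_

  q⊛-zero : ∀ f → (q ⊛ f) 0 ≡ ℤ.0ℤ
  q⊛-zero f = ℤₚ.*-zeroˡ (f 0)

  q⊛-suc : ∀ f n → (q ⊛ f) (suc n) ≡ f n
  q⊛-suc f n = ≡.trans (cong₂ ℤ._+_ (ℤₚ.*-zeroˡ (f (suc n))) (conv-cong {tail q} {const ℤ.1ℤ} tail-q (λ _ → ≡.refl) n))
    (≡.trans (ℤₚ.+-identityˡ _) (≡.trans (conv-const ℤ.1ℤ f n) (ℤₚ.*-identityˡ (f n))))
    where
    tail-q : tail q ≋ const ℤ.1ℤ
    tail-q zero    = ≡.refl
    tail-q (suc n) = ≡.refl

  coeff-𝟏-zero : 𝟏 0 ≡ ℤ.1ℤ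
  coeff-𝟏-zero = ≡.refl

  coeff-𝟏-suc : ∀ n → 𝟏 (suc n) ≡ ℤ.0ℤ
  coeff-𝟏-suc n = ≡.refl

δ-yes : ∀ e n → e ≡ pos n → δ e n ≡ ℤ.1ℤ
δ-yes e n p with e ℤ.≟ pos n
... | yes _ = ≡.refl
... | no ¬p = contradiction p ¬p

δ-no : ∀ e n → e ≢ pos n → δ e n ≡ ℤ.0ℤ
δ-no e n ¬p with e ℤ.≟ pos n
... | yes p = contradiction p ¬p
... | no _  = ≡.refl

coeff-q↑ : ∀ a n → (q ↑ a) n ≡ δ (pos a) n
coeff-q↑ zero    zero    = ≡.trans coeff-𝟏-zero (≡.sym (δ-yes (pos 0) 0 ≡.refl))
coeff-q↑ zero    (suc n) = ≡.trans (coeff-𝟏-suc n) (≡.sym (δ-no (pos 0) (suc n) (λ ())))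
coeff-q↑ (suc a) zero    = ≡.trans (q⊛-zero (q ↑ a)) (≡.sym (δ-no (pos (suc a)) 0 (λ ())))
coeff-q↑ (suc a) (suc n) = ≡.trans (q⊛-suc (q ↑ a) n) (≡.trans (coeff-q↑ a n)
  (δ-≡ (λ p → cong (ℤ._+_ ℤ.1ℤ) p) (λ p → cong ℤ.pred p)))

sg-sgn : ∀ s → sg s ≋ con (sgn s)
sg-sgn zero    = ≋-refl
sg-sgn (suc s) = ≋-trans (⊛-cong ≋-refl (sg-sgn s))
  (≋-trans (solve 1 (λ x → :- c1 :* x := :- x) ≋-refl (con (sgn s))) (≋-sym (con-neg (sgn s))))

-- Coefficient n sees each factor only modulo q^{n+1}, so any boxes larger than n yield the same
-- count. This freedom lets both sides of the lattice identity use the same B and B′.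
coeff-formula : ∀ (t : S) (F : ℕ → S) (w : ℕ → ℕ) (α β : ℕ) →
  (∀ B → t ≈[ B ] ∑ℤ B (λ x → q ↑ ε α β x)) →
  (∀ s → Ord s (F s)) →
  (∀ B s → F s ≈[ B ] ∑ℤ B (λ M → sg s ⊛ q ↑ κ w M s)) →
  ∀ n B B′ → n < B → n < B′ →
  (t ⊛ lim (λ N → ∑ N F)) n
    ≡ Σℤ B (λ x → Σℤ B (λ M → Σ< B′ (λ s → sgn s ℤ.* δ (pos (ε α β x + κ w M s)) n)))
coeff-formula t F w α β t≈ oF F≈ n B B′ n<B n<B′ = begin
  (t ⊛ lim (λ N → ∑ N F)) n
    ≡⟨ ⊛-≈ (≈-weaken n<B (t≈ B)) (≈-trans (lim-≈ (∑-stable oF) n<B′)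
         (∑-≈ B′ (λ s _ → ≈-weaken n<B (F≈ B s)))) n ℕₚ.≤-refl ⟩
  (∑ℤ B (λ x → q ↑ ε α β x) ⊛ L) n
    ≡⟨ ≋-trans (⊛-comm _ L) (≋-sym (∑ℤ-⊛ˡ B L (λ x → q ↑ ε α β x))) n ⟩
  ∑ℤ B (λ x → L ⊛ q ↑ ε α β x) n
    ≡⟨ coeff-∑ℤ B (λ x → L ⊛ q ↑ ε α β x) n ⟩
  Σℤ B (λ x → (L ⊛ q ↑ ε α β x) n)
    ≡⟨ Σℤ-cong B (λ x _ → inner x) ⟩
  Σℤ B (λ x → Σℤ B (λ M → Σ< B′ (λ s → sgn s ℤ.* δ (pos (ε α β x + κ w M s)) n))) ∎
  where
  open ≡.≡-Reasoning
  L = ∑ B′ (λ s → ∑ℤ B (λ M → sg s ⊛ q ↑ κ w M s))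
  monomial : ∀ x s M → (q ↑ ε α β x ⊛ (sg s ⊛ q ↑ κ w M s)) n ≡ sgn s ℤ.* δ (pos (ε α β x + κ w M s)) n
  monomial x s M = begin
    (q ↑ ε α β x ⊛ (sg s ⊛ q ↑ κ w M s)) n
      ≡⟨ ≋-trans (solve 3 (λ a s b → a :* (s :* b) := s :* (a :* b)) ≋-refl (q ↑ ε α β x) (sg s) (q ↑ κ w M s))
           (⊛-cong (sg-sgn s) (≋-sym (↑-+ q (ε α β x) (κ w M s)))) n ⟩
    (con (sgn s) ⊛ q ↑ (ε α β x + κ w M s)) n
      ≡⟨ coeff-con-⊛ (sgn s) _ n ⟩
    sgn s ℤ.* (q ↑ (ε α β x + κ w M s)) n
      ≡⟨ cong (sgn s ℤ.*_) (coeff-q↑ (ε α β x + κ w M s) n) ⟩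
    sgn s ℤ.* δ (pos (ε α β x + κ w M s)) n ∎
  inner : ∀ x → (L ⊛ q ↑ ε α β x) n
    ≡ Σℤ B (λ M → Σ< B′ (λ s → sgn s ℤ.* δ (pos (ε α β x + κ w M s)) n))
  inner x = begin
    (L ⊛ q ↑ ε α β x) n
      ≡⟨ ≋-trans (⊛-comm L _) (≋-trans (≋-sym (∑-⊛ˡ B′ (q ↑ ε α β x) _))
           (∑-cong B′ (λ s _ → ≋-sym (∑ℤ-⊛ˡ B (q ↑ ε α β x) (λ M → sg s ⊛ q ↑ κ w M s))))) n ⟩
    ∑ B′ (λ s → ∑ℤ B (λ M → q ↑ ε α β x ⊛ (sg s ⊛ q ↑ κ w M s))) n
      ≡⟨ ≡.trans (coeff-∑ B′ _ n) (Σ<-cong B′ (λ s _ →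
           coeff-∑ℤ B (λ M → q ↑ ε α β x ⊛ (sg s ⊛ q ↑ κ w M s)) n)) ⟩
    Σ< B′ (λ s → Σℤ B (λ M → (q ↑ ε α β x ⊛ (sg s ⊛ q ↑ κ w M s)) n))
      ≡⟨ Σ<-cong B′ (λ s _ → Σℤ-cong B (λ M _ → monomial x s M)) ⟩
    Σ< B′ (λ s → Σℤ B (λ M → sgn s ℤ.* δ (pos (ε α β x + κ w M s)) n))
      ≡⟨ Σ<-Σℤ-swap B′ B (λ s M → sgn s ℤ.* δ (pos (ε α β x + κ w M s)) n) ⟩
    Σℤ B (λ M → Σ< B′ (λ s → sgn s ℤ.* δ (pos (ε α β x + κ w M s)) n)) ∎

oq↑ : ∀ n .{{_ : NonZero n}} → Ord 1 (q ↑ n)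
oq↑ (suc n) = ≈-weaken (s≤s z≤n) (Ord₁-↑ oq (suc n))

module E = EtaIdentities q oq
module E₆ = EtaIdentities (q ↑ 6) (oq↑ 6)

↑-↑-⊛ : ∀ a b k m → (q ↑ a ⊛ q ↑ b) ↑ k ⊛ (q ↑ a) ↑ m ≋ q ↑ (k * (a + b) + m * a)
↑-↑-⊛ a b k m = ≋-trans (⊛-cong (E.Q-power a b k) (≋-sym (↑-* q m a))) (≋-sym (↑-+ q (k * (a + b)) (m * a)))

theta-ε : ∀ α β .{{_ : NonZero α}} .{{_ : NonZero β}} B → E.Θ.theta α β ≈[ B ] ∑ℤ B (λ x → q ↑ ε α β x)
theta-ε α β B = ≈-trans (Expansions.theta-bilateral (q ↑ α) (q ↑ β) (oq↑ α) (oq↑ β) B) (≋⇒≈ (∑ℤ-cong B exponents))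
  where
  exponents : ∀ x → Expansions.ϑ (q ↑ α) (q ↑ β) (oq↑ α) (oq↑ β) x ≋ q ↑ ε α β x
  exponents (pos k) = ↑-↑-⊛ α β (tri k) k
  exponents (neg k) = ≋-trans (⊛-cong (E.Q-power α β (tri (suc k))) (≋-sym (↑-* q (suc k) β)))
                              (≋-sym (↑-+ q (tri (suc k) * (α + β)) (suc k * β)))

theta₆-ε : ∀ B → E₆.Θ.theta 1 3 ≈[ B ] ∑ℤ B (λ x → q ↑ ε 6 18 x)
theta₆-ε B = ≈-trans (Expansions.theta-bilateral ((q ↑ 6) ↑ 1) ((q ↑ 6) ↑ 3) (oq↑↑ 1) (oq↑↑ 3) B)
                     (≋⇒≈ (∑ℤ-cong B exponents))
  where
  oq↑↑ : ∀ n .{{_ : NonZero n}} → Ord 1 ((q ↑ 6) ↑ n)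
  oq↑↑ (suc n) = ≈-weaken (s≤s z≤n) (Ord₁-↑ (oq↑ 6) (suc n))
  exponents : ∀ x → Expansions.ϑ ((q ↑ 6) ↑ 1) ((q ↑ 6) ↑ 3) (oq↑↑ 1) (oq↑↑ 3) x ≋ q ↑ ε 6 18 x
  exponents (pos k) = ≋-trans
    (⊛-cong (↑-cong (tri k) (⊛-cong (≋-sym (↑-* q 1 6)) (≋-sym (↑-* q 3 6)))) (↑-cong k (≋-sym (↑-* q 1 6))))
    (↑-↑-⊛ 6 18 (tri k) k)
  exponents (neg k) = ≋-trans
    (⊛-cong (↑-cong (tri (suc k)) (⊛-cong (≋-sym (↑-* q 1 6)) (≋-sym (↑-* q 3 6)))) (↑-cong (suc k) (≋-sym (↑-* q 3 6))))
    (≋-trans (⊛-cong (E.Q-power 6 18 (tri (suc k))) (≋-sym (↑-* q (suc k) 18)))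
             (≋-sym (↑-+ q (tri (suc k) * 24) (suc k * 18))))

module L = E.Θ 1 5

lambert-κ : ∀ (w : ℕ → ℕ) (F : ℕ → S) →
  (∀ s → F s ≋ sg s ⊛ q ↑ w s ⊛ ((𝟏 ⊝ L.Q ↑ suc (s + s)) ⊛ L.e s)) →
  ∀ B s → F s ≈[ B ] ∑ℤ B (λ M → sg s ⊛ q ↑ κ w M s)
lambert-κ w F F≋ B s = ≈-trans (≋⇒≈ (F≋ s))
  (≈-trans (⊛-≈ (λ _ _ → ≡.refl) (Expansions.lambert-bilateral (q ↑ 1) (q ↑ 5) (oq↑ 1) (oq↑ 5) B s))
    (≋⇒≈ (≋-trans (≋-sym (∑ℤ-⊛ˡ B (sg s ⊛ q ↑ w s) (Expansions.ℓ (q ↑ 1) (q ↑ 5) (oq↑ 1) (oq↑ 5) s))) (∑ℤ-cong B exponents))))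
  where
  base : ∀ a → q ↑ a ⊛ L.Q ↑ s ≋ q ↑ (a + s * 6)
  base a = ≋-trans (⊛-cong ≋-refl (E.Q-power 1 5 s)) (≋-sym (↑-+ q a (s * 6)))
  exponents : ∀ M → sg s ⊛ q ↑ w s ⊛ Expansions.ℓ (q ↑ 1) (q ↑ 5) (oq↑ 1) (oq↑ 5) s M ≋ sg s ⊛ q ↑ κ w M s
  exponents (pos m) = ≋-trans (⊛-assoc _ _ _) (⊛-cong ≋-refl
    (≋-trans (⊛-cong ≋-refl (≋-trans (↑-cong m (base 1)) (≋-sym (↑-* q m (1 + s * 6)))))
             (≋-sym (↑-+ q (w s) (m * (1 + s * 6))))))
  exponents (neg m) = ≋-trans (⊛-assoc _ _ _) (⊛-cong ≋-refl
    (≋-trans (⊛-cong ≋-refl (≋-trans (↑-cong (suc m) (base 5)) (≋-sym (↑-* q (suc m) (5 + s * 6)))))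
             (≋-sym (↑-+ q (w s) (suc m * (5 + s * 6))))))

K₁-κ : ∀ B s → L.K₁ s ≈[ B ] ∑ℤ B (λ M → sg s ⊛ q ↑ κ w₁ M s)
K₁-κ = lambert-κ w₁ L.K₁ (λ s → ≋-trans (⊛-assoc _ _ _) (⊛-cong (⊛-cong ≋-refl (E.Q-power 1 5 (T s))) ≋-refl))

K₃-κ : ∀ B s → L.K₃ s ≈[ B ] ∑ℤ B (λ M → sg s ⊛ q ↑ κ w₃ M s)
K₃-κ = lambert-κ w₃ L.K₃ (λ s → ≋-trans
  (solve 5 (λ a g t D e → a :* (g :* t :* D :* e) := g :* (a :* t) :* (D :* e)) ≋-refl
    (L.Q ↑ (s * suc s)) (sg s) (L.Q ↑ T s) (𝟏 ⊝ L.Q ↑ suc (s + s)) (L.e s))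
  (⊛-cong (⊛-cong ≋-refl (≋-trans (⊛-cong (E.Q-power 1 5 (s * suc s)) (E.Q-power 1 5 (T s)))
                                  (≋-sym (↑-+ q (s * suc s * 6) (T s * 6))))) ≋-refl))

-- `V` is the reciprocal theta function in q; `W` is ψ(q⁶) f_6 A / q.
V W : S
V = lim (λ N → ∑ N L.K₁)
W = E₆.Θ.theta 1 3 ⊛ lim (λ N → ∑ N L.K₃)

halves : ∀ (E : ℤ → ℤ → ℤ) (w : ℕ → ℕ) (a : ℕ) →
  (∀ {M r} → Valid M r → pos (a + κ w M (index r)) ≡ E M r) →
  ∀ n B′ M → Σ< B′ (λ s → sgn s ℤ.* δ (pos (a + κ w M s)) n) ≡ half B′ M (λ r → δ (E M r) n)
halves E w a p n B′ (pos m) = Σ<-cong B′ (λ s _ → cong (λ z → sgn s ℤ.* δ z n) (p (pos-pos m s)))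
halves E w a p n B′ (neg m) = Σ<-cong B′ (λ s _ → cong (λ z → sgn s ℤ.* δ z n) (p (neg-neg m s)))

coeff-W : ∀ N B B′ → N < B → N < B′ →
  W N ≡ Σℤ B (λ x → Σℤ B (λ M → half B′ M (λ r → δ (E₁ x M r) N)))
coeff-W N B B′ N<B N<B′ = ≡.trans
  (coeff-formula (E₆.Θ.theta 1 3) L.K₃ w₃ 6 18 theta₆-ε L.Ord-K₃ K₃-κ N B B′ N<B N<B′)
  (Σℤ-cong B (λ x _ → Σℤ-cong B (λ M _ →
    halves (E₁ x) w₃ (ε 6 18 x) (λ v → ≡.sym (E₁-natural x v)) N B′ M)))

coeff-V : ∀ α β .{{_ : NonZero α}} .{{_ : NonZero β}} n B B′ → n < B → n < B′ →
  (E.Θ.theta α β ⊛ V) n ≡ Σℤ B (λ k → Σℤ B (λ m → half B′ m (λ r → δ (pos (ε α β k) ℤ.+ e₃ m r) n)))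
coeff-V α β n B B′ n<B n<B′ = ≡.trans
  (coeff-formula (E.Θ.theta α β) L.K₁ w₁ α β (theta-ε α β) L.Ord-K₁ K₁-κ n B B′ n<B n<B′)
  (Σℤ-cong B (λ k _ → Σℤ-cong B (λ m _ →
    halves (λ m r → pos (ε α β k) ℤ.+ e₃ m r) w₁ (ε α β k)
      (λ v → cong (λ z → pos (ε α β k) ℤ.+ z) (κ-poly 3 w₁ w₁-poly v)) n B′ m)))

section-W : ∀ α β .{{_ : NonZero α}} .{{_ : NonZero β}} c →
  (∀ n B B′ → 2 * (4 * n + c) + 2 ≤ B → n + B + B + 2 ≤ B′ →
    Σℤ B (λ x → Σℤ B (λ M → half B′ M (λ r → δ (E₁ x M r) (4 * n + c))))
      ≡ Σℤ B (λ k → Σℤ B (λ m → half B′ m (λ r → δ (pos (ε α β k) ℤ.+ e₃ m r) n)))) →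
  ∀ n → W (4 * n + c) ≡ (E.Θ.theta α β ⊛ V) n
section-W α β c lattice n = ≡.trans (coeff-W N B B′ N<B (ℕₚ.<-≤-trans N<B B≤B′))
  (≡.trans (lattice n B B′ ℕₚ.≤-refl ℕₚ.≤-refl)
    (≡.sym (coeff-V α β n B B′ (ℕₚ.≤-<-trans n≤N N<B) (ℕₚ.≤-<-trans n≤N (ℕₚ.<-≤-trans N<B B≤B′)))))
  where
  N = 4 * n + c
  -- The smallest boxes that the lattice identity admits.
  B = 2 * N + 2
  B′ = n + B + B + 2
  n≤N : n ≤ N
  n≤N = ℕₚ.≤-trans (ℕₚ.m≤n*m n 4) (ℕₚ.m≤m+n (4 * n) c)
  N<B : N < B
  N<B = ℕₚ.≤-trans (ℕₚ.≤-reflexive (ℕₚ.+-comm 1 N)) (ℕₚ.+-mono-≤ (ℕₚ.m≤m+n N (N + 0)) (s≤s (z≤n {1})))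
  B≤B′ : B ≤ B′
  B≤B′ = ℕₚ.≤-trans (ℕₚ.m≤n+m B (n + B)) (ℕₚ.m≤m+n (n + B + B) 2)

W-even : ∀ n → W (4 * n + 0) ≡ (E.Θ.theta 2 4 ⊛ V) n
W-even = section-W 2 4 0 lattice-even

W-odd : ∀ n → W (4 * n + 1) ≡ (E.Θ.theta 1 5 ⊛ V) n
W-odd = section-W 1 5 1 lattice-odd

-- Sections, and the substitution q ↦ q^k

sec : ℕ → ℕ → S → S
sec k i f n = f (k * n + i)

-- Dil k F H says H(q) = F(q^k), in the form in which it acts on sections.
Dil : ℕ → S → S → Set
Dil k F H = ∀ G i → i < k → sec k i (H ⊛ G) ≋ F ⊛ sec k i G

coeff-q↑⊛-< : ∀ a f n → n < a → (q ↑ a ⊛ f) n ≡ ℤ.0ℤ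
coeff-q↑⊛-< a f n n<a = ≡.trans
  (Ord-⊛ {a} {0} (Ord₁-↑ oq a) Ord-0 n (ℕₚ.≤-trans n<a (ℕₚ.m≤m+n a 0))) (coeff-𝟎 n)

coeff-q↑⊛-+ : ∀ a f n → (q ↑ a ⊛ f) (a + n) ≡ f n
coeff-q↑⊛-+ zero    f n = ⊛-identityˡ f n
coeff-q↑⊛-+ (suc a) f n = ≡.trans (⊛-assoc q (q ↑ a) f (suc (a + n)))
  (≡.trans (q⊛-suc (q ↑ a ⊛ f) (a + n)) (coeff-q↑⊛-+ a f n))

sec-≋ : ∀ k i {f g} → f ≋ g → sec k i f ≋ sec k i g
sec-≋ k i p n = p (k * n + i)

sec-⊕ : ∀ k i f g → sec k i (f ⊕ g) ≋ sec k i f ⊕ sec k i g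
sec-⊕ k i f g n = ≡.trans (coeff-⊕ f g (k * n + i)) (≡.sym (coeff-⊕ (sec k i f) (sec k i g) n))

sec-⊖ : ∀ k i f → sec k i (⊖ f) ≋ ⊖ sec k i f
sec-⊖ k i f n = ≡.trans (coeff-⊖ f (k * n + i)) (≡.sym (coeff-⊖ (sec k i f) n))

sec-con : ∀ k i c f → sec k i (con c ⊛ f) ≋ con c ⊛ sec k i f
sec-con k i c f n = ≡.trans (coeff-con-⊛ c f (k * n + i)) (≡.sym (coeff-con-⊛ c (sec k i f) n))

Dil-≋ : ∀ k {F F′ H H′} → F ≋ F′ → H ≋ H′ → Dil k F H → Dil k F′ H′
Dil-≋ k p r d G i i<k = ≋-trans (sec-≋ k i (⊛-cong (≋-sym r) ≋-refl))
                                (≋-trans (d G i i<k) (⊛-cong p ≋-refl))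

Dil-𝟏 : ∀ k → Dil k 𝟏 𝟏
Dil-𝟏 k G i i<k = ≋-trans (sec-≋ k i (⊛-identityˡ G)) (≋-sym (⊛-identityˡ _))

Dil-⊛ : ∀ k {F F′ H H′} → Dil k F H → Dil k F′ H′ → Dil k (F ⊛ F′) (H ⊛ H′)
Dil-⊛ k {F} {F′} {H} {H′} d d′ G i i<k = begin
  sec k i (H ⊛ H′ ⊛ G)      ≈⟨ sec-≋ k i (⊛-assoc H H′ G) ⟩
  sec k i (H ⊛ (H′ ⊛ G))    ≈⟨ d (H′ ⊛ G) i i<k ⟩
  F ⊛ sec k i (H′ ⊛ G)      ≈⟨ ⊛-cong ≋-refl (d′ G i i<k) ⟩
  F ⊛ (F′ ⊛ sec k i G)      ≈⟨ ≋-sym (⊛-assoc _ _ _) ⟩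
  F ⊛ F′ ⊛ sec k i G        ∎
  where open ≋-Reasoning

Dil-⊕ : ∀ k {F F′ H H′} → Dil k F H → Dil k F′ H′ → Dil k (F ⊕ F′) (H ⊕ H′)
Dil-⊕ k {F} {F′} {H} {H′} d d′ G i i<k = begin
  sec k i ((H ⊕ H′) ⊛ G)               ≈⟨ sec-≋ k i (⊛-distribʳ G H H′) ⟩
  sec k i (H ⊛ G ⊕ H′ ⊛ G)             ≈⟨ sec-⊕ k i (H ⊛ G) (H′ ⊛ G) ⟩
  sec k i (H ⊛ G) ⊕ sec k i (H′ ⊛ G)   ≈⟨ ⊕-cong (d G i i<k) (d′ G i i<k) ⟩
  F ⊛ sec k i G ⊕ F′ ⊛ sec k i G       ≈⟨ ≋-sym (⊛-distribʳ _ F F′) ⟩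
  (F ⊕ F′) ⊛ sec k i G                 ∎
  where open ≋-Reasoning

Dil-⊖ : ∀ k {F H} → Dil k F H → Dil k (⊖ F) (⊖ H)
Dil-⊖ k {F} {H} d G i i<k = begin
  sec k i (⊖ H ⊛ G)    ≈⟨ sec-≋ k i (solve 2 (λ h g → :- h :* g := :- (h :* g)) ≋-refl H G) ⟩
  sec k i (⊖ (H ⊛ G))  ≈⟨ sec-⊖ k i (H ⊛ G) ⟩
  ⊖ sec k i (H ⊛ G)    ≈⟨ ⊖-cong (d G i i<k) ⟩
  ⊖ (F ⊛ sec k i G)    ≈⟨ solve 2 (λ f g → :- (f :* g) := :- f :* g) ≋-refl F (sec k i G) ⟩
  ⊖ F ⊛ sec k i G      ∎
  where open ≋-Reasoning

Dil-↑ : ∀ k {F H} n → Dil k F H → Dil k (F ↑ n) (H ↑ n)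
Dil-↑ k zero    d = Dil-𝟏 k
Dil-↑ k (suc n) d = Dil-⊛ k d (Dil-↑ k n d)

Dil-q : ∀ k → Dil k q (q ↑ k)
Dil-q k G i i<k zero = ≡.trans (coeff-q↑⊛-< k G (k * 0 + i) (ℕₚ.≤-trans (s≤s (ℕₚ.≤-reflexive
  (cong (_+ i) (ℕₚ.*-zeroʳ k)))) i<k)) (≡.sym (q⊛-zero (sec k i G)))
Dil-q k G i i<k (suc n) = ≡.trans
  (≡.trans (cong (q ↑ k ⊛ G) (exponent k n i)) (coeff-q↑⊛-+ k G (k * n + i)))
  (≡.sym (q⊛-suc (sec k i G) n))
  where
  exponent : ∀ k n i → k * suc n + i ≡ k + (k * n + i)
  exponent = ℕ-Solver.solve-∀

Dil-lim : ∀ k .{{_ : NonZero k}} {F H : ℕ → S} → Stable F → Stable H →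
          (∀ N → Dil k (F N) (H N)) → Dil k (lim F) (lim H)
Dil-lim k {F} {H} sF sH d G i i<k n = begin
  (lim H ⊛ G) m          ≡⟨ ⊛-≈ {suc m} (lim-≈ sH ℕₚ.≤-refl) (λ _ _ → ≡.refl) m ℕₚ.≤-refl ⟩
  (H (suc m) ⊛ G) m      ≡⟨ d (suc m) G i i<k n ⟩
  (F (suc m) ⊛ sec k i G) n ≡⟨ ≡.sym (⊛-≈ {suc n} (lim-≈ sF (s≤s n≤m)) (λ _ _ → ≡.refl) n ℕₚ.≤-refl) ⟩
  (lim F ⊛ sec k i G) n  ∎
  where
  open ≡.≡-Reasoning
  m = k * n + i
  n≤m : n ≤ m
  n≤m = ℕₚ.≤-trans (ℕₚ.m≤n*m n k) (ℕₚ.m≤m+n (k * n) i)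

Dil-∏ : ∀ k N {F H : ℕ → S} → (∀ j → Dil k (F j) (H j)) → Dil k (∏ N F) (∏ N H)
Dil-∏ k zero    d = Dil-𝟏 k
Dil-∏ k (suc N) d = Dil-⊛ k (Dil-∏ k N d) (d N)

-- Stated for any pair of series related by the dilation, so that it also applies to -q and -q³.
Dil-η : ∀ k .{{_ : NonZero k}} a .{{_ : NonZero a}} y (oy : Ord 1 y) z (oz : Ord 1 z) →
        Dil k y z → Dil k (Eta.η y oy a) (Eta.η z oz a)
Dil-η k a y oy z oz d = Dil-lim k (∏-stable (Eta.pm-convergent y oy a a)) (∏-stable (Eta.pm-convergent z oz a a))
  (λ N → Dil-∏ k N (λ j → Dil-⊕ k (Dil-𝟏 k) (Dil-⊖ k (Dil-↑ k (a + j * a) d))))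

Dil-η-q : ∀ k .{{_ : NonZero k}} a .{{_ : NonZero a}} → Dil k (E.η a) (E.η (a * k))
Dil-η-q k a = Dil-≋ k ≋-refl (η-↑ q oq k (oq↑ k) a) (Dil-η k a q oq (q ↑ k) (oq↑ k) (Dil-q k))

-- Congruences modulo 4

infix 4 _≡₄_
_≡₄_ : S → S → Set
f ≡₄ g = Σ S λ h → f ≋ g ⊕ con (pos 4) ⊛ h

c2 c4 : ∀ {n} → ⊛-Solver.Polynomial n
c2 = ⊛-Solver.con (pos 2)
c4 = ⊛-Solver.con (pos 4)

≋⇒≡₄ : ∀ {f g} → f ≋ g → f ≡₄ g
≋⇒≡₄ {f} {g} p = 𝟎 , ≋-trans p (≋-sym (≋-trans (⊕-cong ≋-refl (⊛-zeroʳ _)) (⊕-identityʳ g)))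

≡₄-trans : ∀ {f g h} → f ≡₄ g → g ≡₄ h → f ≡₄ h
≡₄-trans {f} {g} {h} (a , p) (b , r) = b ⊕ a , ≋-trans p (≋-trans (⊕-cong r ≋-refl)
  (solve 3 (λ h a b → h :+ c4 :* b :+ c4 :* a := h :+ c4 :* (b :+ a)) ≋-refl h a b))

⊛-≡₄ : ∀ c {f g} → f ≡₄ g → c ⊛ f ≡₄ c ⊛ g
⊛-≡₄ c {f} {g} (a , p) = c ⊛ a , ≋-trans (⊛-cong ≋-refl p)
  (solve 3 (λ c g a → c :* (g :+ c4 :* a) := c :* g :+ c4 :* (c :* a)) ≋-refl c g a)

sec-≡₄ : ∀ k i {f g} → f ≡₄ g → sec k i f ≡₄ sec k i g
sec-≡₄ k i {f} {g} (a , p) = sec k i a , ≋-trans (sec-≋ k i p)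
  (≋-trans (sec-⊕ k i g (con (pos 4) ⊛ a)) (⊕-cong ≋-refl (sec-con k i (pos 4) a)))

≡₄-coeff : ∀ {f g} → f ≡₄ g → ∀ n → g n ≡ ℤ.0ℤ → Σ ℤ λ h → f n ≡ pos 4 ℤ.* h
≡₄-coeff {f} {g} (a , p) n gn≡0 = a n , ≡.trans (p n) (≡.trans (coeff-⊕ g (con (pos 4) ⊛ a) n)
  (≡.trans (cong₂ ℤ._+_ gn≡0 (coeff-con-⊛ (pos 4) a n)) (ℤₚ.+-identityˡ _)))

-- the theta series Σ (-1)^n y^{n²}, written as 1 + 2 s
module Phi (y : S) (oy : Ord 1 y) where

  module Y = EtaIdentities y oy
  open Y.φ⁻ using (Q; theta-term; Ord-theta-term; oQ)

  φ : S
  φ = Y.φ⁻.theta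

  s-term : ℕ → S
  s-term k = Q ↑ tri (suc k) ⊛ (⊖ y) ↑ suc k

  s : S
  s = lim (λ N → ∑ N s-term)

  Ord-s : ∀ k → Ord k (s-term k)
  Ord-s k = ≈-weaken (ℕₚ.n≤1+n k) (Ord-⊛ {0} Ord-0 (Ord₁-↑ (Ord-⊖ oy) (suc k)))

  φ≋ : φ ≋ 𝟏 ⊕ con (pos 2) ⊛ s
  φ≋ = ⊕-cong ≋-refl (≈⇒≋ λ N → ≈-trans (lim-≈ (∑-stable Ord-theta-term) (ℕₚ.≤-refl {N}))
    (≈-trans (≋⇒≈ (≋-trans (∑-cong N (λ k _ → solve 2 (λ t w → t :* (w :+ w) := c2 :* (t :* w)) ≋-refl
                (Q ↑ tri (suc k)) ((⊖ y) ↑ suc k)))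
              (∑-⊛ˡ N (con (pos 2)) s-term)))
      (⊛-≈ (λ _ _ → ≡.refl) (≈-sym (lim-≈ (∑-stable Ord-s) (ℕₚ.≤-refl {N}))))))

  φ² : φ ⊛ φ ≡₄ 𝟏
  φ² = s ⊕ s ⊛ s , ≋-trans (⊛-cong φ≋ φ≋)
    (solve 1 (λ s → (c1 :+ c2 :* s) :* (c1 :+ c2 :* s) := c1 :+ c4 :* (s :+ s :* s)) ≋-refl s)

  -- Since φ² ≡ 1 (mod 4), division by φ is multiplication by φ.
  invert-φ : ∀ {f g} → f ⊛ φ ≋ g → f ≡₄ g ⊛ φ
  invert-φ {f} {g} p = ≡₄-trans (≡₄-sym (≡₄-trans (⊛-≡₄ f φ²) (≋⇒≡₄ (⊛-identityʳ f))))
    (≋⇒≡₄ (≋-trans (≋-sym (⊛-assoc f φ φ)) (⊛-cong p ≋-refl)))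
    where
    ≡₄-sym : ∀ {f g} → f ≡₄ g → g ≡₄ f
    ≡₄-sym {f} {g} (a , p) = ⊖ a , ≋-trans
      (solve 2 (λ g a → g := g :+ c4 :* a :+ c4 :* (:- a)) ≋-refl g a) (⊕-cong (≋-sym p) ≋-refl)

-- The 3-section of Σ (-q)^{x²} Σ (-q)^{2k²-k}

oq⁻ : Ord 1 (⊖ q)
oq⁻ = Ord-⊖ oq

module N = EtaIdentities (⊖ q) oq⁻

χ : ℕ → ℕ → ℤ
χ a n = ((⊖ q) ↑ a) n

⊖-↑ : ∀ y n → (⊖ y) ↑ n ≋ sg n ⊛ y ↑ n
⊖-↑ y n = ≋-trans (↑-cong n (solve 1 (λ y → :- y := :- c1 :* y) ≋-refl y)) (↑-⊛ (⊖ 𝟏) y n)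

coeff-sg-q↑ : ∀ s a n → (sg s ⊛ q ↑ a) n ≡ sgn s ℤ.* δ (pos a) n
coeff-sg-q↑ s a n = ≡.trans (⊛-cong (sg-sgn s) ≋-refl n)
  (≡.trans (coeff-con-⊛ (sgn s) (q ↑ a) n) (cong (sgn s ℤ.*_) (coeff-q↑ a n)))

χ-δ : ∀ a n → χ a n ≡ sgn a ℤ.* δ (pos a) n
χ-δ a n = ≡.trans (⊖-↑ q a n) (coeff-sg-q↑ a a n)

χ-support : ∀ a n → χ a n ≢ ℤ.0ℤ → a ≡ n
χ-support a n nz = ℤₚ.+-injective (δ-support (pos a) n
  (λ e → nz (≡.trans (χ-δ a n) (≡.trans (cong (sgn a ℤ.*_) e) (ℤₚ.*-zeroʳ (sgn a))))))

sgn-3 : ∀ a → sgn (3 * a) ≡ sgn a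
sgn-3 zero    = ≡.refl
sgn-3 (suc a) = ≡.trans (cong sgn (exponent a)) (≡.trans (ℤₚ.neg-involutive _) (cong ℤ.-_ (sgn-3 a)))
  where
  exponent : ∀ a → 3 * suc a ≡ suc (suc (suc (3 * a)))
  exponent = ℕ-Solver.solve-∀

-- Multiplication by 3 preserves parity, hence the sign of a power of -q.
χ-3 : ∀ a n → χ (3 * a) (3 * n + 0) ≡ χ a n
χ-3 a n = ≡.trans (χ-δ (3 * a) (3 * n + 0)) (≡.trans
  (cong₂ ℤ._*_ (sgn-3 a) (δ-≡
    (λ p → cong pos (ℕₚ.*-cancelˡ-≡ a n 3 (≡.trans (ℤₚ.+-injective p) (ℕₚ.+-identityʳ (3 * n)))))
    (λ p → cong pos (≡.trans (cong (3 *_) (ℤₚ.+-injective p)) (≡.sym (ℕₚ.+-identityʳ (3 * n)))))))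
  (≡.sym (χ-δ a n)))

thetaᴺ-ε : ∀ α β .{{_ : NonZero α}} .{{_ : NonZero β}} B → N.Θ.theta α β ≈[ B ] ∑ℤ B (λ x → (⊖ q) ↑ ε α β x)
thetaᴺ-ε α β B = ≈-trans (Expansions.theta-bilateral ((⊖ q) ↑ α) ((⊖ q) ↑ β) (o α) (o β) B)
                         (≋⇒≈ (∑ℤ-cong B exponents))
  where
  o : ∀ a .{{_ : NonZero a}} → Ord 1 ((⊖ q) ↑ a)
  o (suc a) = ≈-weaken (s≤s z≤n) (Ord₁-↑ oq⁻ (suc a))
  exponents : ∀ x → Expansions.ϑ ((⊖ q) ↑ α) ((⊖ q) ↑ β) (o α) (o β) x ≋ (⊖ q) ↑ ε α β x
  exponents (pos k) = ≋-trans (⊛-cong (N.Q-power α β (tri k)) (≋-sym (↑-* (⊖ q) k α)))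
                              (≋-sym (↑-+ (⊖ q) (tri k * (α + β)) (k * α)))
  exponents (neg k) = ≋-trans (⊛-cong (N.Q-power α β (tri (suc k))) (≋-sym (↑-* (⊖ q) (suc k) β)))
                              (≋-sym (↑-+ (⊖ q) (tri (suc k) * (α + β)) (suc k * β)))

coeff-theta² : ∀ α β γ ζ .{{_ : NonZero α}} .{{_ : NonZero β}} .{{_ : NonZero γ}} .{{_ : NonZero ζ}} n B → n < B →
  (N.Θ.theta α β ⊛ N.Θ.theta γ ζ) n ≡ Σℤ B (λ x → Σℤ B (λ k → χ (ε α β x + ε γ ζ k) n))
coeff-theta² α β γ ζ n B n<B = begin
  (N.Θ.theta α β ⊛ N.Θ.theta γ ζ) n
    ≡⟨ ⊛-≈ (≈-weaken n<B (thetaᴺ-ε α β B)) (≈-weaken n<B (thetaᴺ-ε γ ζ B)) n ℕₚ.≤-refl ⟩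
  (∑ℤ B (λ x → (⊖ q) ↑ ε α β x) ⊛ R) n
    ≡⟨ ≋-trans (⊛-comm _ R) (≋-sym (∑ℤ-⊛ˡ B R (λ x → (⊖ q) ↑ ε α β x))) n ⟩
  ∑ℤ B (λ x → R ⊛ (⊖ q) ↑ ε α β x) n
    ≡⟨ coeff-∑ℤ B (λ x → R ⊛ (⊖ q) ↑ ε α β x) n ⟩
  Σℤ B (λ x → (R ⊛ (⊖ q) ↑ ε α β x) n)
    ≡⟨ Σℤ-cong B (λ x _ → ≡.trans
         (≋-trans (≋-trans (⊛-comm R _) (≋-sym (∑ℤ-⊛ˡ B ((⊖ q) ↑ ε α β x) (λ k → (⊖ q) ↑ ε γ ζ k))))
                  (∑ℤ-cong B (λ k → ≋-sym (↑-+ (⊖ q) (ε α β x) (ε γ ζ k)))) n)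
         (coeff-∑ℤ B (λ k → (⊖ q) ↑ (ε α β x + ε γ ζ k)) n)) ⟩
  Σℤ B (λ x → Σℤ B (λ k → χ (ε α β x + ε γ ζ k) n)) ∎
  where
  open ≡.≡-Reasoning
  R = ∑ℤ B (λ k → (⊖ q) ↑ ε γ ζ k)

ε-≥ : ∀ α β .{{_ : NonZero α}} .{{_ : NonZero β}} x → ℤ.∣ x ∣ ≤ ε α β x
ε-≥ α β (pos k) = ℕₚ.≤-trans (ℕₚ.m≤m*n k α) (ℕₚ.m≤n+m (k * α) (tri k * (α + β)))
ε-≥ α β (neg k) = ℕₚ.≤-trans (ℕₚ.m≤m*n (suc k) β) (ℕₚ.m≤n+m (suc k * β) (tri (suc k) * (α + β)))

Σℤ-witness : ∀ B {f} → Σℤ B f ≢ ℤ.0ℤ → Σ ℤ λ x → f x ≢ ℤ.0ℤ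
Σℤ-witness B {f} nz with Σ<-witness B nz
... | k , _ , p with f (pos k) ℤ.≟ ℤ.0ℤ
...   | no  fk≢0 = pos k , fk≢0
...   | yes fk≡0 = neg k , λ e → p (cong₂ ℤ._+_ fk≡0 e)

data Mod3 (x : ℤ) : Set where
  r0 : ∀ i → x ≡ pos 3 ℤ.* i → Mod3 x
  r1 : ∀ i → x ≡ pos 3 ℤ.* i ℤ.+ ℤ.1ℤ → Mod3 x
  r2 : ∀ i → x ≡ pos 3 ℤ.* i ℤ.+ pos 2 → Mod3 x

mod3-suc : ∀ {x} → Mod3 x → Mod3 (ℤ.1ℤ ℤ.+ x)
mod3-suc (r0 i p) = r1 i (≡.trans (cong (λ z → ℤ.1ℤ ℤ.+ z) p) (ℤₚ.+-comm ℤ.1ℤ (pos 3 ℤ.* i)))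
mod3-suc (r1 i p) = r2 i (≡.trans (cong (λ z → ℤ.1ℤ ℤ.+ z) p) (lemma i))
  where
  lemma : ∀ i → ℤ.1ℤ ℤ.+ (pos 3 ℤ.* i ℤ.+ ℤ.1ℤ) ≡ pos 3 ℤ.* i ℤ.+ pos 2
  lemma = solve-∀
mod3-suc (r2 i p) = r0 (i ℤ.+ ℤ.1ℤ) (≡.trans (cong (λ z → ℤ.1ℤ ℤ.+ z) p) (lemma i))
  where
  lemma : ∀ i → ℤ.1ℤ ℤ.+ (pos 3 ℤ.* i ℤ.+ pos 2) ≡ pos 3 ℤ.* (i ℤ.+ ℤ.1ℤ)
  lemma = solve-∀

mod3-neg : ∀ {x} → Mod3 x → Mod3 (ℤ.- x)
mod3-neg (r0 i p) = r0 (ℤ.- i) (≡.trans (cong ℤ.-_ p) (lemma i))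
  where
  lemma : ∀ i → ℤ.- (pos 3 ℤ.* i) ≡ pos 3 ℤ.* (ℤ.- i)
  lemma = solve-∀
mod3-neg (r1 i p) = r2 (ℤ.- i ℤ.- ℤ.1ℤ) (≡.trans (cong ℤ.-_ p) (lemma i))
  where
  lemma : ∀ i → ℤ.- (pos 3 ℤ.* i ℤ.+ ℤ.1ℤ) ≡ pos 3 ℤ.* (ℤ.- i ℤ.- ℤ.1ℤ) ℤ.+ pos 2
  lemma = solve-∀
mod3-neg (r2 i p) = r1 (ℤ.- i ℤ.- ℤ.1ℤ) (≡.trans (cong ℤ.-_ p) (lemma i))
  where
  lemma : ∀ i → ℤ.- (pos 3 ℤ.* i ℤ.+ pos 2) ≡ pos 3 ℤ.* (ℤ.- i ℤ.- ℤ.1ℤ) ℤ.+ ℤ.1ℤ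
  lemma = solve-∀

mod3 : ∀ x → Mod3 x
mod3 (pos zero)    = r0 ℤ.0ℤ ≡.refl
mod3 (pos (suc n)) = mod3-suc (mod3 (pos n))
mod3 (neg n)       = mod3-neg (mod3⁺ (suc n))
  where
  mod3⁺ : ∀ n → Mod3 (pos n)
  mod3⁺ zero    = r0 ℤ.0ℤ ≡.refl
  mod3⁺ (suc n) = mod3-suc (mod3⁺ n)

3a+1≢3b : ∀ a b → pos 3 ℤ.* a ℤ.+ ℤ.1ℤ ≢ pos 3 ℤ.* b
3a+1≢3b a b e = no-third ℤ.∣ b ℤ.- a ∣ (≡.trans (≡.sym (ℤₚ.abs-* (pos 3) (b ℤ.- a)))
  (cong ℤ.∣_∣ (≡.trans (lemma₁ a b) (≡.trans (cong (ℤ._- pos 3 ℤ.* a) (≡.sym e)) (lemma₂ a)))))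
  where
  lemma₁ : ∀ a b → pos 3 ℤ.* (b ℤ.- a) ≡ pos 3 ℤ.* b ℤ.- pos 3 ℤ.* a
  lemma₁ = solve-∀
  lemma₂ : ∀ a → pos 3 ℤ.* a ℤ.+ ℤ.1ℤ ℤ.- pos 3 ℤ.* a ≡ ℤ.1ℤ
  lemma₂ = solve-∀
  no-third : ∀ n → 3 * n ≢ 1
  no-third zero ()
  no-third (suc n) e = ℕₚ.m+1+n≢0 n (ℕₚ.suc-injective e)

3a+2≢3b : ∀ a b → pos 3 ℤ.* a ℤ.+ pos 2 ≢ pos 3 ℤ.* b
3a+2≢3b a b e = 3a+1≢3b (ℤ.- a ℤ.- ℤ.1ℤ) (ℤ.- b)
  (≡.trans (lemma₁ a) (≡.trans (cong ℤ.-_ e) (lemma₂ b)))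
  where
  lemma₁ : ∀ a → pos 3 ℤ.* (ℤ.- a ℤ.- ℤ.1ℤ) ℤ.+ ℤ.1ℤ ≡ ℤ.- (pos 3 ℤ.* a ℤ.+ pos 2)
  lemma₁ = solve-∀
  lemma₂ : ∀ b → ℤ.- (pos 3 ℤ.* b) ≡ pos 3 ℤ.* (ℤ.- b)
  lemma₂ = solve-∀

ε-double : ∀ α β x → pos (ε α β x) ℤ.+ pos (ε α β x)
                     ≡ (pos α ℤ.+ pos β) ℤ.* (x ℤ.* x ℤ.- x) ℤ.+ pos 2 ℤ.* (pos α ℤ.* x)
ε-double α β (pos k) = ≡.trans
  (cong (λ z → z ℤ.+ z) (cong₂ ℤ._+_ (ℤₚ.pos-* (tri k) (α + β)) (ℤₚ.pos-* k α)))
  (≡.trans (lemma (pos (tri k)) (pos α) (pos β) (pos k))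
    (cong (λ z → (pos α ℤ.+ pos β) ℤ.* z ℤ.+ pos 2 ℤ.* (pos α ℤ.* pos k)) (tri-poly k)))
  where
  lemma : ∀ t a b k → (t ℤ.* (a ℤ.+ b) ℤ.+ k ℤ.* a) ℤ.+ (t ℤ.* (a ℤ.+ b) ℤ.+ k ℤ.* a)
            ≡ (a ℤ.+ b) ℤ.* (t ℤ.+ t) ℤ.+ pos 2 ℤ.* (a ℤ.* k)
  lemma = solve-∀
ε-double α β (neg k) = ≡.trans
  (cong (λ z → z ℤ.+ z) (cong₂ ℤ._+_ (ℤₚ.pos-* (tri (suc k)) (α + β)) (ℤₚ.pos-* (suc k) β)))
  (≡.trans (lemma₁ (pos (tri (suc k))) (pos α) (pos β) (pos (suc k)))
    (≡.trans (cong (λ z → (pos α ℤ.+ pos β) ℤ.* z ℤ.+ pos 2 ℤ.* (pos (suc k) ℤ.* pos β)) (tri-poly (suc k)))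
      (lemma₂ (pos α) (pos β) (pos (suc k)))))
  where
  lemma₁ : ∀ t a b k → (t ℤ.* (a ℤ.+ b) ℤ.+ k ℤ.* b) ℤ.+ (t ℤ.* (a ℤ.+ b) ℤ.+ k ℤ.* b)
             ≡ (a ℤ.+ b) ℤ.* (t ℤ.+ t) ℤ.+ pos 2 ℤ.* (k ℤ.* b)
  lemma₁ = solve-∀
  lemma₂ : ∀ a b k → (a ℤ.+ b) ℤ.* (k ℤ.* k ℤ.- k) ℤ.+ pos 2 ℤ.* (k ℤ.* b)
             ≡ (a ℤ.+ b) ℤ.* ((ℤ.- k) ℤ.* (ℤ.- k) ℤ.- (ℤ.- k)) ℤ.+ pos 2 ℤ.* (a ℤ.* (ℤ.- k))
  lemma₂ = solve-∀

ε-11 : ∀ x → pos (ε 1 1 x) ≡ x ℤ.* x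
ε-11 x = ≡.trans (ε-poly 1 1 1 ≡.refl x) (lemma x)
  where
  lemma : ∀ x → ℤ.1ℤ ℤ.* (x ℤ.* x ℤ.- x) ℤ.+ ℤ.1ℤ ℤ.* x ≡ x ℤ.* x
  lemma = solve-∀

ε-13 : ∀ k → pos (ε 1 3 k) ≡ pos 2 ℤ.* (k ℤ.* k) ℤ.- k
ε-13 k = ≡.trans (ε-poly 1 3 2 ≡.refl k) (lemma k)
  where
  lemma : ∀ k → pos 2 ℤ.* (k ℤ.* k ℤ.- k) ℤ.+ ℤ.1ℤ ℤ.* k ≡ pos 2 ℤ.* (k ℤ.* k) ℤ.- k
  lemma = solve-∀

ε-33 : ∀ y → ε 1 1 (pos 3 ℤ.* y) ≡ 3 * ε 3 3 y
ε-33 y = ℤₚ.+-injective (≡.trans (ε-11 (pos 3 ℤ.* y)) (≡.trans (lemma y)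
  (≡.trans (cong (pos 3 ℤ.*_) (≡.sym (ε-poly 3 3 3 ≡.refl y))) (≡.sym (ℤₚ.pos-* 3 (ε 3 3 y))))))
  where
  lemma : ∀ y → (pos 3 ℤ.* y) ℤ.* (pos 3 ℤ.* y) ≡ pos 3 ℤ.* (pos 3 ℤ.* (y ℤ.* y ℤ.- y) ℤ.+ pos 3 ℤ.* y)
  lemma = solve-∀

-- 2k² - k is divisible by 3 exactly for k = 3i and k = -3i - 1; these are
-- parametrised by j = 2i and j = 2i + 1.
ι₃ : ∀ j → Parity j → ℤ
ι₃ j (i , inj₁ _ , _) = pos 3 ℤ.* i
ι₃ j (i , inj₂ _ , _) = ℤ.- (pos 3 ℤ.* i) ℤ.- ℤ.1ℤ

ε-12 : ∀ j (P : Parity j) → ε 1 3 (ι₃ j P) ≡ 3 * ε 1 2 j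
ε-12 j P = ℤₚ.+-injective (ℤₚ.*-cancelˡ-≡ (pos 2) _ _ (≡.trans (cong (pos 2 ℤ.*_) (ε-13 (ι₃ j P)))
  (≡.trans (doubled j P) (≡.trans (cong (pos 3 ℤ.*_) (≡.sym (ε-double 1 2 j)))
    (≡.trans (lemma (pos (ε 1 2 j))) (cong (pos 2 ℤ.*_) (≡.sym (ℤₚ.pos-* 3 (ε 1 2 j)))))))))
  where
  lemma : ∀ e → pos 3 ℤ.* (e ℤ.+ e) ≡ pos 2 ℤ.* (pos 3 ℤ.* e)
  lemma = solve-∀
  doubled : ∀ j (P : Parity j) → pos 2 ℤ.* (pos 2 ℤ.* (ι₃ j P ℤ.* ι₃ j P) ℤ.- ι₃ j P)
              ≡ pos 3 ℤ.* (pos 3 ℤ.* (j ℤ.* j ℤ.- j) ℤ.+ pos 2 ℤ.* (ℤ.1ℤ ℤ.* j))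
  doubled _ (i , inj₁ ≡.refl , _) = poly i
    where
    poly : ∀ i → pos 2 ℤ.* (pos 2 ℤ.* ((pos 3 ℤ.* i) ℤ.* (pos 3 ℤ.* i)) ℤ.- pos 3 ℤ.* i)
             ≡ pos 3 ℤ.* (pos 3 ℤ.* ((pos 2 ℤ.* i) ℤ.* (pos 2 ℤ.* i) ℤ.- pos 2 ℤ.* i) ℤ.+ pos 2 ℤ.* (ℤ.1ℤ ℤ.* (pos 2 ℤ.* i)))
    poly = solve-∀
  doubled _ (i , inj₂ ≡.refl , _) = poly i
    where
    poly : ∀ i → pos 2 ℤ.* (pos 2 ℤ.* ((ℤ.- (pos 3 ℤ.* i) ℤ.- ℤ.1ℤ) ℤ.* (ℤ.- (pos 3 ℤ.* i) ℤ.- ℤ.1ℤ)) ℤ.- (ℤ.- (pos 3 ℤ.* i) ℤ.- ℤ.1ℤ))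
             ≡ pos 3 ℤ.* (pos 3 ℤ.* ((pos 2 ℤ.* i ℤ.+ ℤ.1ℤ) ℤ.* (pos 2 ℤ.* i ℤ.+ ℤ.1ℤ) ℤ.- (pos 2 ℤ.* i ℤ.+ ℤ.1ℤ)) ℤ.+ pos 2 ℤ.* (ℤ.1ℤ ℤ.* (pos 2 ℤ.* i ℤ.+ ℤ.1ℤ)))
    poly = solve-∀

ι₃-even : ∀ i (P : Parity (pos 2 ℤ.* i)) → ι₃ (pos 2 ℤ.* i) P ≡ pos 3 ℤ.* i
ι₃-even i (t , inj₁ e , _) = cong (pos 3 ℤ.*_) (≡.sym (ℤₚ.*-cancelˡ-≡ (pos 2) i t e))
ι₃-even i (t , inj₂ e , _) = contradiction (≡.sym e) (odd≢even t i)

ι₃-odd : ∀ i (P : Parity (pos 2 ℤ.* i ℤ.+ ℤ.1ℤ)) → ι₃ (pos 2 ℤ.* i ℤ.+ ℤ.1ℤ) P ≡ ℤ.- (pos 3 ℤ.* i) ℤ.- ℤ.1ℤ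
ι₃-odd i (t , inj₁ e , _) = contradiction e (odd≢even i t)
ι₃-odd i (t , inj₂ e , _) = cong (λ z → ℤ.- (pos 3 ℤ.* z) ℤ.- ℤ.1ℤ)
  (≡.sym (ℤₚ.*-cancelˡ-≡ (pos 2) i t (ℤ-+-cancelʳ ℤ.1ℤ _ _ e)))

ι₃-inj : ∀ j l (P : Parity j) (R : Parity l) → ι₃ j P ≡ ι₃ l R → j ≡ l
ι₃-inj _ _ (i , inj₁ ≡.refl , _) (t , inj₁ ≡.refl , _) e =
  cong (pos 2 ℤ.*_) (ℤₚ.*-cancelˡ-≡ (pos 3) i t e)
ι₃-inj _ _ (i , inj₂ ≡.refl , _) (t , inj₂ ≡.refl , _) e =
  cong (λ z → pos 2 ℤ.* z ℤ.+ ℤ.1ℤ) (ℤₚ.*-cancelˡ-≡ (pos 3) i t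
    (ℤₚ.neg-injective (ℤ-+-cancelʳ (ℤ.- ℤ.1ℤ) _ _ e)))
ι₃-inj _ _ (i , inj₁ ≡.refl , _) (t , inj₂ ≡.refl , _) e = contradiction
  (≡.trans (cong (ℤ._+ ℤ.1ℤ) e) (lemma t)) (3a+1≢3b i (ℤ.- t))
  where
  lemma : ∀ t → ℤ.- (pos 3 ℤ.* t) ℤ.- ℤ.1ℤ ℤ.+ ℤ.1ℤ ≡ pos 3 ℤ.* (ℤ.- t)
  lemma = solve-∀
ι₃-inj _ _ (i , inj₂ ≡.refl , _) (t , inj₁ ≡.refl , _) e = contradiction
  (≡.trans (cong (ℤ._+ ℤ.1ℤ) (≡.sym e)) (lemma i)) (3a+1≢3b t (ℤ.- i))
  where
  lemma : ∀ t → ℤ.- (pos 3 ℤ.* t) ℤ.- ℤ.1ℤ ℤ.+ ℤ.1ℤ ≡ pos 3 ℤ.* (ℤ.- t)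
  lemma = solve-∀

-- Modulo 3, x² takes the values 0, 1, 1 and 2k² - k the values 0, 1, 0, so the sum is divisible by
-- 3 only if both parts are. Thus x = 3y gives φ(-q³), and the admissible k give f(-q, q²).
theta-3-section : sec 3 0 (N.Θ.theta 1 1 ⊛ N.Θ.theta 1 3) ≋ N.Θ.theta 3 3 ⊛ N.Θ.theta 1 2
theta-3-section n = begin
  (N.Θ.theta 1 1 ⊛ N.Θ.theta 1 3) (3 * n + 0)
    ≡⟨ coeff-theta² 1 1 1 3 (3 * n + 0) B ℕₚ.≤-refl ⟩
  Σℤ B (λ x → Σℤ B (λ k → χ (ε 1 1 x + ε 1 3 k) (3 * n + 0)))
    ≡⟨ reindex B (λ x → Σℤ B (λ k → χ (ε 1 1 x + ε 1 3 k) (3 * n + 0))) (pos 3 ℤ.*_)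
         (λ x nz → x-bound x (Σℤ-witness B nz)) (λ x nz → x-onto x (Σℤ-witness B nz))
         (λ k l e → ℤₚ.*-cancelˡ-≡ (pos 3) k l e) ⟩
  Σℤ B (λ y → Σℤ B (λ k → χ (ε 1 1 (pos 3 ℤ.* y) + ε 1 3 k) (3 * n + 0)))
    ≡⟨ Σℤ-cong B (λ y _ → reindex B (λ k → χ (ε 1 1 (pos 3 ℤ.* y) + ε 1 3 k) (3 * n + 0)) (λ j → ι₃ j (parity j))
         (λ k nz → k-bound (pos 3 ℤ.* y) k (χ-support _ _ nz)) (λ k nz → k-onto y k (χ-support _ _ nz))
         (λ j l → ι₃-inj j l (parity j) (parity l))) ⟩
  Σℤ B (λ y → Σℤ B (λ j → χ (ε 1 1 (pos 3 ℤ.* y) + ε 1 3 (ι₃ j (parity j))) (3 * n + 0)))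
    ≡⟨ Σℤ-cong B (λ y _ → Σℤ-cong B (λ j _ → ≡.trans
         (cong (λ a → χ a (3 * n + 0)) (≡.trans (cong₂ _+_ (ε-33 y) (ε-12 j (parity j)))
                                                (≡.sym (ℕₚ.*-distribˡ-+ 3 (ε 3 3 y) (ε 1 2 j)))))
         (χ-3 (ε 3 3 y + ε 1 2 j) n))) ⟩
  Σℤ B (λ y → Σℤ B (λ j → χ (ε 3 3 y + ε 1 2 j) n))
    ≡⟨ ≡.sym (coeff-theta² 3 3 1 2 n B (s≤s (ℕₚ.≤-trans (ℕₚ.m≤n*m n 3) (ℕₚ.m≤m+n (3 * n) 0)))) ⟩
  (N.Θ.theta 3 3 ⊛ N.Θ.theta 1 2) n ∎
  where
  open ≡.≡-Reasoning
  B = suc (3 * n + 0)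
  polynomial : ∀ x k → ε 1 1 x + ε 1 3 k ≡ 3 * n + 0 → x ℤ.* x ℤ.+ (pos 2 ℤ.* (k ℤ.* k) ℤ.- k) ≡ pos 3 ℤ.* pos n
  polynomial x k e = ≡.trans (≡.sym (cong₂ ℤ._+_ (ε-11 x) (ε-13 k)))
    (≡.trans (cong pos (≡.trans e (ℕₚ.+-identityʳ (3 * n)))) (ℤₚ.pos-* 3 n))
  k-bound : ∀ x k → ε 1 1 x + ε 1 3 k ≡ 3 * n + 0 → ℤ.∣ k ∣ < B
  k-bound x k e = s≤s (ℕₚ.≤-trans (ε-≥ 1 3 k) (ℕₚ.≤-trans (ℕₚ.m≤n+m (ε 1 3 k) (ε 1 1 x)) (ℕₚ.≤-reflexive e)))
  x-bound : ∀ x → (Σ ℤ λ k → χ (ε 1 1 x + ε 1 3 k) (3 * n + 0) ≢ ℤ.0ℤ) → ℤ.∣ x ∣ < B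
  x-bound x (k , nz) = s≤s (ℕₚ.≤-trans (ε-≥ 1 1 x) (ℕₚ.≤-trans (ℕₚ.m≤m+n (ε 1 1 x) (ε 1 3 k))
    (ℕₚ.≤-reflexive (χ-support _ _ nz))))
  x-onto : ∀ x → (Σ ℤ λ k → χ (ε 1 1 x + ε 1 3 k) (3 * n + 0) ≢ ℤ.0ℤ) → Σ ℤ λ y → pos 3 ℤ.* y ≡ x × ℤ.∣ y ∣ < B
  x-onto x (k , nz) = cases (mod3 x) (mod3 k) (polynomial x k (χ-support _ _ nz))
    where
    cases : Mod3 x → Mod3 k → x ℤ.* x ℤ.+ (pos 2 ℤ.* (k ℤ.* k) ℤ.- k) ≡ pos 3 ℤ.* pos n →
            Σ ℤ λ y → pos 3 ℤ.* y ≡ x × ℤ.∣ y ∣ < B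
    cases (r0 y p) _ _ = y , ≡.sym p , ℕₚ.≤-<-trans
      (ℕₚ.≤-trans (ℕₚ.m≤n*m ℤ.∣ y ∣ 3) (ℕₚ.≤-reflexive (≡.trans (≡.sym (ℤₚ.abs-* (pos 3) y)) (cong ℤ.∣_∣ (≡.sym p)))))
      (x-bound x (k , nz))
    cases (r1 a ≡.refl) (r0 b ≡.refl) e = contradiction (≡.trans (poly a b) e) (3a+1≢3b X (pos n))
      where
      X = ((pos 3 ℤ.* (a ℤ.* a) ℤ.+ pos 2 ℤ.* a) ℤ.+ (pos 6 ℤ.* (b ℤ.* b) ℤ.- b))
      poly : ∀ a b → pos 3 ℤ.* ((pos 3 ℤ.* (a ℤ.* a) ℤ.+ pos 2 ℤ.* a) ℤ.+ (pos 6 ℤ.* (b ℤ.* b) ℤ.- b)) ℤ.+ ℤ.1ℤ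
               ≡ (pos 3 ℤ.* a ℤ.+ ℤ.1ℤ) ℤ.* (pos 3 ℤ.* a ℤ.+ ℤ.1ℤ) ℤ.+ (pos 2 ℤ.* ((pos 3 ℤ.* b) ℤ.* (pos 3 ℤ.* b)) ℤ.- (pos 3 ℤ.* b))
      poly = solve-∀
    cases (r1 a ≡.refl) (r1 b ≡.refl) e = contradiction (≡.trans (poly a b) e) (3a+2≢3b X (pos n))
      where
      X = ((pos 3 ℤ.* (a ℤ.* a) ℤ.+ pos 2 ℤ.* a) ℤ.+ (pos 6 ℤ.* (b ℤ.* b) ℤ.+ pos 3 ℤ.* b))
      poly : ∀ a b → pos 3 ℤ.* ((pos 3 ℤ.* (a ℤ.* a) ℤ.+ pos 2 ℤ.* a) ℤ.+ (pos 6 ℤ.* (b ℤ.* b) ℤ.+ pos 3 ℤ.* b)) ℤ.+ pos 2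
               ≡ (pos 3 ℤ.* a ℤ.+ ℤ.1ℤ) ℤ.* (pos 3 ℤ.* a ℤ.+ ℤ.1ℤ) ℤ.+ (pos 2 ℤ.* ((pos 3 ℤ.* b ℤ.+ ℤ.1ℤ) ℤ.* (pos 3 ℤ.* b ℤ.+ ℤ.1ℤ)) ℤ.- (pos 3 ℤ.* b ℤ.+ ℤ.1ℤ))
      poly = solve-∀
    cases (r1 a ≡.refl) (r2 b ≡.refl) e = contradiction (≡.trans (poly a b) e) (3a+1≢3b X (pos n))
      where
      X = ((pos 3 ℤ.* (a ℤ.* a) ℤ.+ pos 2 ℤ.* a) ℤ.+ (pos 6 ℤ.* (b ℤ.* b) ℤ.+ pos 7 ℤ.* b ℤ.+ pos 2))
      poly : ∀ a b → pos 3 ℤ.* ((pos 3 ℤ.* (a ℤ.* a) ℤ.+ pos 2 ℤ.* a) ℤ.+ (pos 6 ℤ.* (b ℤ.* b) ℤ.+ pos 7 ℤ.* b ℤ.+ pos 2)) ℤ.+ ℤ.1ℤ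
               ≡ (pos 3 ℤ.* a ℤ.+ ℤ.1ℤ) ℤ.* (pos 3 ℤ.* a ℤ.+ ℤ.1ℤ) ℤ.+ (pos 2 ℤ.* ((pos 3 ℤ.* b ℤ.+ pos 2) ℤ.* (pos 3 ℤ.* b ℤ.+ pos 2)) ℤ.- (pos 3 ℤ.* b ℤ.+ pos 2))
      poly = solve-∀
    cases (r2 a ≡.refl) (r0 b ≡.refl) e = contradiction (≡.trans (poly a b) e) (3a+1≢3b X (pos n))
      where
      X = ((pos 3 ℤ.* (a ℤ.* a) ℤ.+ pos 4 ℤ.* a ℤ.+ ℤ.1ℤ) ℤ.+ (pos 6 ℤ.* (b ℤ.* b) ℤ.- b))
      poly : ∀ a b → pos 3 ℤ.* ((pos 3 ℤ.* (a ℤ.* a) ℤ.+ pos 4 ℤ.* a ℤ.+ ℤ.1ℤ) ℤ.+ (pos 6 ℤ.* (b ℤ.* b) ℤ.- b)) ℤ.+ ℤ.1ℤ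
               ≡ (pos 3 ℤ.* a ℤ.+ pos 2) ℤ.* (pos 3 ℤ.* a ℤ.+ pos 2) ℤ.+ (pos 2 ℤ.* ((pos 3 ℤ.* b) ℤ.* (pos 3 ℤ.* b)) ℤ.- (pos 3 ℤ.* b))
      poly = solve-∀
    cases (r2 a ≡.refl) (r1 b ≡.refl) e = contradiction (≡.trans (poly a b) e) (3a+2≢3b X (pos n))
      where
      X = ((pos 3 ℤ.* (a ℤ.* a) ℤ.+ pos 4 ℤ.* a ℤ.+ ℤ.1ℤ) ℤ.+ (pos 6 ℤ.* (b ℤ.* b) ℤ.+ pos 3 ℤ.* b))
      poly : ∀ a b → pos 3 ℤ.* ((pos 3 ℤ.* (a ℤ.* a) ℤ.+ pos 4 ℤ.* a ℤ.+ ℤ.1ℤ) ℤ.+ (pos 6 ℤ.* (b ℤ.* b) ℤ.+ pos 3 ℤ.* b)) ℤ.+ pos 2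
               ≡ (pos 3 ℤ.* a ℤ.+ pos 2) ℤ.* (pos 3 ℤ.* a ℤ.+ pos 2) ℤ.+ (pos 2 ℤ.* ((pos 3 ℤ.* b ℤ.+ ℤ.1ℤ) ℤ.* (pos 3 ℤ.* b ℤ.+ ℤ.1ℤ)) ℤ.- (pos 3 ℤ.* b ℤ.+ ℤ.1ℤ))
      poly = solve-∀
    cases (r2 a ≡.refl) (r2 b ≡.refl) e = contradiction (≡.trans (poly a b) e) (3a+1≢3b X (pos n))
      where
      X = ((pos 3 ℤ.* (a ℤ.* a) ℤ.+ pos 4 ℤ.* a ℤ.+ ℤ.1ℤ) ℤ.+ (pos 6 ℤ.* (b ℤ.* b) ℤ.+ pos 7 ℤ.* b ℤ.+ pos 2))
      poly : ∀ a b → pos 3 ℤ.* ((pos 3 ℤ.* (a ℤ.* a) ℤ.+ pos 4 ℤ.* a ℤ.+ ℤ.1ℤ) ℤ.+ (pos 6 ℤ.* (b ℤ.* b) ℤ.+ pos 7 ℤ.* b ℤ.+ pos 2)) ℤ.+ ℤ.1ℤ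
               ≡ (pos 3 ℤ.* a ℤ.+ pos 2) ℤ.* (pos 3 ℤ.* a ℤ.+ pos 2) ℤ.+ (pos 2 ℤ.* ((pos 3 ℤ.* b ℤ.+ pos 2) ℤ.* (pos 3 ℤ.* b ℤ.+ pos 2)) ℤ.- (pos 3 ℤ.* b ℤ.+ pos 2))
      poly = solve-∀
  -- The two branches of `ι₃` satisfy 3j = 2k and 3j = 1 - 2k, so |j| does not leave the box of k.
  third : ∀ j k → pos 3 ℤ.* j ≡ pos 2 ℤ.* k ⊎ pos 3 ℤ.* j ≡ ℤ.- (pos 2 ℤ.* k) ℤ.+ ℤ.1ℤ → ℤ.∣ k ∣ < B → ℤ.∣ j ∣ < B
  third j k p k<B = ℕₚ.*-cancelˡ-< 3 ℤ.∣ j ∣ B (ℕₚ.≤-<-trans (bound p)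
    (ℕₚ.≤-trans (ℕₚ.≤-reflexive (arith₁ ℤ.∣ k ∣)) (ℕₚ.≤-trans (ℕₚ.*-monoʳ-≤ 2 k<B) (ℕₚ.*-monoˡ-≤ B (s≤s (s≤s (z≤n {1})))))))
    where
    arith₁ : ∀ k → suc (2 * k + 1) ≡ 2 * suc k
    arith₁ = ℕ-Solver.solve-∀
    bound : pos 3 ℤ.* j ≡ pos 2 ℤ.* k ⊎ pos 3 ℤ.* j ≡ ℤ.- (pos 2 ℤ.* k) ℤ.+ ℤ.1ℤ → 3 * ℤ.∣ j ∣ ≤ 2 * ℤ.∣ k ∣ + 1
    bound (inj₁ e) = ℕₚ.≤-trans (ℕₚ.≤-reflexive (≡.trans (≡.sym (ℤₚ.abs-* (pos 3) j))
      (≡.trans (cong ℤ.∣_∣ e) (ℤₚ.abs-* (pos 2) k)))) (ℕₚ.m≤m+n _ 1)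
    bound (inj₂ e) = ℕₚ.≤-trans (ℕₚ.≤-reflexive (≡.trans (≡.sym (ℤₚ.abs-* (pos 3) j)) (cong ℤ.∣_∣ e)))
      (ℕₚ.≤-trans (ℤₚ.∣i+j∣≤∣i∣+∣j∣ (ℤ.- (pos 2 ℤ.* k)) ℤ.1ℤ)
        (ℕₚ.≤-reflexive (cong (_+ 1) (≡.trans (ℤₚ.∣-i∣≡∣i∣ (pos 2 ℤ.* k)) (ℤₚ.abs-* (pos 2) k)))))
  k-onto : ∀ y k → ε 1 1 (pos 3 ℤ.* y) + ε 1 3 k ≡ 3 * n + 0 → Σ ℤ λ j → ι₃ j (parity j) ≡ k × ℤ.∣ j ∣ < B
  k-onto y k eq = cases (mod3 k)
    where
    cases : Mod3 k → Σ ℤ λ j → ι₃ j (parity j) ≡ k × ℤ.∣ j ∣ < B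
    cases (r0 b p) = pos 2 ℤ.* b , ≡.trans (ι₃-even b (parity (pos 2 ℤ.* b))) (≡.sym p)
      , third (pos 2 ℤ.* b) k (inj₁ (≡.trans (lemma b) (cong (pos 2 ℤ.*_) (≡.sym p)))) (k-bound (pos 3 ℤ.* y) k eq)
      where
      lemma : ∀ b → pos 3 ℤ.* (pos 2 ℤ.* b) ≡ pos 2 ℤ.* (pos 3 ℤ.* b)
      lemma = solve-∀
    cases (r1 b ≡.refl) = contradiction (≡.trans (poly y b) (polynomial (pos 3 ℤ.* y) k eq)) (3a+1≢3b X (pos n))
      where
      X = (pos 3 ℤ.* (y ℤ.* y) ℤ.+ (pos 6 ℤ.* (b ℤ.* b) ℤ.+ pos 3 ℤ.* b))
      poly : ∀ y b → pos 3 ℤ.* (pos 3 ℤ.* (y ℤ.* y) ℤ.+ (pos 6 ℤ.* (b ℤ.* b) ℤ.+ pos 3 ℤ.* b)) ℤ.+ ℤ.1ℤ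
               ≡ (pos 3 ℤ.* y) ℤ.* (pos 3 ℤ.* y) ℤ.+ (pos 2 ℤ.* ((pos 3 ℤ.* b ℤ.+ ℤ.1ℤ) ℤ.* (pos 3 ℤ.* b ℤ.+ ℤ.1ℤ)) ℤ.- (pos 3 ℤ.* b ℤ.+ ℤ.1ℤ))
      poly = solve-∀
    cases (r2 b p) = j , ≡.trans (ι₃-odd i (parity j)) (≡.trans (lemma₁ b) (≡.sym p))
      , third j k (inj₂ (≡.trans (lemma₂ b) (cong (λ z → ℤ.- (pos 2 ℤ.* z) ℤ.+ ℤ.1ℤ) (≡.sym p)))) (k-bound (pos 3 ℤ.* y) k eq)
      where
      -- Chosen so that 3b + 2 = -3i - 1.
      i = ℤ.- b ℤ.- ℤ.1ℤ
      j = pos 2 ℤ.* i ℤ.+ ℤ.1ℤ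
      lemma₁ : ∀ b → ℤ.- (pos 3 ℤ.* (ℤ.- b ℤ.- ℤ.1ℤ)) ℤ.- ℤ.1ℤ ≡ pos 3 ℤ.* b ℤ.+ pos 2
      lemma₁ = solve-∀
      lemma₂ : ∀ b → pos 3 ℤ.* (pos 2 ℤ.* (ℤ.- b ℤ.- ℤ.1ℤ) ℤ.+ ℤ.1ℤ) ≡ ℤ.- (pos 2 ℤ.* (pos 3 ℤ.* b ℤ.+ pos 2)) ℤ.+ ℤ.1ℤ
      lemma₂ = solve-∀

theta-cong : ∀ {u v u′ v′} ou ov ou′ ov′ → u ≋ u′ → v ≋ v′ →
             TripleProduct.theta u v ou ov ≋ TripleProduct.theta u′ v′ ou′ ov′
theta-cong ou ov ou′ ov′ p r = ⊕-cong ≋-refl (lim-cong (λ N → ∑-cong N (λ k _ →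
  ⊛-cong (↑-cong (tri (suc k)) (⊛-cong p r)) (⊕-cong (↑-cong (suc k) p) (↑-cong (suc k) r)))))

-- Eta quotients for the classes 4n + 2 and 4n + 1

module Φ (c : ℕ) .{{_ : NonZero c}} = Phi (q ↑ c) (oq↑ c)

φ-η : ∀ c .{{_ : NonZero c}} → Φ.φ c ⊛ E.η (2 * c) ≋ E.η (1 * c) ⊛ E.η (1 * c)
φ-η c = ≋-trans (⊛-cong ≋-refl (≋-sym (η-↑ q oq c (oq↑ c) 2)))
  (≋-trans (Φ.Y.φ⁻-product c) (⊛-cong (η-↑ q oq c (oq↑ c) 1) (η-↑ q oq c (oq↑ c) 1)))

-- This is A / q, so the classes 4n + 1 and 4n + 2 of A become the classes 4n and 4n + 1.
D : S
D = lim (λ N → ∑ N L.durfee)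

-- ψ(q⁶) f_6 = f_12² is a series in q^12; that is why multiplication by ψ(q⁶) is harmless for
-- sections modulo 4.
η²-D : E.η 12 ⊛ E.η 12 ⊛ D ≋ W
η²-D = begin
  E.η 12 ⊛ E.η 12 ⊛ D
    ≈⟨ ⊛-cong (⊛-cong (≋-sym (η-↑ q oq 6 (oq↑ 6) 2)) (≋-sym (η-↑ q oq 6 (oq↑ 6) 2))) ≋-refl ⟩
  E₆.η 2 ⊛ E₆.η 2 ⊛ D
    ≈⟨ ⊛-cong (≋-sym E₆.ψ-product) ≋-refl ⟩
  E₆.Θ.theta 1 3 ⊛ E₆.η 1 ⊛ D
    ≈⟨ ⊛-assoc _ _ _ ⟩
  E₆.Θ.theta 1 3 ⊛ (E₆.η 1 ⊛ D)
    ≈⟨ ⊛-cong ≋-refl (⊛-cong (≋-trans (η-↑ q oq 6 (oq↑ 6) 1) (≋-sym (E.qq∞-η 1 5))) ≋-refl) ⟩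
  E₆.Θ.theta 1 3 ⊛ (L.qq∞ ⊛ D)
    ≈⟨ ⊛-cong ≋-refl L.qq∞-durfee ⟩
  W ∎
  where open ≋-Reasoning

section-D : ∀ c → c < 4 → E.η 3 ⊛ E.η 3 ⊛ sec 4 c D ≋ sec 4 c W
section-D c c<4 = ≋-trans
  (≋-sym (Dil-⊛ 4 {E.η 3} {E.η 3} (Dil-η-q 4 3) (Dil-η-q 4 3) D c c<4)) (sec-≋ 4 c η²-D)

X Z : S
X = sec 4 1 D
Z = sec 4 0 D

Z-theta : E.η 3 ⊛ E.η 3 ⊛ Z ≋ E.Θ.theta 2 4 ⊛ V
Z-theta = ≋-trans (section-D 0 (s≤s z≤n)) W-even

X-theta : E.η 3 ⊛ E.η 3 ⊛ X ≋ E.Θ.theta 1 5 ⊛ V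
X-theta = ≋-trans (section-D 1 (s≤s (s≤s z≤n))) W-odd

-- X f_3² = f(q, q⁵) V, with both factors on the right replaced by their eta quotients and f_3² f_6
-- cancelled.
X-product : X ⊛ (E.η 1 ⊛ E.η 1) ⊛ E.η 4 ≋ E.η 2 ⊛ E.η 2 ⊛ E.η 2 ⊛ E.η 12
X-product = ⊛-cancel (Unit-⊛ (Unit-⊛ (E.η-Unit 3) (E.η-Unit 3)) (E.η-Unit 6)) (begin
  E.η 3 ⊛ E.η 3 ⊛ E.η 6 ⊛ (X ⊛ (E.η 1 ⊛ E.η 1) ⊛ E.η 4)
    ≈⟨ solve 5 (λ a b x c d → a :* a :* b :* (x :* (c :* c) :* d) := a :* a :* x :* (c :* b :* d :* c)) ≋-refl
         (E.η 3) (E.η 6) X (E.η 1) (E.η 4) ⟩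
  E.η 3 ⊛ E.η 3 ⊛ X ⊛ (E.η 1 ⊛ E.η 6 ⊛ E.η 4 ⊛ E.η 1)
    ≈⟨ ⊛-cong X-theta ≋-refl ⟩
  E.Θ.theta 1 5 ⊛ V ⊛ (E.η 1 ⊛ E.η 6 ⊛ E.η 4 ⊛ E.η 1)
    ≈⟨ solve 4 (λ t v a b → t :* v :* (a :* b) := t :* a :* (v :* b)) ≋-refl
         (E.Θ.theta 1 5) V (E.η 1 ⊛ E.η 6 ⊛ E.η 4) (E.η 1) ⟩
  E.Θ.theta 1 5 ⊛ (E.η 1 ⊛ E.η 6 ⊛ E.η 4) ⊛ (V ⊛ E.η 1)
    ≈⟨ ⊛-cong E.theta₁₅-product E.lambert₁₅-product ⟩
  E.η 2 ⊛ E.η 2 ⊛ E.η 3 ⊛ E.η 12 ⊛ (E.η 2 ⊛ E.η 3 ⊛ E.η 6)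
    ≈⟨ solve 4 (λ a b c d → a :* a :* b :* c :* (a :* b :* d) := b :* b :* d :* (a :* a :* a :* c)) ≋-refl
         (E.η 2) (E.η 3) (E.η 12) (E.η 6) ⟩
  E.η 3 ⊛ E.η 3 ⊛ E.η 6 ⊛ (E.η 2 ⊛ E.η 2 ⊛ E.η 2 ⊛ E.η 12) ∎)
  where open ≋-Reasoning

X-φ : X ⊛ Φ.φ 1 ≋ Φ.φ 2 ⊛ E.η 12
X-φ = ⊛-cancel (Unit-⊛ (E.η-Unit 2) (E.η-Unit 4)) (begin
  E.η 2 ⊛ E.η 4 ⊛ (X ⊛ Φ.φ 1)
    ≈⟨ solve 4 (λ a b x p → a :* b :* (x :* p) := x :* (p :* a) :* b) ≋-refl (E.η 2) (E.η 4) X (Φ.φ 1) ⟩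
  X ⊛ (Φ.φ 1 ⊛ E.η 2) ⊛ E.η 4
    ≈⟨ ⊛-cong (⊛-cong ≋-refl (φ-η 1)) ≋-refl ⟩
  X ⊛ (E.η 1 ⊛ E.η 1) ⊛ E.η 4
    ≈⟨ X-product ⟩
  E.η 2 ⊛ E.η 2 ⊛ E.η 2 ⊛ E.η 12
    ≈⟨ solve 2 (λ a c → a :* a :* a :* c := a :* (a :* a) :* c) ≋-refl (E.η 2) (E.η 12) ⟩
  E.η 2 ⊛ (E.η 2 ⊛ E.η 2) ⊛ E.η 12
    ≈⟨ ⊛-cong (⊛-cong ≋-refl (≋-sym (φ-η 2))) ≋-refl ⟩
  E.η 2 ⊛ (Φ.φ 2 ⊛ E.η 4) ⊛ E.η 12
    ≈⟨ solve 4 (λ a p b c → a :* (p :* b) :* c := a :* b :* (p :* c)) ≋-refl (E.η 2) (Φ.φ 2) (E.η 4) (E.η 12) ⟩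
  E.η 2 ⊛ E.η 4 ⊛ (Φ.φ 2 ⊛ E.η 12) ∎)
  where open ≋-Reasoning

-- In (1 + 2s)(1 + 2t) the cross term 4st drops out, so apart from f_12 only the exponents 0, j² and
-- 2j² survive.
X-mod-4 : X ≡₄ E.η 12 ⊛ (𝟏 ⊕ con (pos 2) ⊛ Φ.s 1 ⊕ con (pos 2) ⊛ Φ.s 2)
X-mod-4 = ≡₄-trans (Φ.invert-φ 1 X-φ) (E.η 12 ⊛ (Φ.s 1 ⊛ Φ.s 2) , ≋-trans
  (⊛-cong (⊛-cong (Φ.φ≋ 2) ≋-refl) (Φ.φ≋ 1))
  (solve 3 (λ e s t → (c1 :+ c2 :* t) :* e :* (c1 :+ c2 :* s)
     := e :* (c1 :+ c2 :* s :+ c2 :* t) :+ c4 :* (e :* (s :* t))) ≋-refl (E.η 12) (Φ.s 1) (Φ.s 2)))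

tri-square : ∀ k → tri k + tri k + k ≡ k * k
tri-square zero    = ≡.refl
tri-square (suc k) = ≡.trans (lemma₁ (tri k) k) (≡.trans (cong (λ z → z + (k + k + 1)) (tri-square k)) (lemma₂ k))
  where
  lemma₁ : ∀ t k → t + k + (t + k) + suc k ≡ t + t + k + (k + k + 1)
  lemma₁ = ℕ-Solver.solve-∀
  lemma₂ : ∀ k → k * k + (k + k + 1) ≡ suc k * suc k
  lemma₂ = ℕ-Solver.solve-∀

s-support : ∀ c .{{_ : NonZero c}} n → (∀ k → k * k * c ≢ n) → Φ.s c n ≡ ℤ.0ℤ
s-support c n ne = ≡.trans (coeff-∑ (suc n) (Φ.s-term c) n) (Σ<-0 (suc n) (λ k _ →
  ≡.trans (term≋ k n) (≡.trans (coeff-sg-q↑ (suc k) (suc k * suc k * c) n)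
    (≡.trans (cong (sgn (suc k) ℤ.*_) (δ-no (pos (suc k * suc k * c)) n (λ e → ne (suc k) (ℤₚ.+-injective e))))
             (ℤₚ.*-zeroʳ (sgn (suc k)))))))
  where
  y = q ↑ c
  term≋ : ∀ k → Φ.s-term c k ≋ sg (suc k) ⊛ q ↑ (suc k * suc k * c)
  term≋ k = ≋-trans
    (⊛-cong (≋-trans (↑-cong (tri (suc k)) (solve 1 (λ y → :- y :* :- y := y :* y) ≋-refl y)) (↑-⊛ y y (tri (suc k))))
            (⊖-↑ y (suc k)))
    (≋-trans (solve 4 (λ a b g w → a :* b :* (g :* w) := g :* (a :* b :* w)) ≋-refl
               (y ↑ tri (suc k)) (y ↑ tri (suc k)) (sg (suc k)) (y ↑ suc k))
      (⊛-cong ≋-refl (≋-trans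
        (≋-sym (≋-trans (↑-+ y (tri (suc k) + tri (suc k)) (suc k)) (⊛-cong (↑-+ y (tri (suc k)) (tri (suc k))) ≋-refl)))
        (≋-trans (↑-≡ y (tri-square (suc k))) (≋-sym (↑-* q (suc k * suc k) c))))))

-- As k divides 12, f_12 is a series in q^k and leaves the section as f_m. The remaining exponents
-- 0, j² and 2j² avoid the class of i.
X-vanishing : ∀ k .{{_ : NonZero k}} m .{{_ : NonZero m}} i → i < k → m * k ≡ 12 →
  (∀ n j → j * j * 1 ≢ k * n + i) → (∀ n j → j * j * 2 ≢ k * n + i) → i ≢ 0 →
  ∀ n → Σ ℤ λ h → X (k * n + i) ≡ pos 4 ℤ.* h
X-vanishing k m i i<k mk≡12 no₁ no₂ i≢0 n = ≡₄-coeff X-mod-4 (k * n + i)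
  (≡.trans (Dil-≋ k ≋-refl (≡⇒≋ E.η mk≡12) (Dil-η-q k m) G i i<k n)
    (≡.trans (⊛-cong ≋-refl sec-G n) (≡.trans (⊛-zeroʳ _ n) (coeff-𝟎 n))))
  where
  G = 𝟏 ⊕ con (pos 2) ⊛ Φ.s 1 ⊕ con (pos 2) ⊛ Φ.s 2
  coeff-𝟏-0 : ∀ n → n ≢ 0 → 𝟏 n ≡ ℤ.0ℤ
  coeff-𝟏-0 zero    p = contradiction ≡.refl p
  coeff-𝟏-0 (suc n) _ = coeff-𝟏-suc n
  double-0 : ∀ f n → f n ≡ ℤ.0ℤ → (con (pos 2) ⊛ f) n ≡ ℤ.0ℤ
  double-0 f n p = ≡.trans (coeff-con-⊛ (pos 2) f n) (cong (pos 2 ℤ.*_) p)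
  sec-G : sec k i G ≋ 𝟎
  sec-G n = ≡.trans (coeff-⊕ _ (con (pos 2) ⊛ Φ.s 2) e)
    (≡.trans (cong₂ ℤ._+_ (≡.trans (coeff-⊕ 𝟏 (con (pos 2) ⊛ Φ.s 1) e)
        (cong₂ ℤ._+_ (coeff-𝟏-0 e (λ p → i≢0 (ℕₚ.m+n≡0⇒n≡0 (k * n) p)))
                     (double-0 (Φ.s 1) e (s-support 1 e (no₁ n)))))
      (double-0 (Φ.s 2) e (s-support 2 e (no₂ n)))) (≡.sym (coeff-𝟎 n)))
    where e = k * n + i

-- The class 12n + 1

ψ⁻ : S
ψ⁻ = N.Θ.theta 1 3

η⁻-2 : N.η 2 ≋ E.η 2
η⁻-2 = E.η⁻-even 1

-- Gauss's product at -q, from which Π (1 - (-q)^n) = f_2³ / (f_1 f_4) is eliminated.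
ψ⁻-product : ψ⁻ ⊛ E.η 2 ≋ E.η 1 ⊛ E.η 4
ψ⁻-product = ⊛-cancel (Unit-⊛ (E.η-Unit 2) (E.η-Unit 2)) (begin
  E.η 2 ⊛ E.η 2 ⊛ (ψ⁻ ⊛ E.η 2)
    ≈⟨ solve 2 (λ a p → a :* a :* (p :* a) := p :* (a :* a :* a)) ≋-refl (E.η 2) ψ⁻ ⟩
  ψ⁻ ⊛ (E.η 2 ⊛ E.η 2 ⊛ E.η 2)
    ≈⟨ ⊛-cong ≋-refl (≋-sym E.η⁻-product) ⟩
  ψ⁻ ⊛ (N.η 1 ⊛ E.η 1 ⊛ E.η 4)
    ≈⟨ solve 4 (λ p n a b → p :* (n :* a :* b) := p :* n :* (a :* b)) ≋-refl ψ⁻ (N.η 1) (E.η 1) (E.η 4) ⟩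
  ψ⁻ ⊛ N.η 1 ⊛ (E.η 1 ⊛ E.η 4)
    ≈⟨ ⊛-cong (≋-trans N.ψ-product (⊛-cong η⁻-2 η⁻-2)) ≋-refl ⟩
  E.η 2 ⊛ E.η 2 ⊛ (E.η 1 ⊛ E.η 4) ∎)
  where open ≋-Reasoning

module E₃ = EtaIdentities (q ↑ 3) (oq↑ 3)

-- the product of 1 - (-q³)^n
M₃ : S
M₃ = E₃.Eta⁻.η 1

M₃-product : M₃ ⊛ E.η 3 ⊛ E.η 12 ≋ E.η 6 ⊛ E.η 6 ⊛ E.η 6
M₃-product = ≋-trans
  (⊛-cong (⊛-cong ≋-refl (≋-sym (η-↑ q oq 3 (oq↑ 3) 1))) (≋-sym (η-↑ q oq 3 (oq↑ 3) 4)))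
  (≋-trans E₃.η⁻-product (⊛-cong (⊛-cong η₆ η₆) η₆))
  where
  η₆ : E₃.η 2 ≋ E.η 6
  η₆ = η-↑ q oq 3 (oq↑ 3) 2

Z-product : Z ⊛ (E.η 3 ⊛ E.η 12) ⊛ E.η 1 ≋ E.η 4 ⊛ (E.η 6 ⊛ E.η 6 ⊛ E.η 6)
Z-product = ⊛-cancel (Unit-⊛ (E.η-Unit 2) (E.η-Unit 3)) (begin
  E.η 2 ⊛ E.η 3 ⊛ (Z ⊛ (E.η 3 ⊛ E.η 12) ⊛ E.η 1)
    ≈⟨ solve 5 (λ a b z c d → a :* b :* (z :* (b :* c) :* d) := b :* b :* z :* (a :* c :* d)) ≋-refl
         (E.η 2) (E.η 3) Z (E.η 12) (E.η 1) ⟩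
  E.η 3 ⊛ E.η 3 ⊛ Z ⊛ (E.η 2 ⊛ E.η 12 ⊛ E.η 1)
    ≈⟨ ⊛-cong Z-theta ≋-refl ⟩
  E.Θ.theta 2 4 ⊛ V ⊛ (E.η 2 ⊛ E.η 12 ⊛ E.η 1)
    ≈⟨ solve 4 (λ t v a b → t :* v :* (a :* b) := t :* a :* (v :* b)) ≋-refl
         (E.Θ.theta 2 4) V (E.η 2 ⊛ E.η 12) (E.η 1) ⟩
  E.Θ.theta 2 4 ⊛ (E.η 2 ⊛ E.η 12) ⊛ (V ⊛ E.η 1)
    ≈⟨ ⊛-cong E.theta₂₄-product E.lambert₁₅-product ⟩
  E.η 4 ⊛ (E.η 6 ⊛ E.η 6) ⊛ (E.η 2 ⊛ E.η 3 ⊛ E.η 6)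
    ≈⟨ solve 4 (λ a b c d → a :* (b :* b) :* (c :* d :* b) := c :* d :* (a :* (b :* b :* b))) ≋-refl
         (E.η 4) (E.η 6) (E.η 2) (E.η 3) ⟩
  E.η 2 ⊛ E.η 3 ⊛ (E.η 4 ⊛ (E.η 6 ⊛ E.η 6 ⊛ E.η 6)) ∎)
  where open ≋-Reasoning

Z-φ : Z ⊛ Φ.φ 1 ≋ M₃ ⊛ ψ⁻
Z-φ = ⊛-cancel (Unit-⊛ (Unit-⊛ (Unit-⊛ (E.η-Unit 3) (E.η-Unit 12)) (E.η-Unit 1)) (E.η-Unit 2)) (begin
  E.η 3 ⊛ E.η 12 ⊛ E.η 1 ⊛ E.η 2 ⊛ (Z ⊛ Φ.φ 1)
    ≈⟨ solve 6 (λ a b c d z p → a :* b :* c :* d :* (z :* p) := z :* (a :* b) :* c :* (p :* d)) ≋-refl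
         (E.η 3) (E.η 12) (E.η 1) (E.η 2) Z (Φ.φ 1) ⟩
  Z ⊛ (E.η 3 ⊛ E.η 12) ⊛ E.η 1 ⊛ (Φ.φ 1 ⊛ E.η 2)
    ≈⟨ ⊛-cong Z-product (φ-η 1) ⟩
  E.η 4 ⊛ (E.η 6 ⊛ E.η 6 ⊛ E.η 6) ⊛ (E.η 1 ⊛ E.η 1)
    ≈⟨ solve 3 (λ a s b → a :* s :* (b :* b) := s :* (b :* a) :* b) ≋-refl
         (E.η 4) (E.η 6 ⊛ E.η 6 ⊛ E.η 6) (E.η 1) ⟩
  E.η 6 ⊛ E.η 6 ⊛ E.η 6 ⊛ (E.η 1 ⊛ E.η 4) ⊛ E.η 1
    ≈⟨ ⊛-cong (⊛-cong (≋-sym M₃-product) (≋-sym ψ⁻-product)) ≋-refl ⟩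
  M₃ ⊛ E.η 3 ⊛ E.η 12 ⊛ (ψ⁻ ⊛ E.η 2) ⊛ E.η 1
    ≈⟨ solve 6 (λ a b c d m p → m :* a :* b :* (p :* d) :* c := a :* b :* c :* d :* (m :* p)) ≋-refl
         (E.η 3) (E.η 12) (E.η 1) (E.η 2) M₃ ψ⁻ ⟩
  E.η 3 ⊛ E.η 12 ⊛ E.η 1 ⊛ E.η 2 ⊛ (M₃ ⊛ ψ⁻) ∎)
  where open ≋-Reasoning

⊖-cube : (⊖ q) ↑ 3 ≋ ⊖ (q ↑ 3)
⊖-cube = solve 1 (λ q → :- q :* (:- q :* (:- q :* c1)) := :- (q :* (q :* (q :* c1)))) ≋-refl q

oq⁻³ : Ord 1 ((⊖ q) ↑ 3)
oq⁻³ = ≈-weaken (s≤s z≤n) (Ord₁-↑ oq⁻ 3)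

η⁻-3 : N.η 3 ≋ M₃
η⁻-3 = ≋-trans (≋-sym (η-↑ (⊖ q) oq⁻ 3 oq⁻³ 1))
  (Π∞-cong (λ j → ⊕-cong ≋-refl (⊖-cong (↑-cong (1 + j * 1) ⊖-cube))))

-- Φ⁺.φ is φ(q³).
module Φ⁺ = Phi ((⊖ q) ↑ 3) oq⁻³

φ⁺-η : Φ⁺.φ ⊛ E.η 6 ≋ M₃ ⊛ M₃
φ⁺-η = ≋-trans (⊛-cong ≋-refl (≋-sym (≋-trans (η-↑ (⊖ q) oq⁻ 3 oq⁻³ 2) (E.η⁻-even 3))))
  (≋-trans Φ⁺.Y.φ⁻-product (⊛-cong η₁ η₁))
  where
  η₁ : Φ⁺.Y.η 1 ≋ M₃
  η₁ = ≋-trans (η-↑ (⊖ q) oq⁻ 3 oq⁻³ 1) η⁻-3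

-- The classical φ(-y) φ(y) = φ(-y²)² at y = q³.
φφ⁺ : Φ.φ 3 ⊛ Φ⁺.φ ≋ Φ.φ 6 ⊛ Φ.φ 6
φφ⁺ = ⊛-cancel (Unit-⊛ (Unit-⊛ (E.η-Unit 6) (E.η-Unit 6)) (Unit-⊛ (E.η-Unit 12) (E.η-Unit 12))) (begin
  E.η 6 ⊛ E.η 6 ⊛ (E.η 12 ⊛ E.η 12) ⊛ (Φ.φ 3 ⊛ Φ⁺.φ)
    ≈⟨ solve 4 (λ a b p r → a :* a :* (b :* b) :* (p :* r) := p :* a :* (r :* a) :* (b :* b)) ≋-refl
         (E.η 6) (E.η 12) (Φ.φ 3) Φ⁺.φ ⟩
  Φ.φ 3 ⊛ E.η 6 ⊛ (Φ⁺.φ ⊛ E.η 6) ⊛ (E.η 12 ⊛ E.η 12)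
    ≈⟨ ⊛-cong (⊛-cong (φ-η 3) φ⁺-η) ≋-refl ⟩
  E.η 3 ⊛ E.η 3 ⊛ (M₃ ⊛ M₃) ⊛ (E.η 12 ⊛ E.η 12)
    ≈⟨ solve 3 (λ a m b → a :* a :* (m :* m) :* (b :* b) := m :* a :* b :* (m :* a :* b)) ≋-refl
         (E.η 3) M₃ (E.η 12) ⟩
  M₃ ⊛ E.η 3 ⊛ E.η 12 ⊛ (M₃ ⊛ E.η 3 ⊛ E.η 12)
    ≈⟨ ⊛-cong M₃-product M₃-product ⟩
  E.η 6 ⊛ E.η 6 ⊛ E.η 6 ⊛ (E.η 6 ⊛ E.η 6 ⊛ E.η 6)
    ≈⟨ solve 1 (λ a → a :* a :* a :* (a :* a :* a) := a :* a :* (a :* a :* (a :* a))) ≋-refl (E.η 6) ⟩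
  E.η 6 ⊛ E.η 6 ⊛ (E.η 6 ⊛ E.η 6 ⊛ (E.η 6 ⊛ E.η 6))
    ≈⟨ ⊛-cong ≋-refl (⊛-cong (≋-sym (φ-η 6)) (≋-sym (φ-η 6))) ⟩
  E.η 6 ⊛ E.η 6 ⊛ (Φ.φ 6 ⊛ E.η 12 ⊛ (Φ.φ 6 ⊛ E.η 12))
    ≈⟨ solve 3 (λ a p b → a :* a :* (p :* b :* (p :* b)) := a :* a :* (b :* b) :* (p :* p)) ≋-refl
         (E.η 6) (Φ.φ 6) (E.η 12) ⟩
  E.η 6 ⊛ E.η 6 ⊛ (E.η 12 ⊛ E.η 12) ⊛ (Φ.φ 6 ⊛ Φ.φ 6) ∎)
  where open ≋-Reasoning

-- The product for f(y, y²) at y = -q, combined with Π (1 - (-q³)^n)² = φ(q³) f_6.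
pentagonal-product : N.Θ.theta 1 2 ⊛ N.η 1 ≋ E.η 2 ⊛ Φ⁺.φ
pentagonal-product = ⊛-cancel (E.η-Unit 6) (begin
  E.η 6 ⊛ (N.Θ.theta 1 2 ⊛ N.η 1)
    ≈⟨ ≋-trans (solve 3 (λ e t n → e :* (t :* n) := t :* (n :* e)) ≋-refl (E.η 6) (N.Θ.theta 1 2) (N.η 1))
               (⊛-cong ≋-refl (⊛-cong ≋-refl (≋-sym (E.η⁻-even 3)))) ⟩
  N.Θ.theta 1 2 ⊛ (N.η 1 ⊛ N.η 6)
    ≈⟨ N.theta₁₂-product ⟩
  N.η 2 ⊛ (N.η 3 ⊛ N.η 3)
    ≈⟨ ⊛-cong η⁻-2 (≋-trans (⊛-cong η⁻-3 η⁻-3) (≋-sym φ⁺-η)) ⟩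
  E.η 2 ⊛ (Φ⁺.φ ⊛ E.η 6)
    ≈⟨ solve 3 (λ a p e → a :* (p :* e) := e :* (a :* p)) ≋-refl (E.η 2) Φ⁺.φ (E.η 6) ⟩
  E.η 6 ⊛ (E.η 2 ⊛ Φ⁺.φ) ∎)
  where open ≋-Reasoning

section-φψ : sec 3 0 (Φ.φ 1 ⊛ ψ⁻) ≋ Φ.φ 3 ⊛ N.Θ.theta 1 2
section-φψ = ≋-trans (sec-≋ 3 0 (⊛-cong (≋-sym φ₁) ≋-refl)) (≋-trans theta-3-section (⊛-cong φ₃ ≋-refl))
  where
  φ₁ : N.Θ.theta 1 1 ≋ Φ.φ 1
  φ₁ = theta-cong o₁ o₁ (Ord-⊖ (oq↑ 1)) (Ord-⊖ (oq↑ 1)) ⊖-1 ⊖-1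
    where
    o₁ : Ord 1 ((⊖ q) ↑ 1)
    o₁ = Ord₁-↑ oq⁻ 1
    ⊖-1 : (⊖ q) ↑ 1 ≋ ⊖ (q ↑ 1)
    ⊖-1 = solve 1 (λ q → :- q :* c1 := :- (q :* c1)) ≋-refl q
  φ₃ : N.Θ.theta 3 3 ≋ Φ.φ 3
  φ₃ = theta-cong oq⁻³ oq⁻³ (Ord-⊖ (oq↑ 3)) (Ord-⊖ (oq↑ 3)) ⊖-cube ⊖-cube

-- Modulo 4, Z is `M₃` ψ(-q) φ(-q). As a series in q³, `M₃` leaves the section as Π (1 - (-q)^n),
-- which is exactly the factor that completes f(-q, q²) to f_2 φ(q³). What remains beside f_2 is
-- φ(-q⁶)², a square that is 1 modulo 4.
Z₀-mod-4 : sec 3 0 Z ≡₄ E.η 2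
Z₀-mod-4 = ≡₄-trans (sec-≡₄ 3 0 (Φ.invert-φ 1 Z-φ)) (≡₄-trans (≋⇒≡₄ (begin
  sec 3 0 (M₃ ⊛ ψ⁻ ⊛ Φ.φ 1)
    ≈⟨ sec-≋ 3 0 (solve 3 (λ m p f → m :* p :* f := m :* (f :* p)) ≋-refl M₃ ψ⁻ (Φ.φ 1)) ⟩
  sec 3 0 (M₃ ⊛ (Φ.φ 1 ⊛ ψ⁻))
    ≈⟨ Dil-η 3 1 (⊖ q) oq⁻ (⊖ (q ↑ 3)) (Ord-⊖ (oq↑ 3)) (Dil-⊖ 3 (Dil-q 3)) (Φ.φ 1 ⊛ ψ⁻) 0 (s≤s z≤n) ⟩
  N.η 1 ⊛ sec 3 0 (Φ.φ 1 ⊛ ψ⁻)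
    ≈⟨ ⊛-cong ≋-refl section-φψ ⟩
  N.η 1 ⊛ (Φ.φ 3 ⊛ N.Θ.theta 1 2)
    ≈⟨ solve 3 (λ n f t → n :* (f :* t) := f :* (t :* n)) ≋-refl (N.η 1) (Φ.φ 3) (N.Θ.theta 1 2) ⟩
  Φ.φ 3 ⊛ (N.Θ.theta 1 2 ⊛ N.η 1)
    ≈⟨ ⊛-cong ≋-refl pentagonal-product ⟩
  Φ.φ 3 ⊛ (E.η 2 ⊛ Φ⁺.φ)
    ≈⟨ solve 3 (λ f e g → f :* (e :* g) := e :* (f :* g)) ≋-refl (Φ.φ 3) (E.η 2) Φ⁺.φ ⟩
  E.η 2 ⊛ (Φ.φ 3 ⊛ Φ⁺.φ)
    ≈⟨ ⊛-cong ≋-refl φφ⁺ ⟩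
  E.η 2 ⊛ (Φ.φ 6 ⊛ Φ.φ 6) ∎))
  (≡₄-trans (⊛-≡₄ (E.η 2) (Φ.φ² 6)) (≋⇒≡₄ (⊛-identityʳ _))))
  where open ≋-Reasoning

-- Writing f_2 as f_2 times 1 reduces its odd coefficients to the odd coefficients of 1.
Z-vanishing : ∀ n → Σ ℤ λ h → Z (3 * (2 * n + 1) + 0) ≡ pos 4 ℤ.* h
Z-vanishing n = ≡₄-coeff Z₀-mod-4 (2 * n + 1) (≡.trans (≋-sym (⊛-identityʳ (E.η 2)) (2 * n + 1))
  (≡.trans (Dil-η-q 2 1 𝟏 1 (s≤s (s≤s z≤n)) n)
    (≡.trans (⊛-cong ≋-refl sec-𝟏 n) (≡.trans (⊛-zeroʳ _ n) (coeff-𝟎 n)))))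
  where
  sec-𝟏 : sec 2 1 𝟏 ≋ 𝟎
  sec-𝟏 n = ≡.trans (cong 𝟏 (ℕₚ.+-comm (2 * n) 1)) (≡.trans (coeff-𝟏-suc (2 * n)) (≡.sym (coeff-𝟎 n)))

-- The generating function of pξ

fromℕ : Series → S
fromℕ f n = pos (f n)

coeff-shift : ∀ a f m → (q ↑ a ⊛ fromℕ f) m ≡ pos (shift a f m)
coeff-shift zero          f m       = ⊛-identityˡ (fromℕ f) m
coeff-shift (suc a)       f zero    = coeff-q↑⊛-< (suc a) (fromℕ f) 0 (s≤s z≤n)
coeff-shift (suc zero)    f (suc m) = ≡.trans (⊛-assoc q 𝟏 (fromℕ f) (suc m))
  (≡.trans (q⊛-suc (𝟏 ⊛ fromℕ f) m) (coeff-shift zero f m))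
coeff-shift (suc (suc a)) f (suc m) = ≡.trans (⊛-assoc q (q ↑ suc a) (fromℕ f) (suc m))
  (≡.trans (q⊛-suc (q ↑ suc a ⊛ fromℕ f) m) (coeff-shift (suc a) f m))

pos-sumTo : ∀ m f → pos (sumTo m f) ≡ Σ< (suc m) (λ i → pos (f i))
pos-sumTo zero    f = ≡.sym (ℤₚ.+-identityˡ (pos (f 0)))
pos-sumTo (suc m) f = cong (ℤ._+ pos (f (suc m))) (pos-sumTo m f)

-- Coefficient m of the product needs only the first m + 1 terms of the geometric series, and these
-- are the summands i ≤ m.
divGeom-geo : ∀ k .{{_ : NonZero k}} f → fromℕ (divGeom k f) ≋ geo (q ↑ k) ⊛ fromℕ f
divGeom-geo k f m = begin
  pos (divGeom k f m)
    ≡⟨ pos-sumTo m (λ i → shift (i * k) f m) ⟩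
  Σ< (suc m) (λ i → pos (shift (i * k) f m))
    ≡⟨ Σ<-cong (suc m) (λ i _ → ≡.trans (≡.sym (coeff-shift (i * k) f m))
         (≋-trans (⊛-comm _ (fromℕ f)) (⊛-cong ≋-refl (↑-* q i k)) m)) ⟩
  Σ< (suc m) (λ i → (fromℕ f ⊛ (q ↑ k) ↑ i) m)
    ≡⟨ ≡.sym (coeff-∑ (suc m) (λ i → fromℕ f ⊛ (q ↑ k) ↑ i) m) ⟩
  ∑ (suc m) (λ i → fromℕ f ⊛ (q ↑ k) ↑ i) m
    ≡⟨ ≋-trans (∑-⊛ˡ (suc m) (fromℕ f) ((q ↑ k) ↑_)) (⊛-comm (fromℕ f) _) m ⟩
  (geometric (q ↑ k) (suc m) ⊛ fromℕ f) m
    ≡⟨ ≡.sym (⊛-≈ {suc m} (lim-≈ (geo-stable (oq↑ k)) ℕₚ.≤-refl) (λ _ _ → ≡.refl) m ℕₚ.≤-refl) ⟩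
  (geo (q ↑ k) ⊛ fromℕ f) m ∎
  where open ≡.≡-Reasoning

geo-cong : ∀ {x y} → x ≋ y → geo x ≋ geo y
geo-cong p = lim-cong (λ N → ∑-cong N (λ i _ → ↑-cong i p))

invProd-∏ : ∀ n → fromℕ (invProd n) ≋ ∏ n L.e
invProd-∏ zero zero    = ≡.sym coeff-𝟏-zero
invProd-∏ zero (suc m) = ≡.sym (coeff-𝟏-suc m)
invProd-∏ (suc n) = begin
  fromℕ (divGeom (6 * n + 1) (divGeom (6 * n + 5) (invProd n)))
    ≈⟨ divGeom-geo (6 * n + 1) {{nz 0}} (divGeom (6 * n + 5) (invProd n)) ⟩
  geo (q ↑ (6 * n + 1)) ⊛ fromℕ (divGeom (6 * n + 5) (invProd n))
    ≈⟨ ⊛-cong ≋-refl (≋-trans (divGeom-geo (6 * n + 5) {{nz 4}} (invProd n)) (⊛-cong ≋-refl (invProd-∏ n))) ⟩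
  geo (q ↑ (6 * n + 1)) ⊛ (geo (q ↑ (6 * n + 5)) ⊛ ∏ n L.e)
    ≈⟨ ⊛-cong (factor 1) (⊛-cong (factor 5) ≋-refl) ⟩
  geo (q ↑ 1 ⊛ L.Q ↑ n) ⊛ (geo (q ↑ 5 ⊛ L.Q ↑ n) ⊛ ∏ n L.e)
    ≈⟨ solve 3 (λ a b c → a :* (b :* c) := c :* (a :* b)) ≋-refl
         (geo (q ↑ 1 ⊛ L.Q ↑ n)) (geo (q ↑ 5 ⊛ L.Q ↑ n)) (∏ n L.e) ⟩
  ∏ (suc n) L.e ∎
  where
  open ≋-Reasoning
  nz : ∀ c → NonZero (6 * n + suc c)
  nz c = ≡.subst NonZero (≡.sym (ℕₚ.+-suc (6 * n) c)) _
  factor : ∀ c → geo (q ↑ (6 * n + c)) ≋ geo (q ↑ c ⊛ L.Q ↑ n)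
  factor c = geo-cong (≋-trans (↑-≡ q (exponent n c))
    (≋-trans (↑-+ q c (n * 6)) (⊛-cong ≋-refl (≋-sym (E.Q-power 1 5 n)))))
    where
    exponent : ∀ n c → 6 * n + c ≡ c + n * 6
    exponent = ℕ-Solver.solve-∀

term-durfee : ∀ n → fromℕ (term (suc n)) ≋ q ⊛ L.durfee n
term-durfee n = begin
  fromℕ (shift (6 * suc n * suc n ∸ 6 * suc n + 1) (invProd (suc n)))
    ≈⟨ (λ m → ≡.sym (coeff-shift (6 * suc n * suc n ∸ 6 * suc n + 1) (invProd (suc n)) m)) ⟩
  q ↑ (6 * suc n * suc n ∸ 6 * suc n + 1) ⊛ fromℕ (invProd (suc n))
    ≈⟨ ⊛-cong (↑-≡ q exponent) (invProd-∏ (suc n)) ⟩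
  q ⊛ q ↑ (n * suc n * 6) ⊛ L.P 0 n
    ≈⟨ ≋-trans (⊛-assoc _ _ _) (⊛-cong ≋-refl (⊛-cong (≋-sym (E.Q-power 1 5 (n * suc n))) ≋-refl)) ⟩
  q ⊛ L.durfee n ∎
  where
  open ≋-Reasoning
  split : ∀ n → 6 * suc n * suc n ≡ n * suc n * 6 + 6 * suc n
  split = ℕ-Solver.solve-∀
  exponent : 6 * suc n * suc n ∸ 6 * suc n + 1 ≡ suc (n * suc n * 6)
  exponent = ≡.trans (cong (_+ 1) (≡.trans (cong (_∸ 6 * suc n) (split n)) (ℕₚ.m+n∸n≡m (n * suc n * 6) (6 * suc n))))
                     (ℕₚ.+-comm (n * suc n * 6) 1)

Σ<-sucˡ : ∀ N f → Σ< (suc N) f ≡ f 0 ℤ.+ Σ< N (λ i → f (suc i))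
Σ<-sucˡ zero    f = ℤₚ.+-comm ℤ.0ℤ (f 0)
Σ<-sucˡ (suc N) f = ≡.trans (cong (ℤ._+ f (suc N)) (Σ<-sucˡ N f)) (ℤₚ.+-assoc (f 0) _ (f (suc N)))

-- The excluded index 0 contributes nothing; the other m + 1 summands, each divided by q, are the
-- partial sum that defines coefficient m of `D`.
sum-D : ∀ m → pos (sumTo (suc m) (λ n → if 1 ≤ᵇ n then term n (suc m) else 0)) ≡ D m
sum-D m = begin
  pos (sumTo (suc m) f)
    ≡⟨ pos-sumTo (suc m) f ⟩
  Σ< (suc (suc m)) (λ i → pos (f i))
    ≡⟨ ≡.trans (Σ<-sucˡ (suc m) (λ i → pos (f i))) (ℤₚ.+-identityˡ _) ⟩
  Σ< (suc m) (λ i → pos (term (suc i) (suc m)))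
    ≡⟨ Σ<-cong (suc m) (λ i _ → ≡.trans (term-durfee i (suc m)) (q⊛-suc (L.durfee i) m)) ⟩
  Σ< (suc m) (λ i → L.durfee i m)
    ≡⟨ ≡.sym (coeff-∑ (suc m) L.durfee m) ⟩
  D m ∎
  where
  open ≡.≡-Reasoning
  f : ℕ → ℕ
  f n = if 1 ≤ᵇ n then term n (suc m) else 0

-- In positive degree the constant 1 of ξ is absent and the coefficient is twice that of A, so
-- divisibility of the latter by 4 is enough.
8∣pξ : ∀ {m n} → suc m ≡ n → (Σ ℤ λ h → D m ≡ pos 4 ℤ.* h) → 8 ∣ pξ n
8∣pξ {m} ≡.refl (h , p) = Div.*-monoʳ-∣ 2 (Div.divides ℤ.∣ h ∣
  (≡.trans (cong ℤ.∣_∣ (≡.trans (sum-D m) p)) (≡.trans (ℤₚ.abs-* (pos 4) h) (ℕₚ.*-comm 4 ℤ.∣ h ∣))))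

-- Quadratic residues and the three congruences

square-mod : ∀ c k .{{_ : NonZero k}} n i j → i < k → j * j * c ≡ k * n + i →
             Σ ℕ λ r → r < k × (r * r * c) % k ≡ i
square-mod c k n i j i<k e = j % k , DivMod.m%n<n j k , (begin
  ((j % k) * (j % k) * c) % k
    ≡⟨ DivMod.%-distribˡ-* ((j % k) * (j % k)) c k ⟩
  (((j % k) * (j % k)) % k * (c % k)) % k
    ≡⟨ cong (λ z → (z * (c % k)) % k) (≡.sym (DivMod.%-distribˡ-* j j k)) ⟩
  ((j * j) % k * (c % k)) % k
    ≡⟨ ≡.sym (DivMod.%-distribˡ-* (j * j) c k) ⟩
  (j * j * c) % k
    ≡⟨ cong (_% k) (≡.trans e (≡.trans (ℕₚ.+-comm (k * n) i) (cong (i +_) (ℕₚ.*-comm k n)))) ⟩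
  (i + n * k) % k
    ≡⟨ DivMod.[m+kn]%n≡m%n i n k ⟩
  i % k
    ≡⟨ DivMod.m<n⇒m%n≡m i<k ⟩
  i ∎)
  where open ≡.≡-Reasoning

-- The residue of c j² depends only on j modulo k, so a finite check excludes every j.
square-nonresidue : ∀ c k .{{_ : NonZero k}} i → i < k → (∀ {r} → r < k → (r * r * c) % k ≢ i) →
                    ∀ n j → j * j * c ≢ k * n + i
square-nonresidue c k i i<k no-residue n j e with square-mod c k n i j i<k e
... | r , r<k , p = no-residue r<k p

-- Modulo 4, squares are 0 or 1 and doubled squares 0 or 2.
4n+3 : ∀ n → Σ ℤ λ h → X (4 * n + 3) ≡ pos 4 ℤ.* h
4n+3 = X-vanishing 4 3 3 3<4 ≡.refl
  (square-nonresidue 1 4 3 3<4 (from-yes (ℕₚ.allUpTo? (λ r → ¬? ((r * r * 1) % 4 ℕ.≟ 3)) 4)))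
  (square-nonresidue 2 4 3 3<4 (from-yes (ℕₚ.allUpTo? (λ r → ¬? ((r * r * 2) % 4 ℕ.≟ 3)) 4))) (λ ())
  where
  3<4 : 3 < 4
  3<4 = ℕₚ.n<1+n 3

-- Modulo 6, squares are 0, 1, 3 or 4 and doubled squares 0 or 2.
6n+5 : ∀ n → Σ ℤ λ h → X (6 * n + 5) ≡ pos 4 ℤ.* h
6n+5 = X-vanishing 6 2 5 5<6 ≡.refl
  (square-nonresidue 1 6 5 5<6 (from-yes (ℕₚ.allUpTo? (λ r → ¬? ((r * r * 1) % 6 ℕ.≟ 5)) 6)))
  (square-nonresidue 2 6 5 5<6 (from-yes (ℕₚ.allUpTo? (λ r → ¬? ((r * r * 2) % 6 ℕ.≟ 5)) 6))) (λ ())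
  where
  5<6 : 5 < 6
  5<6 = ℕₚ.n<1+n 5

theorem5p4 : (n : ℕ) →
    (8 ∣ pξ (16 * n + 14)) × (8 ∣ pξ (24 * n + 13)) × (8 ∣ pξ (24 * n + 22))
theorem5p4 n = 8∣pξ (index₁ n) (4n+3 n) , 8∣pξ (index₂ n) (Z-vanishing n) , 8∣pξ (index₃ n) (6n+5 n)
  where
  index₁ : ∀ n → suc (4 * (4 * n + 3) + 1) ≡ 16 * n + 14
  index₁ = ℕ-Solver.solve-∀
  index₂ : ∀ n → suc (4 * (3 * (2 * n + 1) + 0) + 0) ≡ 24 * n + 13
  index₂ = ℕ-Solver.solve-∀
  index₃ : ∀ n → suc (4 * (6 * n + 5) + 1) ≡ 24 * n + 22
  index₃ = ℕ-Solver.solve-∀
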